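{- Let $p$ be an odd prime and let $0\le d\le e$ be integers. Let $\nu(d,e)$ denote the number of isomorphism classes of reciprocal pairs of regular dessins whose underlying graph is the complete bipartite graph $K_{p^d,p^e}$. Then (i) if $d=0$ then $\nu(d,e)=1$; (ii) if $0<d=e$ then $\nu(d,e)=\frac{1}{2}p^{e-1}(1+p^{e-1})$; (iii) if $0<d<e$ then $\nu(d,e)=p^{2d-1}$. Moreover, in each case every such dessin, coloured so that its black vertices have valency $p^d$, has type $(p^d,p^e,p^e)$ (black vertices of valency $p^d$, white vertices of valency $p^e$, every face of length $2p^e$), and its supporting surface has genus $\frac{1}{2}(p^d-1)(p^e-2)$.
   Context: A dessin is a $2$-cell embedding of a connected bipartite graph, whose vertices are properly $2$-coloured black and white, into an orientable closed surface. An automorphism of a dessin is a permutation of the edges preserving the graph structure and the vertex colours and extending to an orientation-preserving self-homeomorphism of the surface; the automorphisms form a group acting semiregularly on the edges, and the dessin is regular if this action is transitive. Two dessins are isomorphic if there is a bijection of edges induced by a colour-preserving, orientation-preserving homeomorphism of the surfaces mapping one embedded graph onto the other. The reciprocal dessin $\mathcal D^*$ of $\mathcal D$ is obtained by interchanging the two vertex colours; dessins thus occur in reciprocal pairs $\{\mathcal D,\mathcal D^*\}$ (which consist of a single dessin when $\mathcal D\cong\mathcal D^*$). The type of a regular dessin is $(l,m,n)$ where $l$, $m$ are the valencies of the black and white vertices and every face has length $2n$. -}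

module Defs where

open import Data.Nat using (ℕ; zero; suc; _+_; _*_; _<_)
open import Data.Fin using (Fin)
open import Data.Fin.Permutation using (Permutation; Permutation′; _⟨$⟩ʳ_; _⟨$⟩ˡ_)
open import Data.Product using (Σ; ∃; _×_; _,_; proj₁)
open import Data.Sum using (_⊎_)
open import Relation.Nullary using (¬_)
open import Relation.Binary.PropositionalEquality using (_≡_; _≢_)
open import Function.Bundles using (_⇔_)

-- Combinatorial model of dessins (standard permutation representation).
-- A dessin with N edges (labelled by Fin N) is a pair of permutations
-- (a , b) of the edges: a rotates edges around black vertices, b around
-- white vertices (following the orientation).  Black vertices = cycles
-- of a, white vertices = cycles of b, faces = cycles of a∘b (a face of
-- length 2n corresponds to a cycle of length n).  Connectedness of the
-- graph = transitivity of the monodromy group ⟨a , b⟩.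

iter : ∀ {N} → Permutation′ N → ℕ → Fin N → Fin N
iter σ zero    x = x
iter σ (suc k) x = σ ⟨$⟩ʳ iter σ k x

comp : ∀ {N} → Permutation′ N → Permutation′ N → Fin N → Fin N
comp a b x = a ⟨$⟩ʳ (b ⟨$⟩ʳ x)

data Reach {N : ℕ} (a b : Permutation′ N) : Fin N → Fin N → Set where
  here  : ∀ {x} → Reach a b x x
  stepa : ∀ {x y} → Reach a b x y → Reach a b x (a ⟨$⟩ʳ y)
  stepb : ∀ {x y} → Reach a b x y → Reach a b x (b ⟨$⟩ʳ y)
  stepa⁻ : ∀ {x y} → Reach a b x y → Reach a b x (a ⟨$⟩ˡ y)
  stepb⁻ : ∀ {x y} → Reach a b x y → Reach a b x (b ⟨$⟩ˡ y)

record Dessin : Set where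
  constructor mkDessin
  field
    N          : ℕ
    a          : Permutation′ N
    b          : Permutation′ N
    transitive : ∀ x y → Reach a b x y
open Dessin public

reciprocal : Dessin → Dessin
reciprocal (mkDessin N a b t) = mkDessin N b a (λ x y → swapR (t x y))
  where
  swapR : ∀ {x y} → Reach a b x y → Reach b a x y
  swapR here       = here
  swapR (stepa r)  = stepb (swapR r)
  swapR (stepb r)  = stepa (swapR r)
  swapR (stepa⁻ r) = stepb⁻ (swapR r)
  swapR (stepb⁻ r) = stepa⁻ (swapR r)

Iso : Dessin → Dessin → Set
Iso D E = Σ (Permutation (N D) (N E)) λ φ →
  (∀ x → φ ⟨$⟩ʳ (a D ⟨$⟩ʳ x) ≡ a E ⟨$⟩ʳ (φ ⟨$⟩ʳ x)) ×
  (∀ x → φ ⟨$⟩ʳ (b D ⟨$⟩ʳ x) ≡ b E ⟨$⟩ʳ (φ ⟨$⟩ʳ x))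

Regular : Dessin → Set
Regular D = ∀ x y → Σ (Iso D D) λ φ → proj₁ φ ⟨$⟩ʳ x ≡ y

SameOrbit : ∀ {N} → Permutation′ N → Fin N → Fin N → Set
SameOrbit σ x y = ∃ λ k → iter σ k x ≡ y

-- The underlying (uncoloured-part-labelled) graph is K_{m,n} with the m
-- vertices of the first part black and the n of the second part white:
-- β/ω label black/white vertices (cycles of a / cycles of b), and every
-- (black,white) pair is joined by exactly one edge.
IsCompleteBipartite : Dessin → ℕ → ℕ → Set
IsCompleteBipartite D m n =
  Σ (Fin (N D) → Fin m) λ β → Σ (Fin (N D) → Fin n) λ ω →
    (∀ x y → (β x ≡ β y) ⇔ SameOrbit (a D) x y) ×
    (∀ x y → (ω x ≡ ω y) ⇔ SameOrbit (b D) x y) ×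
    (∀ x y → β x ≡ β y → ω x ≡ ω y → x ≡ y) ×
    (∀ i j → ∃ λ x → β x ≡ i × ω x ≡ j)

UnderlyingK : Dessin → ℕ → ℕ → Set
UnderlyingK D m n = IsCompleteBipartite D m n ⊎ IsCompleteBipartite D n m

ClassCount : (A : Set) → (A → Set) → (A → A → Set) → ℕ → Set
ClassCount A P R k = Σ (Fin k → A) λ xs →
  (∀ i → P (xs i)) ×
  (∀ i j → R (xs i) (xs j) → i ≡ j) ×
  (∀ x → P x → ∃ λ i → R x (xs i))

SamePair : Dessin → Dessin → Set
SamePair D E = Iso D E ⊎ Iso D (reciprocal E)

CycleLength : ∀ {N} → Permutation′ N → Fin N → ℕ → Set
CycleLength σ x k = 0 < k × iter σ k x ≡ x × (∀ j → 0 < j → j < k → iter σ j x ≢ x)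

NumCycles : ∀ {N} → (Fin N → Fin N) → ℕ → Set
NumCycles {N} f k = ClassCount (Fin N) (λ _ → ⊤) (λ x y → ∃ λ j → iterf j x ≡ y) k
  where
  open import Data.Unit using (⊤)
  iterf : ℕ → Fin N → Fin N
  iterf zero x = x
  iterf (suc j) x = f (iterf j x)

-- type (l,m,n): black valency l, white valency m, faces of length 2n
HasType : Dessin → ℕ → ℕ → ℕ → Set
HasType D l m n = ∀ x →
  CycleLength (a D) x l × CycleLength (b D) x m × FaceLen x
  where
  FaceLen : Fin (N D) → Set
  FaceLen x = 0 < n × iterab n x ≡ x × (∀ j → 0 < j → j < n → iterab j x ≢ x)
    where
    iterab : ℕ → Fin (N D) → Fin (N D)
    iterab zero y = y
    iterab (suc j) y = comp (a D) (b D) (iterab j y)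

-- genus via Euler's formula  V − E + F = 2 − 2g
Genus : Dessin → ℕ → Set
Genus D g = ∃ λ vb → ∃ λ vw → ∃ λ f →
  NumCycles (a D ⟨$⟩ʳ_) vb × NumCycles (b D ⟨$⟩ʳ_) vw ×
  NumCycles (comp (a D) (b D)) f ×
  vb + vw + f + 2 * g ≡ 2 + N D

{-# OPTIONS --safe #-}

-- A regular dessin with underlying graph K_{pᵈ,pᵉ} is a group G = ⟨a⟩⟨b⟩ with a and b of orders pᵈ and pᵉ and
-- ⟨a⟩ ∩ ⟨b⟩ = 1.  Each such G is a regular group of affine maps with scalar linear part on ℤ/pᵈ × ℤ/pᵉ, where
-- a : v ↦ (1 + α) v + (1 , 0) and b : v ↦ (1 + β) v + (0 , 1), p divides α and β, α pᵈ ≡ 0 mod pᵉ and β pᵉ ≡ 0 mod pᵈ.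
-- This goes by induction on d + e.  If d ≤ e, then z = b^(p^(e−1)) is central, because ⟨b⟩ fixes the coset ⟨b⟩ and so has
-- orbits shorter than pᵉ on the others, and because a p-group acts trivially on ⟨z⟩.  Let b aⁱ = a^φ(i) b^π(i).  The
-- obstruction to lifting the coordinates from G/⟨z⟩ to G is a function g : ℤ/pᵉ → ℤ/p with
-- g(i + k) = g(i) + Σ_{t < π(i)} g(φᵗ k).  As π(i) ≡ 1 and, p being odd, Σ_{t < π(i)} t ≡ 0 mod p, every period pʲ⁺¹
-- of g descends to pʲ; so g vanishes once α is lifted in such a way that g(1) = 0.
-- The relation b a = aʳ bˢ determines α mod pᵉ and β mod pᵈ, so the dessins are counted by the pairs (α , β), which
-- reciprocity exchanges when d = e.  The face permutation a b is affine with linear part (1 + α)(1 + β), whence the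
-- length of its cycles and the genus.

module Submission where

open import Algebra.Bundles using (Monoid)
open import Data.Empty using (⊥; ⊥-elim)
open import Data.Fin as Fin using (Fin; toℕ; fromℕ<; splitAt; join; combine; remQuot)
open import Data.Fin.Permutation using (Permutation′; permutation; _⟨$⟩ʳ_; _⟨$⟩ˡ_; inverseˡ; inverseʳ)
import Data.Fin.Properties as Fin
open import Data.Integer.Tactic.RingSolver
open import Data.Nat as ℕ using (ℕ; zero; suc)
open import Data.Nat.DivMod as ℕ using (m≡m%n+[m/n]*n)
open import Data.Nat.Divisibility as ℕ using (_∣_; divides; ∣m+n∣m⇒∣n; ∣-trans; n∣m*n; _∣?_; ∣⇒≤; *-cancelˡ-∣; m∣m*n)
open import Data.Nat.GeneralisedArithmetic using (fold)
open import Data.Nat.Primality using (Prime; euclidsLemma; prime⇒nonZero; prime⇒nonTrivial)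
import Data.Nat.Properties as ℕ
open import Data.Product using (∃; _×_; _,_; proj₁; proj₂; ∃₂)
open import Data.Sum using (_⊎_; inj₁; inj₂)
open import Data.Unit using (tt)
open import Function.Bundles using (_⇔_; mk⇔; module Equivalence)
open import Level using (0ℓ)
open import Relation.Binary.PropositionalEquality using (_≡_)
open import Relation.Nullary using (yes; no; ¬_; contradiction)

-- In the affine model aⁱ bʲ sends the origin to (geo L i, Lⁱ geo M j), where L = 1 + α, M = 1 + β
-- and geo L i = 1 + L + ... + Lⁱ⁻¹. Finding coordinates thus amounts to solving geo L φ(i) = M geo
-- L i modulo pᵈ and L^φ(i) geo M π(i) = 1 modulo pᵉ for the relations b aⁱ = a^φ(i) b^π(i). A chart
-- of G/⟨z⟩ gives the second equation only modulo pᵉ⁻¹, and the missing digit is g(i). The obstacle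
-- is that a single digit of α is free while every value of g has to vanish; the cocycle identity
-- closes this gap. Since L - 1 is not invertible, geometric sums replace (Lⁱ - 1)/(L - 1), and for
-- odd p the map i ↦ geo L i permutes ℤ/pᵏ, so it can be inverted like an exponential. The two
-- moduli differ: α pᵈ ≡ 0 and β pᵉ ≡ 0 are what gives αX a meaning modulo pᵉ and βY a meaning
-- modulo pᵈ.

module Congruences where

  open import Data.Integer hiding (suc)
  open import Data.Integer.Properties
  open import Relation.Binary.PropositionalEquality hiding ([_])

  -- Congruences between integers, with explicit quotients, and geometric sums

  infix 4 _≡_[_]

  -- The quotient is kept as data because the obstruction to lifting a chart is read off as such a
  -- quotient.
  record _≡_[_] (x y n : ℤ) : Set where
    constructor by
    field
      quotient : ℤ
      equation : x - y ≡ n * quotient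

  private variable x y z w n m : ℤ

  ≡⇒≡[] : x ≡ y → x ≡ y [ n ]
  ≡⇒≡[] {x} {n = n} refl = by 0ℤ (trans (+-inverseʳ x) (sym (*-zeroʳ n)))

  ≡-refl : x ≡ x [ n ]
  ≡-refl = ≡⇒≡[] refl

  scale : ∀ c → c * n ≡ m → x ≡ y [ n ] → c * x ≡ c * y [ m ]
  scale {n} {x = x} {y} c refl (by q e) =
    by q (trans (lem c x y) (trans (cong (c *_) e) (lem′ c n q)))
    where
    lem : ∀ c x y → c * x - c * y ≡ c * (x - y)
    lem = solve-∀
    lem′ : ∀ c n q → c * (n * q) ≡ c * n * q
    lem′ = solve-∀

  -- A difference written as an integer combination of known differences reduces a congruence to a
  -- ring identity; the coefficients given to `comb₁`, `comb₂` and `comb₃` in later proofs are those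
  -- of such a combination.
  comb₁ : ∀ c → x ≡ y [ n ] → z - w ≡ c * (x - y) → z ≡ w [ n ]
  comb₁ {n = n} c (by q e) e′ = by (c * q) (trans e′ (trans (cong (c *_) e) (lem c n q)))
    where
    lem : ∀ c n q → c * (n * q) ≡ n * (c * q)
    lem = solve-∀

  -- With `c` = α, `n` = pᵈ and `m` = pᵉ, this is how a coordinate known only modulo pᵈ enters an
  -- expression modulo pᵉ.
  scale-kills : ∀ c → c * n ≡ 0ℤ [ m ] → x ≡ y [ n ] → c * x ≡ c * y [ m ]
  scale-kills {n} {m} {x} {y} c c*n≡0 (by q e) = comb₁ q c*n≡0
    (trans (lem c x y) (trans (cong (c *_) e) (lem′ c n q)))
    where
    lem : ∀ c x y → c * x - c * y ≡ c * (x - y)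
    lem = solve-∀
    lem′ : ∀ c n q → c * (n * q) ≡ q * (c * n - 0ℤ)
    lem′ = solve-∀

  comb₂ : ∀ {x₁ y₁ x₂ y₂} c₁ c₂ → x₁ ≡ y₁ [ n ] → x₂ ≡ y₂ [ n ] →
          z - w ≡ c₁ * (x₁ - y₁) + c₂ * (x₂ - y₂) → z ≡ w [ n ]
  comb₂ {n = n} c₁ c₂ (by q e) (by q′ e′) e″ = by (c₁ * q + c₂ * q′)
    (trans e″ (trans (cong₂ (λ s t → c₁ * s + c₂ * t) e e′) (lem c₁ c₂ n q q′)))
    where
    lem : ∀ c c′ n q q′ → c * (n * q) + c′ * (n * q′) ≡ n * (c * q + c′ * q′)
    lem = solve-∀

  comb₃ : ∀ {x₁ y₁ x₂ y₂ x₃ y₃} c₁ c₂ c₃ →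
          x₁ ≡ y₁ [ n ] → x₂ ≡ y₂ [ n ] → x₃ ≡ y₃ [ n ] →
          z - w ≡ c₁ * (x₁ - y₁) + c₂ * (x₂ - y₂) + c₃ * (x₃ - y₃) → z ≡ w [ n ]
  comb₃ {n = n} c₁ c₂ c₃ (by q e) (by q′ e′) (by q″ e″) e‴ = by (c₁ * q + c₂ * q′ + c₃ * q″)
    (trans e‴ (trans (cong₂ _+_ (cong₂ (λ s t → c₁ * s + c₂ * t) e e′) (cong (c₃ *_) e″))
      (lem c₁ c₂ c₃ n q q′ q″)))
    where
    lem : ∀ c c′ c″ n q q′ q″ → c * (n * q) + c′ * (n * q′) + c″ * (n * q″) ≡ n * (c * q + c′ * q′ + c″ * q″)
    lem = solve-∀

  ≡-sym : x ≡ y [ n ] → y ≡ x [ n ]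
  ≡-sym {x} {y} h = comb₁ -1ℤ h (lem x y)
    where
    lem : ∀ x y → y - x ≡ -1ℤ * (x - y)
    lem = solve-∀

  ≡-trans : x ≡ y [ n ] → y ≡ z [ n ] → x ≡ z [ n ]
  ≡-trans {x} {y} {z = z} h h′ = comb₂ 1ℤ 1ℤ h h′ (lem x y z)
    where
    lem : ∀ x y z → x - z ≡ 1ℤ * (x - y) + 1ℤ * (y - z)
    lem = solve-∀

  +-cong : x ≡ y [ n ] → z ≡ w [ n ] → x + z ≡ y + w [ n ]
  +-cong {x} {y} {_} {z} {w} h h′ = comb₂ 1ℤ 1ℤ h h′ (lem x y z w)
    where
    lem : ∀ x y z w → (x + z) - (y + w) ≡ 1ℤ * (x - y) + 1ℤ * (z - w)
    lem = solve-∀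

  *-cong : x ≡ y [ n ] → z ≡ w [ n ] → x * z ≡ y * w [ n ]
  *-cong {x} {y} {_} {z} {w} h h′ = comb₂ z y h h′ (lem x y z w)
    where
    lem : ∀ x y z w → (x * z) - (y * w) ≡ z * (x - y) + y * (z - w)
    lem = solve-∀

  *-congˡ : ∀ c → x ≡ y [ n ] → c * x ≡ c * y [ n ]
  *-congˡ c h = *-cong {c} {c} ≡-refl h

  +-congˡ : ∀ c → x ≡ y [ n ] → c + x ≡ c + y [ n ]
  +-congˡ c h = +-cong {c} {c} ≡-refl h

  neg-cong : x ≡ y [ n ] → - x ≡ - y [ n ]
  neg-cong {x} {y} h = comb₁ -1ℤ h (lem x y)
    where
    lem : ∀ x y → - x - - y ≡ -1ℤ * (x - y)
    lem = solve-∀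

  ^-cong : ∀ k → x ≡ y [ n ] → x ^ k ≡ y ^ k [ n ]
  ^-cong zero    h = ≡-refl
  ^-cong (suc k) h = *-cong h (^-cong k h)

  weaken : ∀ c → n * c ≡ m → x ≡ y [ m ] → x ≡ y [ n ]
  weaken {n} c refl (by q e) = by (c * q) (trans e (*-assoc n c q))

  0[]⇒ : ∀ {x y} → x ≡ 0ℤ [ y ] → ∃ λ q → x ≡ y * q
  0[]⇒ {x} (by q e) = q , trans (sym (+-identityʳ x)) e

  ⇒0[] : ∀ {x y} q → x ≡ y * q → x ≡ 0ℤ [ y ]
  ⇒0[] {x} q e = by q (trans (+-identityʳ x) e)

  ∣⇒0[] : ∀ {k m} → m ℕ.∣ k → + k ≡ 0ℤ [ + m ]
  ∣⇒0[] {k} {m} (ℕ.divides q refl) = ⇒0[] (+ q) (trans (pos-* q m) (*-comm (+ q) (+ m)))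

  0[]⇒∣ : ∀ {k m} → + k ≡ 0ℤ [ + m ] → m ℕ.∣ k
  0[]⇒∣ {k} {m} h with 0[]⇒ h
  ... | q , e = ℕ.divides ∣ q ∣ (trans (cong ∣_∣ e) (trans (abs-* (+ m) q) (ℕ.*-comm m ∣ q ∣)))

  private
    shift : ∀ {i j m} → i ℕ.≤ j → + j ≡ + i [ + m ] → ∃ λ s → j ≡ i ℕ.+ m ℕ.* s
    shift {i} {j} {m} i≤j (by q e) with 0[]⇒∣ {j ℕ.∸ i} {m} (⇒0[] q
      (trans (sym (⊖-≥ i≤j)) (trans (sym (m-n≡m⊖n j i)) e)))
    ... | ℕ.divides s e′ = s , trans (sym (ℕ.m+[n∸m]≡n i≤j)) (cong (i ℕ.+_) (trans e′ (ℕ.*-comm s m)))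

  difference : ∀ {i j m} → + i ≡ + j [ + m ] →
               (∃ λ s → j ≡ i ℕ.+ m ℕ.* s) ⊎ (∃ λ s → i ≡ j ℕ.+ m ℕ.* s)
  difference {i} {j} h with ℕ.≤-total i j
  ... | inj₁ i≤j = inj₁ (shift i≤j (≡-sym h))
  ... | inj₂ j≤i = inj₂ (shift j≤i h)

  -- The sum 1 + L + ... + Lⁿ⁻¹, which is the image of 0 under the n-th iterate of x ↦ 1 + L x.
  geo : ℤ → ℕ → ℤ
  geo L zero    = 0ℤ
  geo L (suc n) = 1ℤ + L * geo L n

  geo-cong : ∀ k → x ≡ y [ n ] → geo x k ≡ geo y k [ n ]
  geo-cong zero    h = ≡-refl
  geo-cong (suc k) h = +-congˡ 1ℤ (*-cong h (geo-cong k h))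

  geo-+ : ∀ L i j → geo L (i ℕ.+ j) ≡ geo L i + L ^ i * geo L j
  geo-+ L zero    j = lem (geo L j)
    where
    lem : ∀ g → g ≡ 0ℤ + 1ℤ * g
    lem = solve-∀
  geo-+ L (suc i) j = trans (cong (λ t → 1ℤ + L * t) (geo-+ L i j)) (lem L (geo L i) (L ^ i) (geo L j))
    where
    lem : ∀ L g u h → 1ℤ + L * (g + u * h) ≡ 1ℤ + L * g + L * u * h
    lem = solve-∀

  geo-* : ∀ L i j → geo L (i ℕ.* j) ≡ geo L i * geo (L ^ i) j
  geo-* L i zero    = trans (cong (geo L) (ℕ.*-zeroʳ i)) (sym (*-zeroʳ (geo L i)))
  geo-* L i (suc j) = trans (cong (geo L) (ℕ.*-suc i j)) (trans (geo-+ L i (i ℕ.* j))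
    (trans (cong (λ t → geo L i + L ^ i * t) (geo-* L i j)) (lem (geo L i) (L ^ i) (geo (L ^ i) j))))
    where
    lem : ∀ g u h → g + u * (g * h) ≡ g * (1ℤ + u * h)
    lem = solve-∀

  -- Turns powers into geometric sums with a factor x in front; for x = α that factor lets a sum
  -- known modulo pᵈ determine the power modulo pᵉ.
  ^-geo : ∀ x i → (1ℤ + x) ^ i ≡ 1ℤ + x * geo (1ℤ + x) i
  ^-geo x zero    = lem x
    where
    lem : ∀ x → 1ℤ ≡ 1ℤ + x * 0ℤ
    lem = solve-∀
  ^-geo x (suc i) = trans (cong ((1ℤ + x) *_) (^-geo x i)) (lem x (geo (1ℤ + x) i))
    where
    lem : ∀ x g → (1ℤ + x) * (1ℤ + x * g) ≡ 1ℤ + x * (1ℤ + (1ℤ + x) * g)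
    lem = solve-∀

  geo-1 : ∀ i → geo 1ℤ i ≡ + i
  geo-1 zero    = refl
  geo-1 (suc i) = cong (λ t → 1ℤ + t) (trans (*-identityˡ (geo 1ℤ i)) (geo-1 i))

  geo≡ : ∀ i → x ≡ 1ℤ [ n ] → geo x i ≡ + i [ n ]
  geo≡ i h = ≡-trans (geo-cong i h) (≡⇒≡[] (geo-1 i))

  ^≡1 : ∀ i → x ≡ 1ℤ [ n ] → x ^ i ≡ 1ℤ [ n ]
  ^≡1 i h = ≡-trans (^-cong i h) (≡⇒≡[] (^-zeroˡ i))

-- Geometric sums modulo powers of an odd number `p`

module OddPrimePower (p h : ℕ) (p-odd : p ≡ 1 ℕ.+ 2 ℕ.* h) where

  open import Relation.Binary.PropositionalEquality hiding ([_])
  open import Data.Integer hiding (suc)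
  open import Data.Integer.Properties
  open import Data.Integer.DivMod using (_%ℕ_; _/ℕ_; n%ℕd<d; a≡a%ℕn+[a/ℕn]*n)
  open Congruences

  P : ℤ
  P = + p

  private
    H : ℤ
    H = + h

    P≡1+2H : P ≡ 1ℤ + + 2 * H
    P≡1+2H = trans (cong +_ p-odd) (cong (λ t → 1ℤ + t) (pos-* 2 h))

  instance
    p-nonZero : ℕ.NonZero p
    p-nonZero = subst ℕ.NonZero (sym p-odd) _

  pos-^ : ∀ k → + (p ℕ.^ k) ≡ P ^ k
  pos-^ zero    = refl
  pos-^ (suc k) = trans (pos-* p (p ℕ.^ k)) (cong (P *_) (pos-^ k))

  ^-weaken : ∀ {x y i j} → i ℕ.≤ j → x ≡ y [ P ^ j ] → x ≡ y [ P ^ i ]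
  ^-weaken {i = i} {j} i≤j = weaken (P ^ (j ℕ.∸ i))
    (trans (sym (^-distribˡ-+-* P i (j ℕ.∸ i))) (cong (P ^_) (ℕ.m+[n∸m]≡n i≤j)))

  ≡[p^0] : ∀ {x y} → x ≡ y [ P ^ 0 ]
  ≡[p^0] {x} {y} = by (x - y) (sym (*-identityˡ (x - y)))

  modP : ∀ {x y} → x ≡ y [ P ] → x ≡ y [ P ^ 1 ]
  modP {x} {y} = subst (x ≡ y [_]) (sym (*-identityʳ P))

  modP⁻ : ∀ {x y} k → x ≡ y [ P ^ suc k ] → x ≡ y [ P ]
  modP⁻ k = weaken (P ^ k) refl

  P≡0 : P ≡ 0ℤ [ P ]
  P≡0 = ⇒0[] 1ℤ (sym (*-identityʳ P))

  p^≡0 : ∀ k → + (p ℕ.^ k) ≡ 0ℤ [ P ^ k ]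
  p^≡0 k = ⇒0[] 1ℤ (trans (pos-^ k) (sym (*-identityʳ (P ^ k))))

  -- The sum of all t < n, that is n(n - 1)/2: the derivative of `geo` at the base 1.
  tri : ℕ → ℤ
  tri zero    = 0ℤ
  tri (suc n) = + n + tri n

  private
    2tri : ∀ n → + 2 * tri n ≡ + n * + n - + n
    2tri zero    = refl
    2tri (suc n) = trans (*-distribˡ-+ (+ 2) (+ n) (tri n))
      (trans (cong (λ t → + 2 * + n + t) (2tri n)) (lem (+ n)))
      where
      lem : ∀ n → + 2 * n + (n * n - n) ≡ (1ℤ + n) * (1ℤ + n) - (1ℤ + n)
      lem = solve-∀

  -- 2 tri n = n² − n, and 2 is invertible modulo p.
  tri-cong : ∀ {m i} → + m ≡ + i [ P ] → tri m ≡ tri i [ P ]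
  tri-cong {m} {i} m≡i = comb₂ (tri m - tri i) (- (H * (+ m + + i - 1ℤ))) P≡0 m≡i
    (trans (halve (tri m) (tri i) P≡1+2H)
      (cong (λ t → (tri m - tri i) * (P - 0ℤ) + t)
        (trans (cong₂ (λ s t → - (H * (s - t))) (2tri m) (2tri i)) (lem H (+ m) (+ i)))))
    where
    halve : ∀ s t → P ≡ 1ℤ + + 2 * H → s - t ≡ (s - t) * (P - 0ℤ) + - (H * (+ 2 * s - + 2 * t))
    halve s t e = trans (lem′ s t H) (cong (λ P → (s - t) * (P - 0ℤ) + - (H * (+ 2 * s - + 2 * t))) (sym e))
      where
      lem′ : ∀ s t H → s - t ≡ (s - t) * ((1ℤ + + 2 * H) - 0ℤ) + - (H * (+ 2 * s - + 2 * t))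
      lem′ = solve-∀
    lem : ∀ H m i → - (H * ((m * m - m) - (i * i - i))) ≡ - (H * (m + i - 1ℤ)) * (m - i)
    lem = solve-∀

  -- A first-order Taylor expansion: the derivative of the sum in its base is Σ t Lᵗ⁻¹, which is Σ t
  -- modulo p because both bases are 1 there.
  geo-difference : ∀ {L L′} n w m → L ≡ 1ℤ [ P ] → L′ ≡ 1ℤ [ P ] → L - L′ ≡ n * w →
                   geo L m - geo L′ m ≡ n * w * tri m [ n * P ]
  geo-difference n w zero _ _ _ = ≡⇒≡[] (sym (*-zeroʳ (n * w)))
  geo-difference {L} {L′} n w (suc m) L≡1 L′≡1 e =
    comb₃ L (w * tri m) w (geo-difference n w m L≡1 L′≡1 e) (scale n refl L≡1) (scale n refl (geo≡ m L′≡1))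
      (trans (cong (λ t → t - n * w * (+ m + tri m)) (lem L L′ (geo L m) (geo L′ m)))
        (trans (cong (λ t → L * (geo L m - geo L′ m) + t * geo L′ m - n * w * (+ m + tri m)) e)
          (lem′ L (geo L m) (geo L′ m) n w (+ m) (tri m))))
    where
    lem : ∀ L L′ g g′ → (1ℤ + L * g) - (1ℤ + L′ * g′) ≡ L * (g - g′) + (L - L′) * g′
    lem = solve-∀
    lem′ : ∀ L g g′ n w m t → L * (g - g′) + n * w * g′ - n * w * (m + t)
         ≡ L * (g - g′ - n * w * t) + w * t * (n * L - n * 1ℤ) + w * (n * g′ - n * m)
    lem′ = solve-∀

  -- `tri` depends only on its argument modulo p, and here oddness of p enters. So changing the base
  -- by a multiple of n moves the sums of lengths m and i by the same amount.
  geo-difference-cong : ∀ {L L′} n m i → L ≡ 1ℤ [ P ] → L′ ≡ 1ℤ [ P ] → L ≡ L′ [ n ] →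
                        + m ≡ + i [ P ] → geo L m - geo L′ m ≡ geo L i - geo L′ i [ n * P ]
  geo-difference-cong n m i L≡1 L′≡1 (by w e) m≡i =
    ≡-trans (geo-difference n w m L≡1 L′≡1 e)
      (≡-trans (comb₁ w (scale n refl (tri-cong {m} {i} m≡i)) (lem n w (tri m) (tri i)))
        (≡-sym (geo-difference n w i L≡1 L′≡1 e)))
    where
    lem : ∀ n w s t → n * w * s - n * w * t ≡ w * (n * s - n * t)
    lem = solve-∀

  private
    -- Comparison with the base 1 at the lengths p and 0, which agree modulo p. For p = 2 the claim
    -- fails: 1 + 3 = 4 is not 2 modulo 4.
    geo-p : ∀ {L} → L ≡ 1ℤ [ P ] → geo L p ≡ P [ P * P ]
    geo-p {L} L≡1 = comb₁ 1ℤ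
      (geo-difference-cong P p 0 L≡1 ≡-refl L≡1 P≡0)
      (trans (cong (λ t → geo L p - t) (sym (geo-1 p))) (lem (geo L p) (geo 1ℤ p)))
      where
      lem : ∀ x y → x - y ≡ 1ℤ * ((x - y) - (0ℤ - 0ℤ))
      lem = solve-∀

    -- A sum of length p K is the product of `geo L p` and a sum of length K with base Lᵖ, which is
    -- again 1 modulo p; each factor p gains one power in the modulus.
    geo-pow : ∀ {L} k s → L ≡ 1ℤ [ P ] → geo L (p ℕ.^ k ℕ.* s) ≡ + (p ℕ.^ k ℕ.* s) [ P ^ suc k ]
    geo-pow zero s L≡1 = modP (geo≡ (1 ℕ.* s) L≡1)
    geo-pow {L} (suc k) s L≡1 = step (geo-p L≡1) (geo-pow k s (^≡1 p L≡1))
      where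
      K = p ℕ.^ k ℕ.* s
      lem : ∀ G G′ P Pk s K r r′ → G - P ≡ P * P * r → G′ - K ≡ P * Pk * r′ → K ≡ Pk * s →
            G * G′ - P * K ≡ P * (P * Pk) * (r * (s + P * r′) + r′)
      lem G G′ P Pk s K r r′ e e′ e″ = trans (lem₁ G G′ P K)
        (trans (cong₂ (λ u v → u * (v + K) + P * v) e e′)
          (trans (cong (λ K → P * P * r * (P * Pk * r′ + K) + P * (P * Pk * r′)) e″) (lem₂ P Pk s r r′)))
        where
        lem₁ : ∀ G G′ P K → G * G′ - P * K ≡ (G - P) * ((G′ - K) + K) + P * (G′ - K)
        lem₁ = solve-∀
        lem₂ : ∀ P Pk s r r′ → P * P * r * (P * Pk * r′ + Pk * s) + P * (P * Pk * r′)
             ≡ P * (P * Pk) * (r * (s + P * r′) + r′)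
        lem₂ = solve-∀
      step : geo L p ≡ P [ P * P ] → geo (L ^ p) K ≡ + K [ P ^ suc k ] →
             geo L (p ℕ.^ suc k ℕ.* s) ≡ + (p ℕ.^ suc k ℕ.* s) [ P ^ suc (suc k) ]
      step (by r e) (by r′ e′) = by _ (trans
        (cong₂ _-_ (trans (cong (geo L) (ℕ.*-assoc p (p ℕ.^ k) s)) (geo-* L p K))
                   (trans (cong +_ (ℕ.*-assoc p (p ℕ.^ k) s)) (pos-* p K)))
        (lem (geo L p) (geo (L ^ p) K) P (P ^ k) (+ s) (+ K) r r′ e e′
          (trans (pos-* (p ℕ.^ k) s) (cong (_* + s) (pos-^ k)))))

    isometry : ∀ {L} j y s → L ≡ 1ℤ [ P ] →
      geo L (y ℕ.+ p ℕ.^ j ℕ.* s) - geo L y ≡ + (y ℕ.+ p ℕ.^ j ℕ.* s) - + y [ P ^ suc j ]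
    isometry {L} j y s L≡1 = subst₂ (λ u v → u ≡ v [ P ^ suc j ])
      (sym (trans (cong (_- geo L y) (geo-+ L y K)) (lem₁ (geo L y) (L ^ y * geo L K))))
      (sym (trans (cong (_- + y) (pos-+ y K)) (lem₁ (+ y) (+ K))))
      (≡-trans (*-congˡ (L ^ y) (geo-pow j s L≡1))
        (comb₁ (+ s) (scale (P ^ j) (*-comm (P ^ j) P) (^≡1 y L≡1))
          (trans (cong (λ t → L ^ y * t - t) (trans (pos-* (p ℕ.^ j) s) (cong (_* + s) (pos-^ j))))
            (lem₂ (L ^ y) (P ^ j) (+ s)))))
      where
      K = p ℕ.^ j ℕ.* s
      lem₁ : ∀ x y → (x + y) - x ≡ y
      lem₁ = solve-∀
      lem₂ : ∀ u m s → u * (m * s) - m * s ≡ s * (m * u - m * 1ℤ)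
      lem₂ = solve-∀

  [p^]⇒ : ∀ {x y} j → x ≡ y [ P ^ j ] → x ≡ y [ + (p ℕ.^ j) ]
  [p^]⇒ {x} {y} j = subst (x ≡ y [_]) (sym (pos-^ j))

  [p^]⇐ : ∀ {x y} j → x ≡ y [ + (p ℕ.^ j) ] → x ≡ y [ P ^ j ]
  [p^]⇐ {x} {y} j = subst (x ≡ y [_]) (pos-^ j)

  -- One digit beyond the modulus of the hypothesis is preserved. This makes i ↦ geo L i injective
  -- (`geo-injective`) and surjective (`log`) modulo every power of p.
  geo-isometry : ∀ {L} j {x y} → L ≡ 1ℤ [ P ] → + x ≡ + y [ P ^ j ] →
                 geo L x - geo L y ≡ + x - + y [ P ^ suc j ]
  geo-isometry {L} j {x} {y} L≡1 x≡y with difference ([p^]⇒ j x≡y)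
  ... | inj₂ (s , refl) = isometry j y s L≡1
  ... | inj₁ (s , refl) = comb₁ -1ℤ (isometry j x s L≡1)
    (lem (geo L x) (geo L y) (+ x) (+ y))
    where
    lem : ∀ g g′ x y → (g - g′) - (x - y) ≡ -1ℤ * ((g′ - g) - (y - x))
    lem = solve-∀

  geo-exp-cong : ∀ {L} j {x y} → L ≡ 1ℤ [ P ] → + x ≡ + y [ P ^ j ] → geo L x ≡ geo L y [ P ^ j ]
  geo-exp-cong {L} j {x} {y} L≡1 x≡y = comb₂ 1ℤ 1ℤ (^-weaken (ℕ.n≤1+n j) (geo-isometry j L≡1 x≡y)) x≡y
    (lem (geo L x) (geo L y) (+ x) (+ y))
    where
    lem : ∀ g g′ x y → g - g′ ≡ 1ℤ * ((g - g′) - (x - y)) + 1ℤ * (x - y)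
    lem = solve-∀

  geo-injective : ∀ {L} j {x y} → L ≡ 1ℤ [ P ] → geo L x ≡ geo L y [ P ^ j ] → + x ≡ + y [ P ^ j ]
  geo-injective zero    _   _   = ≡[p^0]
  geo-injective {L} (suc j) {x} {y} L≡1 e = comb₂ -1ℤ 1ℤ
    (geo-isometry j {x} {y} L≡1 (geo-injective j {x} {y} L≡1 (^-weaken (ℕ.n≤1+n j) e))) e
    (lem (geo L x) (geo L y) (+ x) (+ y))
    where
    lem : ∀ g g′ x y → x - y ≡ -1ℤ * ((g - g′) - (x - y)) + 1ℤ * (g - g′)
    lem = solve-∀

  residue : ∀ x n .{{_ : ℕ.NonZero n}} → ∃ λ r → r ℕ.< n × + r ≡ x [ + n ]
  residue x n = x %ℕ n , n%ℕd<d x n , ≡-sym (by (x /ℕ n)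
    (trans (cong (_- + (x %ℕ n)) (a≡a%ℕn+[a/ℕn]*n x n)) (lem (+ (x %ℕ n)) (x /ℕ n) (+ n))))
    where
    lem : ∀ r q n → r + q * n - r ≡ n * q
    lem = solve-∀

  -- Digit by digit: an error pʲ q is removed by adding pʲ s with s ≡ - q to the length, since this
  -- adds pʲ s to the sum modulo pʲ⁺¹.
  log : ∀ {L} j c → L ≡ 1ℤ [ P ] → ∃ λ i → geo L i ≡ c [ P ^ j ]
  log zero    c L≡1 = 0 , ≡[p^0]
  log {L} (suc j) c L≡1 with log j c L≡1
  ... | i , by q e with residue (- q) p
  ... | s , _ , s≡-q = i ℕ.+ p ℕ.^ j ℕ.* s ,
    comb₂ 1ℤ 1ℤ (isometry j i s L≡1) (scale (P ^ j) (*-comm (P ^ j) P) s≡-q)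
      (trans (trans (lem (geo L (i ℕ.+ p ℕ.^ j ℕ.* s)) (geo L i) c) (cong (λ t → geo L (i ℕ.+ p ℕ.^ j ℕ.* s) - geo L i + t) e))
        (trans (lem′ (geo L (i ℕ.+ p ℕ.^ j ℕ.* s)) (geo L i) (+ i) (P ^ j) (+ s) q)
          (cong (λ t → 1ℤ * ((geo L (i ℕ.+ p ℕ.^ j ℕ.* s) - geo L i) - (t - + i)) + 1ℤ * (P ^ j * + s - P ^ j * - q))
            (sym (trans (pos-+ i (p ℕ.^ j ℕ.* s)) (cong (λ t → + i + t) (trans (pos-* (p ℕ.^ j) s) (cong (_* + s) (pos-^ j)))))))))
    where
    lem : ∀ G g c → G - c ≡ (G - g) + (g - c)
    lem = solve-∀
    lem′ : ∀ G g i m s q → (G - g) + m * q ≡ 1ℤ * ((G - g) - ((i + m * s) - i)) + 1ℤ * (m * s - m * - q)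
    lem′ = solve-∀

  -- The geometric series of 1 / (1 - (1 - u)), cut off after k terms: the remainder (1 - u)ᵏ is
  -- divisible by pᵏ.
  inverse : ∀ u k → u ≡ 1ℤ [ P ] → u * geo (1ℤ - u) k ≡ 1ℤ [ P ^ k ]
  inverse u zero    _   = ≡[p^0]
  inverse u (suc k) (by r e) with inverse u k (by r e)
  ... | by q e′ = by (- (r * q)) (trans (lem u (geo (1ℤ - u) k))
    (trans (cong₂ (λ s t → - (s * t)) e e′) (lem′ P (P ^ k) r q)))
    where
    lem : ∀ u g → u * (1ℤ + (1ℤ - u) * g) - 1ℤ ≡ - ((u - 1ℤ) * (u * g - 1ℤ))
    lem = solve-∀
    lem′ : ∀ P m r q → - (P * r * (m * q)) ≡ P * m * - (r * q)
    lem′ = solve-∀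

  cancel : ∀ {u x y} k → u ≡ 1ℤ [ P ] → u * x ≡ u * y [ P ^ k ] → x ≡ y [ P ^ k ]
  cancel {u} {x} {y} k u≡1 ux≡uy = comb₂ (geo (1ℤ - u) k) (- (x - y)) ux≡uy (inverse u k u≡1)
    (lem u x y (geo (1ℤ - u) k))
    where
    lem : ∀ u x y v → x - y ≡ v * (u * x - u * y) + - (x - y) * (u * v - 1ℤ)
    lem = solve-∀

  -- Vanishing of the obstruction cocycle

  Σ[<_] : ℕ → (ℕ → ℤ) → ℤ
  Σ[< zero  ] f = 0ℤ
  Σ[< suc n ] f = f n + Σ[< n ] f

  Σ-affine : ∀ {n f} m x η → (∀ t → f t ≡ x + + t * η [ n ]) → Σ[< m ] f ≡ + m * x + tri m * η [ n ]
  Σ-affine zero    x η f≡ = ≡⇒≡[] refl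
  Σ-affine (suc m) x η f≡ = ≡-trans (+-cong (f≡ m) (Σ-affine m x η f≡))
    (≡⇒≡[] (lem (+ m) x η (tri m)))
    where
    lem : ∀ m x η t → (x + m * η) + (m * x + t * η) ≡ (1ℤ + m) * x + (m + t) * η
    lem = solve-∀

  private
    +*ℕ : ∀ k j s → + (k ℕ.+ j ℕ.* s) ≡ + k + + j * + s
    +*ℕ k j s = cong (λ t → + k + t) (pos-* j s)

  module _ (e : ℕ) (g : ℕ → ℤ) (φ π : ℕ → ℕ)
    (additive : ∀ i k → g (i ℕ.+ k) ≡ g i + Σ[< π i ] (λ t → g (fold k φ t)) [ P ])
    (π≡1 : ∀ i → + π i ≡ 1ℤ [ P ])
    (φ-isometry : ∀ {j} x y → j ℕ.< e → + x ≡ + y [ P ^ j ] → + φ x - + φ y ≡ + x - + y [ P ^ suc j ])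
    (φ-zero : + φ 0 ≡ 0ℤ [ P ^ e ])
    (g-one : g 1 ≡ 0ℤ [ P ])
    where

    private
      Periodic : ℕ → Set
      Periodic j = ∀ x y → + x ≡ + y [ P ^ j ] → g x ≡ g y [ P ]

      translates : ∀ {k η} → (∀ i → g (i ℕ.+ k) ≡ g i + η [ P ]) → ∀ i s → g (i ℕ.+ k ℕ.* s) ≡ g i + + s * η [ P ]
      translates {k} {η} add i zero    = ≡⇒≡[] (trans (cong g (trans (cong (i ℕ.+_) (ℕ.*-zeroʳ k)) (ℕ.+-identityʳ i))) (lem (g i) η))
        where
        lem : ∀ x η → x ≡ x + 0ℤ * η
        lem = solve-∀
      translates {k} {η} add i (suc s) = ≡-trans
        (≡⇒≡[] (cong g (trans (cong (i ℕ.+_) (ℕ.*-suc k s)) (sym (ℕ.+-assoc i k (k ℕ.* s))))))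
        (≡-trans (translates add (i ℕ.+ k) s)
          (≡-trans (+-cong (add i) (≡-refl {+ s * η})) (≡⇒≡[] (lem (g i) η (+ s)))))
        where
        lem : ∀ x η s → (x + η) + s * η ≡ x + (1ℤ + s) * η
        lem = solve-∀

      -- If g is affine along the φ-orbit of k, then in the sum of `additive` the constant term has
      -- coefficient π(i) ≡ 1 and the slope has coefficient `tri (π i)` ≡ `tri 1` = 0. So
      -- translation by k shifts g by a constant.
      affine-add : ∀ {k η x} i → (∀ t → g (fold k φ t) ≡ x + + t * η [ P ]) → g (i ℕ.+ k) ≡ g i + x [ P ]
      affine-add {k} {η} {x} i g≡ = ≡-trans (additive i k) (+-congˡ (g i)
        (≡-trans (Σ-affine (π i) x η g≡)
          (comb₂ x η (π≡1 i) (tri-cong {π i} {1} (π≡1 i)) (lem (+ π i) x (tri (π i)) η))))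
        where
        lem : ∀ m x t η → m * x + t * η - x ≡ x * (m - 1ℤ) + η * (t - 0ℤ)
        lem = solve-∀

      fixed : ∀ {j x} → j ℕ.< e → + x ≡ 0ℤ [ P ^ j ] → + φ x ≡ + x [ P ^ suc j ]
      fixed {j} {x} j<e x≡0 = comb₂ 1ℤ 1ℤ (φ-isometry x 0 j<e x≡0) (^-weaken j<e φ-zero) (lem (+ φ x) (+ x) (+ φ 0))
        where
        lem : ∀ u x z → u - x ≡ 1ℤ * ((u - z) - (x - 0ℤ)) + 1ℤ * (z - 0ℤ)
        lem = solve-∀

      η : ℕ → ℤ
      η j = g (p ℕ.^ j)

      -- φ fixes 0 and preserves one digit more than it is given, so it fixes multiples of pʲ modulo
      -- pʲ⁺¹. A function of period pʲ⁺¹ is then constant on this orbit.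
      orbit : ∀ {j} → j ℕ.< e → ∀ t → + fold (p ℕ.^ j) φ t ≡ + (p ℕ.^ j) [ P ^ suc j ]
      orbit         j<e zero    = ≡-refl
      orbit {j} j<e (suc t) = ≡-trans (fixed j<e (≡-trans (^-weaken (ℕ.n≤1+n j) (orbit j<e t)) (p^≡0 j))) (orbit j<e t)

      add-η : ∀ {j} → j ℕ.< e → Periodic (suc j) → ∀ i → g (i ℕ.+ p ℕ.^ j) ≡ g i + η j [ P ]
      add-η {j} j<e per i = affine-add {η = 0ℤ} i
        (λ t → ≡-trans (per (fold (p ℕ.^ j) φ t) (p ℕ.^ j) (orbit j<e t)) (≡⇒≡[] (lem (η j) (+ t))))
        where
        lem : ∀ η t → η ≡ η + t * 0ℤ
        lem = solve-∀

      module _ {j} (j<e : suc j ℕ.< e) (per : Periodic (suc (suc j))) where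
        k = p ℕ.^ j

        -- One digit further the orbit is a progression instead of a fixed point: each application
        -- of φ adds the same pʲ⁺¹ c. Along it g is affine with slope c g(pʲ⁺¹).
        orbit₂ : ∀ c → + φ k ≡ + (k ℕ.+ p ℕ.^ suc j ℕ.* c) [ P ^ suc (suc j) ] →
                 ∀ t → + fold k φ t ≡ + (k ℕ.+ p ℕ.^ suc j ℕ.* (t ℕ.* c)) [ P ^ suc (suc j) ]
        orbit₂ c φk zero    = ≡⇒≡[] (cong +_ (sym (trans (cong (k ℕ.+_) (ℕ.*-zeroʳ (p ℕ.^ suc j))) (ℕ.+-identityʳ k))))
        orbit₂ c φk (suc t) = comb₃ 1ℤ 1ℤ 1ℤ
          (φ-isometry (fold k φ t) k j<e (orbit (ℕ.<-trans ℕ.≤-refl j<e) t)) (orbit₂ c φk t) φk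
          (trans (cong (λ u → + φ (fold k φ t) - u) e₁)
            (trans (lem (+ φ (fold k φ t)) (+ fold k φ t) (+ φ k) (+ k) (+ (p ℕ.^ suc j)) (+ t) (+ c))
              (cong₂ (λ u v → 1ℤ * ((+ φ (fold k φ t) - + φ k) - (+ fold k φ t - + k)) + 1ℤ * (+ fold k φ t - u) + 1ℤ * (+ φ k - v))
                (sym e₂) (sym (+*ℕ k (p ℕ.^ suc j) c)))))
          where
          e₂ : + (k ℕ.+ p ℕ.^ suc j ℕ.* (t ℕ.* c)) ≡ + k + + (p ℕ.^ suc j) * (+ t * + c)
          e₂ = trans (+*ℕ k (p ℕ.^ suc j) (t ℕ.* c)) (cong (λ u → + k + + (p ℕ.^ suc j) * u) (pos-* t c))
          e₁ : + (k ℕ.+ p ℕ.^ suc j ℕ.* (suc t ℕ.* c)) ≡ + k + + (p ℕ.^ suc j) * ((1ℤ + + t) * + c)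
          e₁ = trans (+*ℕ k (p ℕ.^ suc j) (suc t ℕ.* c)) (cong (λ u → + k + + (p ℕ.^ suc j) * u) (pos-* (suc t) c))
          lem : ∀ u y v k m t c → u - (k + m * ((1ℤ + t) * c)) ≡
                1ℤ * ((u - v) - (y - k)) + 1ℤ * (y - (k + m * (t * c))) + 1ℤ * (v - (k + m * c))
          lem = solve-∀

        step-constant : ∃ λ c → + φ k ≡ + (k ℕ.+ p ℕ.^ suc j ℕ.* c) [ P ^ suc (suc j) ]
        step-constant = choose (fixed {j} {k} (ℕ.<-trans ℕ.≤-refl j<e) (p^≡0 j))
          where
          lem : ∀ u k m c → u - (k + m * c) ≡ (u - k) - m * c
          lem = solve-∀
          lem′ : ∀ m q c → m * q - m * c ≡ -1ℤ * (m * c - m * q)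
          lem′ = solve-∀
          φk≡ : ∀ q c → + φ k - + k ≡ P ^ suc j * q → + c ≡ q [ P ] →
                + φ k ≡ + (k ℕ.+ p ℕ.^ suc j ℕ.* c) [ P ^ suc (suc j) ]
          φk≡ q c e c≡q = comb₁ -1ℤ (scale (P ^ suc j) (*-comm (P ^ suc j) P) c≡q)
            (trans (cong (λ u → + φ k - u) (trans (+*ℕ k (p ℕ.^ suc j) c) (cong (λ u → + k + u * + c) (pos-^ (suc j)))))
              (trans (lem (+ φ k) (+ k) (P ^ suc j) (+ c)) (trans (cong (_- P ^ suc j * + c) e) (lem′ (P ^ suc j) q (+ c)))))
          choose : + φ k ≡ + k [ P ^ suc j ] → ∃ λ c → + φ k ≡ + (k ℕ.+ p ℕ.^ suc j ℕ.* c) [ P ^ suc (suc j) ]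
          choose (by q e) = let c , _ , c≡q = residue q p in c , φk≡ q c e c≡q

        add-k : ∀ i → g (i ℕ.+ k) ≡ g i + g k [ P ]
        add-k i = from step-constant
          where
          terms : ∀ c → + φ k ≡ + (k ℕ.+ p ℕ.^ suc j ℕ.* c) [ P ^ suc (suc j) ] →
                  ∀ t → g (fold k φ t) ≡ g k + + t * (+ c * η (suc j)) [ P ]
          terms c φk t = ≡-trans (per (fold k φ t) (k ℕ.+ p ℕ.^ suc j ℕ.* (t ℕ.* c)) (orbit₂ c φk t))
            (≡-trans (translates (add-η j<e per) k (t ℕ.* c))
              (≡⇒≡[] (cong (λ u → g k + u) (trans (cong (_* η (suc j)) (pos-* t c)) (*-assoc (+ t) (+ c) (η (suc j)))))))
          from : (∃ λ c → + φ k ≡ + (k ℕ.+ p ℕ.^ suc j ℕ.* c) [ P ^ suc (suc j) ]) → g (i ℕ.+ k) ≡ g i + g k [ P ]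
          from (c , φk) = affine-add i (terms c φk)

        -- A translation by pʲ⁺¹ consists of p translations by pʲ, which add p g(pʲ) ≡ 0; the
        -- additivity at 0 supplies g(0) ≡ 0.
        η≡0 : η (suc j) ≡ 0ℤ [ P ]
        η≡0 = comb₃ 1ℤ (g k) -1ℤ
          (≡-trans (≡⇒≡[] (cong g (ℕ.*-comm p k))) (translates add-k 0 p)) P≡0
          (add-η j<e per 0)
          (lem (η (suc j)) (g 0) (g k) P)
          where
          lem : ∀ η g₀ x P → η - 0ℤ ≡ 1ℤ * (η - (g₀ + P * x)) + x * (P - 0ℤ) + -1ℤ * (η - (g₀ + η))
          lem = solve-∀

      -- Translation by pʲ adds η(j). For j > 0 this increment vanishes by itself; for j = 0 it is
      -- g(1), the one value that the choice of α has to normalise.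
      descend : ∀ j → j ℕ.< e → Periodic (suc j) → Periodic j
      descend j j<e per x y x≡y = conclude (η≡ j j<e per)
        where
        η≡ : ∀ j → j ℕ.< e → Periodic (suc j) → η j ≡ 0ℤ [ P ]
        η≡ zero    _   _   = g-one
        η≡ (suc j) j<e per = η≡0 j<e per
        multiples : ∀ i s → η j ≡ 0ℤ [ P ] → g (i ℕ.+ p ℕ.^ j ℕ.* s) ≡ g i [ P ]
        multiples i s η₀ = comb₂ 1ℤ (+ s) (translates (add-η j<e per) i s) η₀
          (lem (g (i ℕ.+ p ℕ.^ j ℕ.* s)) (g i) (+ s) (η j))
          where
          lem : ∀ G g s η → G - g ≡ 1ℤ * (G - (g + s * η)) + s * (η - 0ℤ)
          lem = solve-∀
        conclude : η j ≡ 0ℤ [ P ] → g x ≡ g y [ P ]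
        conclude η₀ with difference ([p^]⇒ j x≡y)
        ... | inj₁ (s , refl) = ≡-sym (multiples x s η₀)
        ... | inj₂ (s , refl) = multiples y s η₀

      descend-to-zero : ∀ j → j ℕ.≤ e → Periodic j → Periodic 0
      descend-to-zero zero    _   per = per
      descend-to-zero (suc j) j<e per = descend-to-zero j (ℕ.<⇒≤ j<e) (descend j j<e per)

    vanishing : (∀ x y → + x ≡ + y [ P ^ e ] → g x ≡ g y [ P ]) → ∀ i → g i ≡ 0ℤ [ P ]
    vanishing per i = ≡-trans (descend-to-zero e ℕ.≤-refl per i 1 ≡[p^0]) g-one

  -- In a group with b aⁱ = a^φ(i) b^π(i) this is the exponent of b in bᵐ aᵏ, the exponent of a
  -- being φᵐ(k).
  skew-sum : (φ π : ℕ → ℕ) → ℕ → ℕ → ℕ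
  skew-sum φ π zero    k = 0
  skew-sum φ π (suc m) k = π (fold k φ m) ℕ.+ skew-sum φ π m k

  P^-nonZero : ∀ n → NonZero (P ^ n)
  P^-nonZero n = subst NonZero (pos-^ n) (≢-nonZero λ e → ℕ.≢-nonZero⁻¹ (p ℕ.^ n) ⦃ ℕ.m^n≢0 p n ⦄ (+-injective e))

  cancel-P^ : ∀ n {x y} → P ^ n * x ≡ P ^ n * y [ P ^ suc n ] → x ≡ y [ P ]
  cancel-P^ n {x} {y} (by q e) = by q (*-cancelˡ-≡ (P ^ n) (x - y) (P * q) ⦃ P^-nonZero n ⦄
    (trans (lem (P ^ n) x y) (trans e (lem′ P (P ^ n) q))))
    where
    lem : ∀ m x y → m * (x - y) ≡ m * x - m * y
    lem = solve-∀
    lem′ : ∀ P m q → P * m * q ≡ m * (P * q)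
    lem′ = solve-∀

  scale-P^ : ∀ n {x y} → x ≡ y [ P ] → P ^ n * x ≡ P ^ n * y [ P ^ suc n ]
  scale-P^ n = scale (P ^ n) (*-comm (P ^ n) P)

  1+[] : ∀ {x} → x ≡ 0ℤ [ P ] → 1ℤ + x ≡ 1ℤ [ P ]
  1+[] = +-congˡ 1ℤ

  -- The missing digit as a cocycle

  module _ (n : ℕ) (1≤n : 1 ℕ.≤ n) (α β : ℤ) (α≡0 : α ≡ 0ℤ [ P ]) (β≡0 : β ≡ 0ℤ [ P ]) (φ π : ℕ → ℕ) where

    private
      L = 1ℤ + α
      M = 1ℤ + β
      e = suc n

      L≡1 : L ≡ 1ℤ [ P ]
      L≡1 = 1+[] α≡0

      M≡1 : M ≡ 1ℤ [ P ]
      M≡1 = 1+[] β≡0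

      -- The second coordinate of b aⁱ as computed from a^φ(i) b^π(i); computed directly it is 1.
      F : ℕ → ℤ
      F i = L ^ φ i * geo M (π i)

    module _
      (φ-geo : ∀ i → geo L (φ i) ≡ M * geo L i [ P ^ e ])
      (π-lift : ∀ i → L ^ φ i * geo M (π i) ≡ 1ℤ [ P ^ n ])
      (π-skew : ∀ i k → + π (i ℕ.+ k) ≡ + skew-sum φ π (π i) k [ P ^ e ])
      (π-periodic : ∀ x y → + x ≡ + y [ P ^ e ] → + π x ≡ + π y [ P ^ e ])
      (π-one : L ^ φ 1 * geo M (π 1) ≡ 1ℤ [ P ^ e ])
      where

      private
        g : ℕ → ℤ
        g i = _≡_[_].quotient (π-lift i)

        F-g : ∀ i → F i ≡ 1ℤ + P ^ n * g i
        F-g i = trans (lem (F i)) (cong (λ t → 1ℤ + t) (_≡_[_].equation (π-lift i)))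
          where
          lem : ∀ x → x ≡ 1ℤ + (x - 1ℤ)
          lem = solve-∀

        F≡ : ∀ i → F i ≡ 1ℤ + P ^ n * g i [ P ^ e ]
        F≡ i = ≡⇒≡[] (F-g i)

        T : ℕ → ℕ → ℤ
        T m k = Σ[< m ] (λ t → g (fold k φ t))

        S = skew-sum φ π

        L^-φ : ∀ x → L ^ φ x ≡ 1ℤ + α * (M * geo L x) [ P ^ e ]
        L^-φ x = ≡-trans (≡⇒≡[] (^-geo α (φ x))) (+-congˡ 1ℤ (*-congˡ α (φ-geo x)))

        -- The linear parts of b aˣ and a^φ(x) b^π(x) agree modulo pᵉ although the translation parts
        -- need not: the missing digit comes multiplied by pⁿ β, and p divides β.
        L^-M^ : ∀ x → L ^ φ x * M ^ π x ≡ M * L ^ x [ P ^ e ]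
        L^-M^ x = ≡-trans (≡⇒≡[] (trans (cong (L ^ φ x *_) (^-geo β (π x))) (lem₁ (L ^ φ x) β (geo M (π x)))))
          (comb₃ 1ℤ β (g x) (L^-φ x) (F≡ x) (scale-P^ n β≡0)
            (trans (cong (λ u → L ^ φ x + β * F x - M * u) (^-geo α x))
              (lem₂ (L ^ φ x) (F x) α β (geo L x) (P ^ n) (g x))))
          where
          lem₁ : ∀ u β G → u * (1ℤ + β * G) ≡ u + β * (u * G)
          lem₁ = solve-∀
          lem₂ : ∀ u F α β G m g → u + β * F - (1ℤ + β) * (1ℤ + α * G) ≡
            1ℤ * (u - (1ℤ + α * ((1ℤ + β) * G))) + β * (F - (1ℤ + m * g)) + g * (m * β - m * 0ℤ)
          lem₂ = solve-∀

        -- The second coordinate of bᵐ aᵏ. Linear parts are 1 modulo p and do not affect the digit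
        -- at pⁿ, so the deviations along the φ-orbit simply add up.
        S-geo : ∀ m k → L ^ fold k φ m * geo M (S m k) ≡ geo M m + P ^ n * T m k [ P ^ e ]
        S-geo zero    k = ≡⇒≡[] (lem (L ^ k) (P ^ n))
          where
          lem : ∀ u m → u * 0ℤ ≡ 0ℤ + m * 0ℤ
          lem = solve-∀
        S-geo (suc m) k = ≡-trans (≡⇒≡[] (trans (cong (L ^ φ x *_) (geo-+ M (π x) (S m k)))
            (lem₁ (L ^ φ x) (geo M (π x)) (M ^ π x) (geo M (S m k)))))
          (≡-trans (+-cong (F≡ x) (*-cong (L^-M^ x) (≡-refl {geo M (S m k)})))
            (comb₂ M (T m k) (S-geo m k) (scale-P^ n M≡1)
              (lem₂ (P ^ n) (g x) M (L ^ x) (geo M (S m k)) (geo M m) (T m k))))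
          where
          x = fold k φ m
          lem₁ : ∀ u G v H → u * (G + v * H) ≡ u * G + u * v * H
          lem₁ = solve-∀
          lem₂ : ∀ q g M u H G T → (1ℤ + q * g) + M * u * H - ((1ℤ + M * G) + q * (g + T)) ≡
                 M * (u * H - (G + q * T)) + T * (q * M - q * 1ℤ)
          lem₂ = solve-∀

        geo-fold : ∀ k m → geo L (fold k φ m) ≡ M ^ m * geo L k [ P ^ e ]
        geo-fold k zero    = ≡⇒≡[] (sym (*-identityˡ (geo L k)))
        geo-fold k (suc m) = ≡-trans (φ-geo (fold k φ m)) (≡-trans (*-congˡ M (geo-fold k m))
          (≡⇒≡[] (sym (*-assoc M (M ^ m) (geo L k)))))

        L^-skew : ∀ i k → L ^ φ (i ℕ.+ k) ≡ L ^ φ i * L ^ fold k φ (π i) [ P ^ e ]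
        L^-skew i k = ≡-trans (L^-φ (i ℕ.+ k)) (≡-trans
          (≡-trans (≡⇒≡[] (cong (λ t → 1ℤ + α * (M * t)) (geo-+ L i k)))
            (comb₃ (- α) (- (α * geo L k)) (- (α * L ^ φ i)) (φ-geo i) (L^-M^ i) (geo-fold k (π i))
              (lem α M (geo L i) (L ^ i) (geo L k) (geo L (φ i)) (L ^ φ i) (geo L (fold k φ (π i))) (M ^ π i))))
          (≡⇒≡[] (trans (cong (λ t → 1ℤ + α * t) (sym (geo-+ L (φ i) (fold k φ (π i)))))
            (trans (sym (^-geo α (φ i ℕ.+ fold k φ (π i)))) (^-distribˡ-+-* L (φ i) (fold k φ (π i)))))))
          where
          lem : ∀ α M Gi Li Gk Gφ Lφ Gf Mπ →
            (1ℤ + α * (M * (Gi + Li * Gk))) - (1ℤ + α * (Gφ + Lφ * Gf)) ≡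
            - α * (Gφ - M * Gi) + - (α * Gk) * (Lφ * Mπ - M * Li) + - (α * Lφ) * (Gf - Mπ * Gk)
          lem = solve-∀

        -- Associativity b (aⁱ aᵏ) = (b aⁱ) aᵏ in second coordinates: `π-skew` and `L^-skew` expand
        -- F(i + k), and the coefficients of pⁿ are compared.
        additive : ∀ i k → g (i ℕ.+ k) ≡ g i + T (π i) k [ P ]
        additive i k = cancel-P^ n (comb₃ -1ℤ 1ℤ (T (π i) k) (F≡ (i ℕ.+ k))
          (≡-trans (*-cong (L^-skew i k) (geo-exp-cong e M≡1 (π-skew i k)))
            (≡-trans (≡⇒≡[] (*-assoc (L ^ φ i) (L ^ fold k φ (π i)) (geo M (S (π i) k))))
              (≡-trans (*-congˡ (L ^ φ i) (S-geo (π i) k)) (≡⇒≡[] (trans (lem₁ (L ^ φ i) (geo M (π i)) (P ^ n) (T (π i) k))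
                (cong (λ t → t + L ^ φ i * (P ^ n * T (π i) k)) (F-g i)))))))
          (scale-P^ n (^≡1 (φ i) L≡1))
          (lem (P ^ n) (g (i ℕ.+ k)) (g i) (T (π i) k) (L ^ φ (i ℕ.+ k) * geo M (π (i ℕ.+ k))) (L ^ φ i)))
          where
          lem₁ : ∀ u G m T → u * (G + m * T) ≡ u * G + u * (m * T)
          lem₁ = solve-∀
          lem : ∀ m g g′ T F u → m * g - m * (g′ + T) ≡ -1ℤ * (F - (1ℤ + m * g)) +
            1ℤ * (F - ((1ℤ + m * g′) + u * (m * T))) + T * (m * u - m * 1ℤ)
          lem = solve-∀

        -- Modulo p both bases are 1, so F(i) reads as π(i). One digit of F must be known for this,
        -- whence `1≤n` and the separate treatment of e ≤ 1.
        π≡1 : ∀ i → + π i ≡ 1ℤ [ P ]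
        π≡1 i = comb₃ 1ℤ -1ℤ (- geo M (π i)) (weaken′ (π-lift i)) (geo≡ (π i) M≡1) (^≡1 (φ i) L≡1)
          (lem (+ π i) (L ^ φ i) (geo M (π i)))
          where
          weaken′ : ∀ {x y} → x ≡ y [ P ^ n ] → x ≡ y [ P ]
          weaken′ x≡y = modP⁻ 0 (^-weaken 1≤n x≡y)
          lem : ∀ x u G → x - 1ℤ ≡ 1ℤ * (u * G - 1ℤ) + -1ℤ * (G - x) + - G * (u - 1ℤ)
          lem = solve-∀

        φ-cong : ∀ {j} x y → j ℕ.≤ e → + x ≡ + y [ P ^ j ] → + φ x ≡ + φ y [ P ^ j ]
        φ-cong {j} x y j≤e x≡y = geo-injective j L≡1 (≡-trans (^-weaken j≤e (φ-geo x))
          (≡-trans (*-congˡ M (geo-exp-cong j L≡1 x≡y)) (≡-sym (^-weaken j≤e (φ-geo y)))))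

        -- φ is multiplication by M conjugated by the isometry `geo L`, and multiplication by M ≡ 1
        -- modulo p preserves the leading digit too.
        φ-isometry : ∀ {j} x y → j ℕ.< e → + x ≡ + y [ P ^ j ] → + φ x - + φ y ≡ + x - + y [ P ^ suc j ]
        φ-isometry {j} x y j<e x≡y = ≡-trans
          (≡-trans (≡-sym (geo-isometry j L≡1 (φ-cong x y (ℕ.<⇒≤ j<e) x≡y)))
            (+-cong (^-weaken j<e (φ-geo x)) (neg-cong (^-weaken j<e (φ-geo y)))))
          (final x≡y)
          where
          final : + x ≡ + y [ P ^ j ] → M * geo L x - M * geo L y ≡ + x - + y [ P ^ suc j ]
          final (by q e′) = comb₂ M q (geo-isometry j {x} {y} L≡1 (by q e′)) (scale-P^ j M≡1)
            (trans (lem M (geo L x) (geo L y) (+ x) (+ y))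
              (cong (λ t → M * ((geo L x - geo L y) - (+ x - + y)) + t)
                (trans (cong ((M - 1ℤ) *_) e′) (lem′ M (P ^ j) q))))
            where
            lem : ∀ M G H x y → (M * G - M * H) - (x - y) ≡ M * ((G - H) - (x - y)) + (M - 1ℤ) * (x - y)
            lem = solve-∀
            lem′ : ∀ M m q → (M - 1ℤ) * (m * q) ≡ q * (m * M - m * 1ℤ)
            lem′ = solve-∀

        φ-zero : + φ 0 ≡ 0ℤ [ P ^ e ]
        φ-zero = geo-injective e {φ 0} {0} L≡1 (≡-trans (φ-geo 0) (≡⇒≡[] (*-zeroʳ M)))

        g-from-F : ∀ {x} i → F i ≡ 1ℤ + P ^ n * x [ P ^ e ] → g i ≡ x [ P ]
        g-from-F {x} i h = cancel-P^ n (comb₂ 1ℤ -1ℤ h (F≡ i) (lem (P ^ n * g i) (P ^ n * x) (F i)))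
          where
          lem : ∀ u v F → u - v ≡ 1ℤ * (F - (1ℤ + v)) + -1ℤ * (F - (1ℤ + u))
          lem = solve-∀

        g-one : g 1 ≡ 0ℤ [ P ]
        g-one = g-from-F 1 (≡-trans π-one (≡⇒≡[] (lem (P ^ n))))
          where
          lem : ∀ m → 1ℤ ≡ 1ℤ + m * 0ℤ
          lem = solve-∀

        periodic : ∀ x y → + x ≡ + y [ P ^ e ] → g x ≡ g y [ P ]
        periodic x y x≡y = g-from-F x (≡-trans (*-cong
          (≡-trans (L^-φ x) (≡-trans (+-congˡ 1ℤ (*-congˡ α (*-congˡ M (geo-exp-cong e L≡1 x≡y)))) (≡-sym (L^-φ y))))
          (geo-exp-cong e M≡1 (π-periodic x y x≡y))) (F≡ y))

      cocycle-trivial : ∀ i → L ^ φ i * geo M (π i) ≡ 1ℤ [ P ^ e ]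
      cocycle-trivial i = ≡-trans (F≡ i) (comb₁ 1ℤ
        (scale-P^ n (vanishing e g φ π additive π≡1 φ-isometry φ-zero g-one periodic i))
        (lem (P ^ n) (g i)))
        where
        lem : ∀ m g → (1ℤ + m * g) - 1ℤ ≡ 1ℤ * (m * g - m * 0ℤ)
        lem = solve-∀

-- Groups factorised by two cyclic subgroups

module Bicyclics where

  import Algebra.Properties.Monoid.Mult as Mult
  open import Data.Nat as ℕ using (ℕ; zero; suc; pred; NonZero)
  open import Data.Integer as ℤ using (ℤ; +_)
  import Data.Integer.Properties as ℤ
  open import Relation.Binary.PropositionalEquality as ≡ using (_≡_)
  import Relation.Binary.Reasoning.Setoid
  open Congruences

  -- A monoid with its own equality suffices: inverses are products of powers of `a` and `b`, and a
  -- quotient keeps the carrier and only coarsens the equality. Powers are written `i · a`. By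
  -- `disjoint` with j = 0 the order of `a` is exactly m, and likewise for `b`.
  record Bicyclic (G : Monoid 0ℓ 0ℓ) (m n : ℕ) : Set where
    open Monoid G
    open Mult G using () renaming (_×_ to infixr 8 _·_)
    field
      a b      : Carrier
      a-order  : m · a ≈ ε
      b-order  : n · b ≈ ε
      disjoint : ∀ i j → i · a ≈ j · b → m ∣ i × n ∣ j
      factor   : ∀ g → ∃₂ λ i j → g ≈ i · a ∙ j · b

  IsCentral : (G : Monoid 0ℓ 0ℓ) → Monoid.Carrier G → Set
  IsCentral G x = ∀ g → x ∙ g ≈ g ∙ x
    where open Monoid G

  neg-sum : ∀ k i .⦃ _ : NonZero k ⦄ → pred k ℕ.* i ℕ.+ i ≡ k ℕ.* i
  neg-sum (suc k) i = ℕ.+-comm (k ℕ.* i) i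

  module Powers (G : Monoid 0ℓ 0ℓ) where
    open Monoid G
    open Mult G public using () renaming
      (_×_ to infixr 8 _·_; ×-congʳ to ·-congʳ; ×-homo-+ to ·-+; ×-assocˡ to ·-·)
    open Relation.Binary.Reasoning.Setoid setoid

    ·-ε : ∀ i → i · ε ≈ ε
    ·-ε zero    = refl
    ·-ε (suc i) = trans (identityˡ (i · ε)) (·-ε i)

    ·-comm : ∀ x i j → i · x ∙ j · x ≈ j · x ∙ i · x
    ·-comm x i j = trans (sym (·-+ x i j)) (trans (reflexive (≡.cong (_· x) (ℕ.+-comm i j))) (·-+ x j i))

    ·-multiple : ∀ {x} m → m · x ≈ ε → ∀ i s → (i ℕ.+ m ℕ.* s) · x ≈ i · x
    ·-multiple {x} m x^m i s = begin
      (i ℕ.+ m ℕ.* s) · x   ≈⟨ ·-+ x i (m ℕ.* s) ⟩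
      i · x ∙ (m ℕ.* s) · x ≡⟨ ≡.cong (λ t → i · x ∙ t · x) (ℕ.*-comm m s) ⟩
      i · x ∙ (s ℕ.* m) · x ≈⟨ ∙-congˡ (sym (·-· x s m)) ⟩
      i · x ∙ s · (m · x)   ≈⟨ ∙-congˡ (trans (·-congʳ s x^m) (·-ε s)) ⟩
      i · x ∙ ε             ≈⟨ identityʳ (i · x) ⟩
      i · x                 ∎

    ·-mod : ∀ {x} m → m · x ≈ ε → ∀ {i j} → + i ≡ + j [ + m ] → i · x ≈ j · x
    ·-mod {x} m x^m {i} {j} i≡j with difference i≡j
    ... | inj₁ (s , ≡.refl) = sym (·-multiple m x^m i s)
    ... | inj₂ (s , ≡.refl) = ·-multiple m x^m j s

    commute-· : ∀ {x y v} → x ∙ v ≈ v ∙ y → ∀ i → i · x ∙ v ≈ v ∙ i · y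
    commute-· {x} {y} {v} e zero    = trans (identityˡ v) (sym (identityʳ v))
    commute-· {x} {y} {v} e (suc i) = begin
      (x ∙ i · x) ∙ v ≈⟨ assoc x (i · x) v ⟩
      x ∙ (i · x ∙ v) ≈⟨ ∙-congˡ (commute-· e i) ⟩
      x ∙ (v ∙ i · y) ≈⟨ sym (assoc x v (i · y)) ⟩
      (x ∙ v) ∙ i · y ≈⟨ ∙-congʳ e ⟩
      (v ∙ y) ∙ i · y ≈⟨ assoc v y (i · y) ⟩
      v ∙ (y ∙ i · y) ∎

  module BicyclicProperties {G : Monoid 0ℓ 0ℓ} {m n : ℕ} ⦃ _ : NonZero m ⦄ ⦃ _ : NonZero n ⦄ (B : Bicyclic G m n) where
    open Monoid G
    open Powers G public
    open Bicyclic B public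
    open Relation.Binary.Reasoning.Setoid setoid

    private
      inverse-power : ∀ {x k} .⦃ _ : NonZero k ⦄ → k · x ≈ ε → ∀ i → (pred k ℕ.* i) · x ∙ i · x ≈ ε
      inverse-power {x} {k} x^k i = trans (sym (·-+ x (pred k ℕ.* i) i))
        (trans (reflexive (≡.cong (_· x) (neg-sum k i))) (·-multiple k x^k 0 i))

      product-inverse : ∀ {x x′ y y′} → x′ ∙ x ≈ ε → y′ ∙ y ≈ ε → (y′ ∙ x′) ∙ (x ∙ y) ≈ ε
      product-inverse {x} {x′} {y} {y′} e e′ = begin
        (y′ ∙ x′) ∙ (x ∙ y) ≈⟨ assoc y′ x′ (x ∙ y) ⟩
        y′ ∙ (x′ ∙ (x ∙ y)) ≈⟨ ∙-congˡ (sym (assoc x′ x y)) ⟩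
        y′ ∙ ((x′ ∙ x) ∙ y) ≈⟨ ∙-congˡ (trans (∙-congʳ e) (identityˡ y)) ⟩
        y′ ∙ y              ≈⟨ e′ ⟩
        ε                   ∎

    a⁻ b⁻ : ℕ → ℕ
    a⁻ i = pred m ℕ.* i
    b⁻ j = pred n ℕ.* j

    a⁻∙a : ∀ i → a⁻ i · a ∙ i · a ≈ ε
    a⁻∙a = inverse-power a-order

    b⁻∙b : ∀ j → b⁻ j · b ∙ j · b ≈ ε
    b⁻∙b = inverse-power b-order

    a∙a⁻ : ∀ i → i · a ∙ a⁻ i · a ≈ ε
    a∙a⁻ i = trans (·-comm a i (a⁻ i)) (a⁻∙a i)

    b∙b⁻ : ∀ j → j · b ∙ b⁻ j · b ≈ ε
    b∙b⁻ j = trans (·-comm b j (b⁻ j)) (b⁻∙b j)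

    record Inverse (g : Carrier) : Set where
      field
        i j   : ℕ
        left  : (j · b ∙ i · a) ∙ g ≈ ε
        right : g ∙ (j · b ∙ i · a) ≈ ε

    inverse-of : ∀ g → Inverse g
    inverse-of g with factor g
    ... | i , j , e = record
      { i     = a⁻ i
      ; j     = b⁻ j
      ; left  = trans (∙-congˡ e) (product-inverse (a⁻∙a i) (b⁻∙b j))
      ; right = trans (∙-congʳ e) (product-inverse (b∙b⁻ j) (a∙a⁻ i))
      }

    left-cancel : ∀ g {x y} → g ∙ x ≈ g ∙ y → x ≈ y
    left-cancel g {x} {y} e = begin
      x                          ≈⟨ sym (trans (∙-congʳ left) (identityˡ x)) ⟩
      ((j · b ∙ i · a) ∙ g) ∙ x  ≈⟨ assoc (j · b ∙ i · a) g x ⟩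
      (j · b ∙ i · a) ∙ (g ∙ x)  ≈⟨ ∙-congˡ e ⟩
      (j · b ∙ i · a) ∙ (g ∙ y)  ≈⟨ sym (assoc (j · b ∙ i · a) g y) ⟩
      ((j · b ∙ i · a) ∙ g) ∙ y  ≈⟨ trans (∙-congʳ left) (identityˡ y) ⟩
      y                          ∎
      where open Inverse (inverse-of g)

    right-cancel : ∀ g {x y} → x ∙ g ≈ y ∙ g → x ≈ y
    right-cancel g {x} {y} e = begin
      x                          ≈⟨ sym (trans (∙-congˡ right) (identityʳ x)) ⟩
      x ∙ (g ∙ (j · b ∙ i · a))  ≈⟨ sym (assoc x g (j · b ∙ i · a)) ⟩
      (x ∙ g) ∙ (j · b ∙ i · a)  ≈⟨ ∙-congʳ e ⟩
      (y ∙ g) ∙ (j · b ∙ i · a)  ≈⟨ assoc y g (j · b ∙ i · a) ⟩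
      y ∙ (g ∙ (j · b ∙ i · a))  ≈⟨ trans (∙-congˡ right) (identityʳ y) ⟩
      y                          ∎
      where open Inverse (inverse-of g)

    private
      neg⇒≡ : ∀ k i i′ .⦃ _ : NonZero k ⦄ → k ∣ pred k ℕ.* i′ ℕ.+ i → + i ≡ + i′ [ + k ]
      neg⇒≡ (suc k) i i′ d = comb₂ ℤ.1ℤ (ℤ.- (+ i′)) (∣⇒0[] d) (⇒0[] {+ suc k} ℤ.1ℤ (≡.sym (ℤ.*-identityʳ (+ suc k))))
        (≡.trans (lem (+ k) (+ i) (+ i′))
          (≡.cong (λ t → ℤ.1ℤ ℤ.* (t ℤ.+ + i ℤ.- ℤ.0ℤ) ℤ.+ ℤ.- (+ i′) ℤ.* ((ℤ.1ℤ ℤ.+ + k) ℤ.- ℤ.0ℤ))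
            (≡.sym (ℤ.pos-* k i′))))
        where
        lem : ∀ k i i′ → i ℤ.- i′ ≡ ℤ.1ℤ ℤ.* (k ℤ.* i′ ℤ.+ i ℤ.- ℤ.0ℤ) ℤ.+ ℤ.- i′ ℤ.* ((ℤ.1ℤ ℤ.+ k) ℤ.- ℤ.0ℤ)
        lem = solve-∀

    factor-unique : ∀ {i j i′ j′} → i · a ∙ j · b ≈ i′ · a ∙ j′ · b →
                    + i ≡ + i′ [ + m ] × + j ≡ + j′ [ + n ]
    factor-unique {i} {j} {i′} {j′} e =
      neg⇒≡ m i i′ (proj₁ divisors) , ≡-sym (neg⇒≡ n j′ j (≡.subst (n ∣_) (ℕ.+-comm j′ (b⁻ j)) (proj₂ divisors)))
      where
      divisors : m ∣ a⁻ i′ ℕ.+ i × n ∣ j′ ℕ.+ b⁻ j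
      divisors = disjoint (a⁻ i′ ℕ.+ i) (j′ ℕ.+ b⁻ j) (begin
        (a⁻ i′ ℕ.+ i) · a                          ≈⟨ ·-+ a (a⁻ i′) i ⟩
        a⁻ i′ · a ∙ i · a                          ≈⟨ ∙-congˡ (sym (identityʳ (i · a))) ⟩
        a⁻ i′ · a ∙ (i · a ∙ ε)                    ≈⟨ ∙-congˡ (∙-congˡ (sym (b∙b⁻ j))) ⟩
        a⁻ i′ · a ∙ (i · a ∙ (j · b ∙ b⁻ j · b))   ≈⟨ ∙-congˡ (sym (assoc (i · a) (j · b) (b⁻ j · b))) ⟩
        a⁻ i′ · a ∙ ((i · a ∙ j · b) ∙ b⁻ j · b)   ≈⟨ ∙-congˡ (∙-congʳ e) ⟩
        a⁻ i′ · a ∙ ((i′ · a ∙ j′ · b) ∙ b⁻ j · b) ≈⟨ ∙-congˡ (assoc (i′ · a) (j′ · b) (b⁻ j · b)) ⟩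
        a⁻ i′ · a ∙ (i′ · a ∙ (j′ · b ∙ b⁻ j · b)) ≈⟨ sym (assoc (a⁻ i′ · a) (i′ · a) (j′ · b ∙ b⁻ j · b)) ⟩
        (a⁻ i′ · a ∙ i′ · a) ∙ (j′ · b ∙ b⁻ j · b) ≈⟨ ∙-congʳ (a⁻∙a i′) ⟩
        ε ∙ (j′ · b ∙ b⁻ j · b)                    ≈⟨ identityˡ (j′ · b ∙ b⁻ j · b) ⟩
        j′ · b ∙ b⁻ j · b                          ≈⟨ sym (·-+ b j′ (b⁻ j)) ⟩
        (j′ ℕ.+ b⁻ j) · b                          ∎)

    -- G = ⟨a⟩⟨b⟩ gives G = ⟨b⟩⟨a⟩: the inverse of g is factorised and the factorisation is
    -- inverted.
    swap : Bicyclic G n m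
    swap = record
      { a        = b
      ; b        = a
      ; a-order  = b-order
      ; b-order  = a-order
      ; disjoint = λ i j e → let p , q = disjoint j i (sym e) in q , p
      ; factor   = λ g → factor′ g (inverse-of g)
      }
      where
      factor′ : ∀ g → Inverse g → ∃₂ λ i j → g ≈ i · b ∙ j · a
      factor′ g I = b⁻ j′ , a⁻ i′ , right-cancel (i′ · a ∙ j′ · b)
        (trans (trans (∙-congˡ (sym e)) right)
          (sym (product-inverse (a⁻∙a i′) (b⁻∙b j′))))
        where
        open Inverse I
        i′ = proj₁ (factor (j · b ∙ i · a))
        j′ = proj₁ (proj₂ (factor (j · b ∙ i · a)))
        e = proj₂ (proj₂ (factor (j · b ∙ i · a)))

  -- The quotient by a central subgroup of ⟨b⟩

  module Quotient {G : Monoid 0ℓ 0ℓ} {m k : ℕ} (q : ℕ) ⦃ _ : NonZero m ⦄ ⦃ _ : NonZero q ⦄ ⦃ _ : NonZero (q ℕ.* k) ⦄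
    (B : Bicyclic G m (q ℕ.* k))
    (central : IsCentral G (Mult._×_ G k (Bicyclic.b B))) where

    open Monoid G
    open BicyclicProperties B

    private
      z = k · b
      open Relation.Binary.Reasoning.Setoid setoid

    infix 4 _∼_

    _∼_ : Carrier → Carrier → Set
    x ∼ y = ∃ λ t → x ≈ y ∙ t · z

    ≈⇒∼ : ∀ {x y} → x ≈ y → x ∼ y
    ≈⇒∼ {y = y} e = 0 , trans e (sym (identityʳ y))

    private
      central-· : ∀ t g → t · z ∙ g ≈ g ∙ t · z
      central-· t g = commute-· (central g) t

      z-order : q · z ≈ ε
      z-order = trans (·-· b q k) b-order

      ∼-sym : ∀ {x y} → x ∼ y → y ∼ x
      ∼-sym {x} {y} (t , e) = pred q ℕ.* t , (begin
        y                          ≈⟨ sym (identityʳ y) ⟩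
        y ∙ ε                      ≈⟨ ∙-congˡ (sym (·-multiple q z-order 0 t)) ⟩
        y ∙ (q ℕ.* t) · z          ≡⟨ ≡.cong (λ s → y ∙ s · z) (≡.trans (≡.sym (neg-sum q t)) (ℕ.+-comm (pred q ℕ.* t) t)) ⟩
        y ∙ (t ℕ.+ pred q ℕ.* t) · z    ≈⟨ ∙-congˡ (·-+ z t (pred q ℕ.* t)) ⟩
        y ∙ (t · z ∙ (pred q ℕ.* t) · z) ≈⟨ sym (assoc y (t · z) ((pred q ℕ.* t) · z)) ⟩
        (y ∙ t · z) ∙ (pred q ℕ.* t) · z ≈⟨ ∙-congʳ (sym e) ⟩
        x ∙ (pred q ℕ.* t) · z           ∎)

      ∼-trans : ∀ {x y w} → x ∼ y → y ∼ w → x ∼ w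
      ∼-trans {x} {y} {w} (s , e) (t , e′) = t ℕ.+ s , (begin
        x                    ≈⟨ e ⟩
        y ∙ s · z            ≈⟨ ∙-congʳ e′ ⟩
        (w ∙ t · z) ∙ s · z  ≈⟨ assoc w (t · z) (s · z) ⟩
        w ∙ (t · z ∙ s · z)  ≈⟨ ∙-congˡ (sym (·-+ z t s)) ⟩
        w ∙ (t ℕ.+ s) · z    ∎)

      ∼-∙-cong : ∀ {x y u v} → x ∼ y → u ∼ v → x ∙ u ∼ y ∙ v
      ∼-∙-cong {x} {y} {u} {v} (s , e) (t , e′) = s ℕ.+ t , (begin
        x ∙ u                      ≈⟨ ∙-cong e e′ ⟩
        (y ∙ s · z) ∙ (v ∙ t · z)  ≈⟨ assoc y (s · z) (v ∙ t · z) ⟩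
        y ∙ (s · z ∙ (v ∙ t · z))  ≈⟨ ∙-congˡ (sym (assoc (s · z) v (t · z))) ⟩
        y ∙ ((s · z ∙ v) ∙ t · z)  ≈⟨ ∙-congˡ (∙-congʳ (central-· s v)) ⟩
        y ∙ ((v ∙ s · z) ∙ t · z)  ≈⟨ ∙-congˡ (assoc v (s · z) (t · z)) ⟩
        y ∙ (v ∙ (s · z ∙ t · z))  ≈⟨ sym (assoc y v (s · z ∙ t · z)) ⟩
        (y ∙ v) ∙ (s · z ∙ t · z)  ≈⟨ ∙-congˡ (sym (·-+ z s t)) ⟩
        (y ∙ v) ∙ (s ℕ.+ t) · z    ∎)

    G/z : Monoid 0ℓ 0ℓ
    G/z = record
      { Carrier  = Carrier
      ; _≈_      = _∼_
      ; _∙_      = _∙_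
      ; ε        = ε
      ; isMonoid = record
        { isSemigroup = record
          { isMagma = record
            { isEquivalence = record { refl = ≈⇒∼ refl ; sym = ∼-sym ; trans = ∼-trans }
            ; ∙-cong        = ∼-∙-cong
            }
          ; assoc   = λ x y w → ≈⇒∼ (assoc x y w)
          }
        ; identity = (λ x → ≈⇒∼ (identityˡ x)) , (λ x → ≈⇒∼ (identityʳ x))
        }
      }

    private
      module Q = Powers G/z

    ·≡ : ∀ i x → i Q.· x ≡ i · x
    ·≡ zero    x = ≡.refl
    ·≡ (suc i) x = ≡.cong (x ∙_) (·≡ i x)

    -- If aⁱ = bʲ zᵗ, then aⁱ is the power of b with exponent j + t k in G, so q k divides j + t k
    -- and hence k divides j: the intersection stays trivial.
    B/z : Bicyclic G/z m k
    B/z = record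
      { a        = a
      ; b        = b
      ; a-order  = ≈⇒∼ (trans (reflexive (·≡ m a)) a-order)
      ; b-order  = 1 , trans (reflexive (·≡ k b)) (sym (trans (identityˡ (1 · z)) (identityʳ z)))
      ; disjoint = λ i j (t , e) → disjoint′ i j t (trans (trans (reflexive (≡.sym (·≡ i a))) e)
                     (∙-congʳ (reflexive (·≡ j b))))
      ; factor   = λ g → let i , j , e = factor g in i , j ,
                     ≈⇒∼ (trans e (∙-cong (reflexive (≡.sym (·≡ i a))) (reflexive (≡.sym (·≡ j b)))))
      }
      where
      disjoint′ : ∀ i j t → i · a ≈ j · b ∙ t · z → m ∣ i × k ∣ j
      disjoint′ i j t e = let d , d′ = disjoint i (j ℕ.+ t ℕ.* k) (trans e
                                (trans (∙-congˡ (·-· b t k)) (sym (·-+ b j (t ℕ.* k))))) in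
        d , ∣m+n∣m⇒∣n (≡.subst (k ∣_) (ℕ.+-comm j (t ℕ.* k)) (∣-trans (n∣m*n q) d′)) (n∣m*n t)

-- Centrality of the subgroup of order p in ⟨b⟩

module Central where

  open import Data.Nat as ℕ using (ℕ; zero; suc; NonZero; _≤_; _<_; s≤s)
  open import Data.Nat.GCD using (gcd; gcd[m,n]∣m; gcd[m,n]∣n; gcd-GCD; module Bézout)
  open import Data.Integer using (+_)
  open import Relation.Binary.PropositionalEquality as ≡ using (_≡_)
  import Relation.Binary.Reasoning.Setoid
  open Congruences
  open Bicyclics

  module _ {p : ℕ} (p-prime : Prime p) where

    private instance
      p-nonZero : NonZero p
      p-nonZero = prime⇒nonZero p-prime

    cofactor-one : ∀ n {q d} → ¬ p ∣ q → q ℕ.* d ≡ p ℕ.^ n → q ≡ 1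
    cofactor-one zero    {q} {d} _ e = ℕ.m*n≡1⇒m≡1 q d e
    cofactor-one (suc n) {q} {d} ¬p∣q e with euclidsLemma q d p-prime (≡.subst (p ∣_) (≡.sym e) (m∣m*n (p ℕ.^ n)))
    ... | inj₁ p∣q = contradiction p∣q ¬p∣q
    ... | inj₂ (divides d′ ≡.refl) = cofactor-one n {q} {d′} ¬p∣q
      (ℕ.*-cancelˡ-≡ (q ℕ.* d′) (p ℕ.^ n) p (≡.trans (≡.trans (ℕ.*-comm p (q ℕ.* d′)) (ℕ.*-assoc q d′ p)) e))

    proper-divisor : ∀ {d} n → d ∣ p ℕ.^ suc n → d < p ℕ.^ suc n → d ∣ p ℕ.^ n
    proper-divisor {d} n (divides q e) d< with p ∣? q
    ... | yes (divides q′ ≡.refl) = divides q′ (ℕ.*-cancelˡ-≡ (p ℕ.^ n) (q′ ℕ.* d) p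
            (≡.trans e (≡.trans (≡.cong (ℕ._* d) (ℕ.*-comm q′ p)) (ℕ.*-assoc p q′ d))))
    ... | no ¬p∣q = contradiction (≡.trans (≡.sym (ℕ.*-identityˡ d))
            (≡.trans (≡.cong (ℕ._* d) (≡.sym (cofactor-one (suc n) {q} {d} ¬p∣q (≡.sym e)))) (≡.sym e))) (ℕ.<⇒≢ d<)

    module _ (K : ℕ → Set) (K-zero : K 0) (K-+ : ∀ i j → K i → K j → K (i ℕ.+ j))
             (K-∸ : ∀ i j → K i → K (i ℕ.+ j) → K j) where

      private
        K-* : ∀ s {i} → K i → K (s ℕ.* i)
        K-* zero        _ = K-zero
        K-* (suc s) {i} k = K-+ i (s ℕ.* i) k (K-* s k)

      K-gcd : ∀ i j → K i → K j → K (gcd i j)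
      K-gcd i j ki kj with Bézout.identity (gcd-GCD i j)
      ... | Bézout.+- x y e = K-∸ (y ℕ.* j) (gcd i j) (K-* y kj)
            (≡.subst K (≡.trans (≡.sym e) (ℕ.+-comm (gcd i j) (y ℕ.* j))) (K-* x ki))
      ... | Bézout.-+ x y e = K-∸ (x ℕ.* i) (gcd i j) (K-* x ki)
            (≡.subst K (≡.trans (≡.sym e) (ℕ.+-comm (gcd i j) (x ℕ.* i))) (K-* y kj))

      -- A set of exponents closed under sums and differences contains gcd(k, pⁿ⁺¹), a proper
      -- divisor of pⁿ⁺¹ and hence a divisor of pⁿ. This serves both for stabilisers of cosets in
      -- ⟨b⟩ and for the centraliser of z in ⟨a⟩.
      K-lower : ∀ n {k} → K (p ℕ.^ suc n) → K k → 0 < k → k < p ℕ.^ suc n → K (p ℕ.^ n)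
      K-lower n {k} kp kk 0<k k< with proper-divisor n (gcd[m,n]∣n k (p ℕ.^ suc n))
        (ℕ.≤-<-trans (∣⇒≤ ⦃ ℕ.>-nonZero 0<k ⦄ (gcd[m,n]∣m k (p ℕ.^ suc n))) k<)
      ... | divides s e = ≡.subst K (≡.sym e) (K-* s (K-gcd k (p ℕ.^ suc n) kk kp))

      K-one : ∀ d {k} → K (p ℕ.^ d) → K k → 0 < k → k < p → K 1
      K-one zero    kp _ _ _ = kp
      K-one (suc d) kp kk 0<k k<p = K-one d (K-lower d kp kk 0<k
        (ℕ.<-≤-trans k<p (ℕ.m≤m*n p (p ℕ.^ d) ⦃ ℕ.m^n≢0 p d ⦄))) kk 0<k k<p

    module _ {G : Monoid 0ℓ 0ℓ} {d e : ℕ} (d≤e : d ≤ suc e) (B : Bicyclic G (p ℕ.^ d) (p ℕ.^ suc e)) where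

      private
        m = p ℕ.^ d
        n = p ℕ.^ suc e
        instance
          m-nonZero : NonZero m
          m-nonZero = ℕ.m^n≢0 p d
          n-nonZero : NonZero n
          n-nonZero = ℕ.m^n≢0 p (suc e)

        m≤n : m ≤ n
        m≤n = ℕ.^-monoʳ-≤ p d≤e

      open Monoid G
      open BicyclicProperties B
      open Relation.Binary.Reasoning.Setoid setoid

      private
        z = (p ℕ.^ e) · b

        module _ (v : Carrier) where

          -- The stabiliser of the coset v⟨b⟩ in ⟨b⟩, as a set of exponents.
          K : ℕ → Set
          K k = ∃ λ j → k · b ∙ v ≈ v ∙ j · b

          K-zero′ : K 0
          K-zero′ = 0 , trans (identityˡ v) (sym (identityʳ v))

          K-+′ : ∀ k l → K k → K l → K (k ℕ.+ l)
          K-+′ k l (i , e₁) (j , e₂) = i ℕ.+ j , (begin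
            (k ℕ.+ l) · b ∙ v       ≈⟨ ∙-congʳ (·-+ b k l) ⟩
            (k · b ∙ l · b) ∙ v     ≈⟨ assoc (k · b) (l · b) v ⟩
            k · b ∙ (l · b ∙ v)     ≈⟨ ∙-congˡ e₂ ⟩
            k · b ∙ (v ∙ j · b)     ≈⟨ sym (assoc (k · b) v (j · b)) ⟩
            (k · b ∙ v) ∙ j · b     ≈⟨ ∙-congʳ e₁ ⟩
            (v ∙ i · b) ∙ j · b     ≈⟨ assoc v (i · b) (j · b) ⟩
            v ∙ (i · b ∙ j · b)     ≈⟨ ∙-congˡ (sym (·-+ b i j)) ⟩
            v ∙ (i ℕ.+ j) · b       ∎)

          K-∸′ : ∀ k l → K k → K (k ℕ.+ l) → K l
          K-∸′ k l (i , e₁) (j , e₂) = b⁻ i ℕ.+ j , left-cancel (k · b) (begin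
            k · b ∙ (l · b ∙ v)                   ≈⟨ sym (assoc (k · b) (l · b) v) ⟩
            (k · b ∙ l · b) ∙ v                   ≈⟨ ∙-congʳ (sym (·-+ b k l)) ⟩
            (k ℕ.+ l) · b ∙ v                     ≈⟨ e₂ ⟩
            v ∙ j · b                             ≈⟨ ∙-congˡ (sym (trans (∙-congʳ (b∙b⁻ i)) (identityˡ (j · b)))) ⟩
            v ∙ ((i · b ∙ b⁻ i · b) ∙ j · b)      ≈⟨ ∙-congˡ (assoc (i · b) (b⁻ i · b) (j · b)) ⟩
            v ∙ (i · b ∙ (b⁻ i · b ∙ j · b))      ≈⟨ sym (assoc v (i · b) (b⁻ i · b ∙ j · b)) ⟩
            (v ∙ i · b) ∙ (b⁻ i · b ∙ j · b)      ≈⟨ ∙-cong (sym e₁) (sym (·-+ b (b⁻ i) j)) ⟩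
            (k · b ∙ v) ∙ (b⁻ i ℕ.+ j) · b        ≈⟨ assoc (k · b) v ((b⁻ i ℕ.+ j) · b) ⟩
            k · b ∙ (v ∙ (b⁻ i ℕ.+ j) · b)        ∎)

          label : ∀ k → ∃₂ λ (i : Fin m) j → k · b ∙ v ≈ toℕ i · a ∙ j · b
          label k with factor (k · b ∙ v)
          ... | i , j , eq = Fin.fromℕ< (ℕ.m%n<n i m) , j , trans eq (∙-congʳ
            (trans (reflexive (≡.cong (_· a) (ℕ.m≡m%n+[m/n]*n i m)))
              (trans (reflexive (≡.cong₂ (λ s t → (s ℕ.+ t) · a) (≡.sym (Fin.toℕ-fromℕ< (ℕ.m%n<n i m))) (ℕ.*-comm (i ℕ./ m) m)))
                (·-multiple m a-order (toℕ (Fin.fromℕ< (ℕ.m%n<n i m))) (i ℕ./ m)))))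

          -- Index 0 stands for the coset ⟨b⟩ itself, the others for bᵏ v⟨b⟩ with k < n. This extra
          -- name makes a collision certain even when m = n.
          f : Fin (suc n) → Fin m
          f Fin.zero    = Fin.fromℕ< (ℕ.>-nonZero⁻¹ m)
          f (Fin.suc k) = proj₁ (label (toℕ k))

          -- An orbit of ⟨b⟩ on the m ≤ n cosets of ⟨b⟩, other than the fixed point ⟨b⟩ itself, has fewer than n points.
          K-n/p : K (p ℕ.^ e)
          K-n/p with Fin.pigeonhole (s≤s m≤n) f
          ... | Fin.zero , Fin.suc k , _ , eq = let i , j , e₁ = label (toℕ k) in
            K-b (toℕ k) j (trans e₁ (trans (∙-congʳ (reflexive (≡.cong (_· a) (≡.trans (≡.sym (≡.cong toℕ eq))
              (Fin.toℕ-fromℕ< (ℕ.>-nonZero⁻¹ m)))))) (identityˡ (j · b))))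
            where
            K-b : ∀ k j → k · b ∙ v ≈ j · b → K (p ℕ.^ e)
            K-b k j e₁ = p ℕ.^ e , trans (∙-congˡ v≈) (trans (·-comm b (p ℕ.^ e) (b⁻ k ℕ.+ j)) (∙-congʳ (sym v≈)))
              where
              v≈ : v ≈ (b⁻ k ℕ.+ j) · b
              v≈ = left-cancel (k · b) (begin
                k · b ∙ v                     ≈⟨ trans e₁ (sym (identityˡ (j · b))) ⟩
                ε ∙ j · b                     ≈⟨ ∙-congʳ (sym (b∙b⁻ k)) ⟩
                (k · b ∙ b⁻ k · b) ∙ j · b    ≈⟨ assoc (k · b) (b⁻ k · b) (j · b) ⟩
                k · b ∙ (b⁻ k · b ∙ j · b)    ≈⟨ ∙-congˡ (sym (·-+ b (b⁻ k) j)) ⟩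
                k · b ∙ (b⁻ k ℕ.+ j) · b      ∎)
          ... | Fin.suc k , Fin.suc l , s≤s k<l , eq = let i , j , e₁ = label (toℕ k) ; i′ , j′ , e₂ = label (toℕ l) in
            K-lower K K-zero′ K-+′ K-∸′ e K-n (K-difference i i′ j j′ e₁ e₂ eq)
              (ℕ.m<n⇒0<n∸m k<l) (ℕ.≤-<-trans (ℕ.m∸n≤m (toℕ l) (toℕ k)) (Fin.toℕ<n l))
            where
            K-n : K n
            K-n = 0 , trans (∙-congʳ b-order) (trans (identityˡ v) (sym (identityʳ v)))
            K-difference : ∀ i i′ j j′ → toℕ k · b ∙ v ≈ toℕ i · a ∙ j · b → toℕ l · b ∙ v ≈ toℕ {m} i′ · a ∙ j′ · b →
                           i ≡ i′ → K (toℕ l ℕ.∸ toℕ k)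
            K-difference i .i j j′ e₁ e₂ ≡.refl = b⁻ j ℕ.+ j′ , left-cancel (toℕ k · b) (begin
              toℕ k · b ∙ ((toℕ l ℕ.∸ toℕ k) · b ∙ v)  ≈⟨ sym (assoc (toℕ k · b) ((toℕ l ℕ.∸ toℕ k) · b) v) ⟩
              (toℕ k · b ∙ (toℕ l ℕ.∸ toℕ k) · b) ∙ v  ≈⟨ ∙-congʳ (sym (·-+ b (toℕ k) (toℕ l ℕ.∸ toℕ k))) ⟩
              (toℕ k ℕ.+ (toℕ l ℕ.∸ toℕ k)) · b ∙ v    ≡⟨ ≡.cong (λ t → t · b ∙ v) (ℕ.m+[n∸m]≡n (ℕ.<⇒≤ k<l)) ⟩
              toℕ l · b ∙ v                            ≈⟨ e₂ ⟩
              toℕ i · a ∙ j′ · b                       ≈⟨ ∙-congˡ (sym (trans (∙-congʳ (b∙b⁻ j)) (identityˡ (j′ · b)))) ⟩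
              toℕ i · a ∙ ((j · b ∙ b⁻ j · b) ∙ j′ · b) ≈⟨ ∙-congˡ (assoc (j · b) (b⁻ j · b) (j′ · b)) ⟩
              toℕ i · a ∙ (j · b ∙ (b⁻ j · b ∙ j′ · b)) ≈⟨ sym (assoc (toℕ i · a) (j · b) (b⁻ j · b ∙ j′ · b)) ⟩
              (toℕ i · a ∙ j · b) ∙ (b⁻ j · b ∙ j′ · b) ≈⟨ ∙-cong (sym e₁) (sym (·-+ b (b⁻ j) j′)) ⟩
              (toℕ k · b ∙ v) ∙ (b⁻ j ℕ.+ j′) · b      ≈⟨ assoc (toℕ k · b) v ((b⁻ j ℕ.+ j′) · b) ⟩
              toℕ k · b ∙ (v ∙ (b⁻ j ℕ.+ j′) · b)      ∎)

          -- From z v = v bʲ the p-th power gives that p j is a multiple of the order of b, so pᵉ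
          -- divides j and bʲ is a power of z. Reducing its exponent modulo p leaves p possible
          -- values.
          z-conj : ∃ λ (c : Fin p) → z ∙ v ≈ v ∙ toℕ c · z
          z-conj with K-n/p
          ... | j , eq = from (proj₂ (disjoint 0 (p ℕ.* j) (sym (left-cancel v (begin
            v ∙ (p ℕ.* j) · b ≈⟨ ∙-congˡ (sym (·-· b p j)) ⟩
            v ∙ p · (j · b)   ≈⟨ sym (commute-· eq p) ⟩
            p · z ∙ v         ≈⟨ ∙-congʳ (trans (·-· b p (p ℕ.^ e)) b-order) ⟩
            ε ∙ v             ≈⟨ identityˡ v ⟩
            v                 ≈⟨ sym (identityʳ v) ⟩
            v ∙ ε             ∎)))))
            where
            from : n ∣ p ℕ.* j → ∃ λ (c : Fin p) → z ∙ v ≈ v ∙ toℕ c · z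
            from n∣ with *-cancelˡ-∣ p n∣
            ... | divides q ≡.refl = Fin.fromℕ< (ℕ.m%n<n q p) , trans eq (∙-congˡ (trans (sym (·-· b q (p ℕ.^ e)))
              (trans (reflexive (≡.cong (_· z) (ℕ.m≡m%n+[m/n]*n q p)))
                (trans (reflexive (≡.cong₂ (λ s t → (s ℕ.+ t) · z) (≡.sym (Fin.toℕ-fromℕ< (ℕ.m%n<n q p))) (ℕ.*-comm (q ℕ./ p) p)))
                  (·-multiple p (trans (·-· b p (p ℕ.^ e)) b-order) (toℕ (Fin.fromℕ< (ℕ.m%n<n q p))) (q ℕ./ p))))))

        C : ℕ → Set
        C k = z ∙ k · a ≈ k · a ∙ z

        C-zero : C 0
        C-zero = trans (identityʳ z) (sym (identityˡ z))

        C-+ : ∀ k l → C k → C l → C (k ℕ.+ l)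
        C-+ k l e₁ e₂ = begin
          z ∙ (k ℕ.+ l) · a     ≈⟨ ∙-congˡ (·-+ a k l) ⟩
          z ∙ (k · a ∙ l · a)   ≈⟨ sym (assoc z (k · a) (l · a)) ⟩
          (z ∙ k · a) ∙ l · a   ≈⟨ ∙-congʳ e₁ ⟩
          (k · a ∙ z) ∙ l · a   ≈⟨ assoc (k · a) z (l · a) ⟩
          k · a ∙ (z ∙ l · a)   ≈⟨ ∙-congˡ e₂ ⟩
          k · a ∙ (l · a ∙ z)   ≈⟨ sym (assoc (k · a) (l · a) z) ⟩
          (k · a ∙ l · a) ∙ z   ≈⟨ ∙-congʳ (sym (·-+ a k l)) ⟩
          (k ℕ.+ l) · a ∙ z     ∎

        C-∸ : ∀ k l → C k → C (k ℕ.+ l) → C l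
        C-∸ k l e₁ e₂ = left-cancel (k · a) (begin
          k · a ∙ (z ∙ l · a)   ≈⟨ sym (assoc (k · a) z (l · a)) ⟩
          (k · a ∙ z) ∙ l · a   ≈⟨ ∙-congʳ (sym e₁) ⟩
          (z ∙ k · a) ∙ l · a   ≈⟨ assoc z (k · a) (l · a) ⟩
          z ∙ (k · a ∙ l · a)   ≈⟨ ∙-congˡ (sym (·-+ a k l)) ⟩
          z ∙ (k ℕ.+ l) · a     ≈⟨ e₂ ⟩
          (k ℕ.+ l) · a ∙ z     ≈⟨ ∙-congʳ (·-+ a k l) ⟩
          (k · a ∙ l · a) ∙ z   ≈⟨ assoc (k · a) (l · a) z ⟩
          k · a ∙ (l · a ∙ z)   ∎)

        C-difference : ∀ k l c → k ≤ l → z ∙ k · a ≈ k · a ∙ c · z → z ∙ l · a ≈ l · a ∙ c · z → C (l ℕ.∸ k)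
        C-difference k l c k≤l e₁ e₂ = right-cancel (k · a) (begin
          (z ∙ r · a) ∙ k · a     ≈⟨ assoc z (r · a) (k · a) ⟩
          z ∙ (r · a ∙ k · a)     ≈⟨ ∙-congˡ l≈ ⟩
          z ∙ l · a               ≈⟨ e₂ ⟩
          l · a ∙ c · z           ≈⟨ ∙-congʳ (sym l≈) ⟩
          (r · a ∙ k · a) ∙ c · z ≈⟨ assoc (r · a) (k · a) (c · z) ⟩
          r · a ∙ (k · a ∙ c · z) ≈⟨ ∙-congˡ (sym e₁) ⟩
          r · a ∙ (z ∙ k · a)     ≈⟨ sym (assoc (r · a) z (k · a)) ⟩
          (r · a ∙ z) ∙ k · a     ∎)
          where
          r = l ℕ.∸ k
          l≈ : r · a ∙ k · a ≈ l · a
          l≈ = trans (sym (·-+ a r k)) (reflexive (≡.cong (_· a) (ℕ.m∸n+n≡m k≤l)))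

        z≉ε : ¬ z ≈ ε
        z≉ε eq = ℕ.<⇒≱ (ℕ.^-monoʳ-< p (ℕ.nonTrivial⇒n>1 p) (ℕ.n<1+n e))
          (∣⇒≤ ⦃ ℕ.m^n≢0 p e ⦄ (proj₂ (disjoint 0 (p ℕ.^ e) (sym eq))))
          where instance _ = prime⇒nonTrivial p-prime

        c : Fin (suc p) → Fin p
        c Fin.zero    = Fin.fromℕ< (ℕ.>-nonZero⁻¹ p)
        c (Fin.suc k) = proj₁ (z-conj (toℕ k · a))

        -- Index 0 of `c` carries the exponent 0, which conjugation cannot produce since z is not 1;
        -- so two of 1, a, ..., aᵖ⁻¹ act alike on z. Their quotient aʳ with 0 < r < p centralises z,
        -- and descending from pᵈ by `K-one` yields a itself.
        C-one : C 1
        C-one with Fin.pigeonhole (ℕ.n<1+n p) c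
        ... | Fin.zero , Fin.suc k , _ , eq = ⊥-elim (impossible (proj₁ (z-conj (toℕ k · a))) (proj₂ (z-conj (toℕ k · a))) eq)
          where
          impossible : ∀ c → z ∙ toℕ k · a ≈ toℕ k · a ∙ toℕ c · z → Fin.fromℕ< (ℕ.>-nonZero⁻¹ p) ≡ c → ⊥
          impossible c e₁ ≡.refl = z≉ε (right-cancel (toℕ k · a) (trans e₁
            (trans (∙-congˡ (reflexive (≡.cong (_· z) (Fin.toℕ-fromℕ< (ℕ.>-nonZero⁻¹ p)))))
              (trans (identityʳ (toℕ k · a)) (sym (identityˡ (toℕ k · a)))))))
        ... | Fin.suc k , Fin.suc l , s≤s k<l , eq = K-one C C-zero C-+ C-∸ d
            (trans (∙-congˡ a-order) (trans C-zero (∙-congʳ (sym a-order))))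
            (same (proj₁ (z-conj (toℕ k · a))) (proj₁ (z-conj (toℕ l · a)))
              (proj₂ (z-conj (toℕ k · a))) (proj₂ (z-conj (toℕ l · a))) eq)
            (ℕ.m<n⇒0<n∸m k<l) (ℕ.≤-<-trans (ℕ.m∸n≤m (toℕ l) (toℕ k)) (Fin.toℕ<n l))
          where
          same : ∀ c c′ → z ∙ toℕ k · a ≈ toℕ k · a ∙ toℕ c · z → z ∙ toℕ l · a ≈ toℕ l · a ∙ toℕ c′ · z →
                 c ≡ c′ → C (toℕ l ℕ.∸ toℕ k)
          same c .c e₁ e₂ ≡.refl = C-difference (toℕ k) (toℕ l) (toℕ c) (ℕ.<⇒≤ k<l) e₁ e₂

      socle-central : IsCentral G ((p ℕ.^ e) · b)
      socle-central g with factor g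
      ... | i , j , eq = begin
        z ∙ g                 ≈⟨ ∙-congˡ eq ⟩
        z ∙ (i · a ∙ j · b)   ≈⟨ sym (assoc z (i · a) (j · b)) ⟩
        (z ∙ i · a) ∙ j · b   ≈⟨ ∙-congʳ (sym (commute-· a∙z i)) ⟩
        (i · a ∙ z) ∙ j · b   ≈⟨ assoc (i · a) z (j · b) ⟩
        i · a ∙ (z ∙ j · b)   ≈⟨ ∙-congˡ (·-comm b (p ℕ.^ e) j) ⟩
        i · a ∙ (j · b ∙ z)   ≈⟨ sym (assoc (i · a) (j · b) z) ⟩
        (i · a ∙ j · b) ∙ z   ≈⟨ ∙-congʳ (sym eq) ⟩
        g ∙ z                 ∎
        where
        a∙z : a ∙ z ≈ z ∙ a
        a∙z = trans (∙-congʳ (sym (identityʳ a))) (trans (sym C-one) (∙-congˡ (identityʳ a)))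

-- Affine coordinates on a factorised group

module Charts (p h : ℕ) (p-odd : p ≡ 1 ℕ.+ 2 ℕ.* h) where

  open import Data.Integer as ℤ using (ℤ; +_; _+_; _*_; _^_; 0ℤ; 1ℤ; -1ℤ; _-_; -_)
  import Data.Integer.Properties as ℤ
  open import Relation.Binary.PropositionalEquality as ≡ using (cong; cong₂; subst)
  import Relation.Binary.Reasoning.Setoid
  open Congruences
  open OddPrimePower p h p-odd
  open Bicyclics

  -- (X , Y) identifies G with ℤ/pᵈ × ℤ/pᵉ, a and b acting as v ↦ (1 + α) v + (1 , 0) and v ↦ (1 + β) v + (0 , 1).
  record Chart {G : Monoid 0ℓ 0ℓ} (d e : ℕ) (B : Bicyclic G (p ℕ.^ d) (p ℕ.^ e)) : Set where
    open Monoid G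
    open Bicyclic B
    field
      α β     : ℕ
      α<      : α ℕ.< p ℕ.^ e
      β<      : β ℕ.< p ℕ.^ d
      α≡0     : + α ≡ 0ℤ [ P ]
      β≡0     : + β ≡ 0ℤ [ P ]
      α-kills : + α * P ^ d ≡ 0ℤ [ P ^ e ]
      β-kills : + β * P ^ e ≡ 0ℤ [ P ^ d ]
      X Y     : Carrier → ℤ
      X-cong  : ∀ {g h} → g ≈ h → X g ≡ X h [ P ^ d ]
      Y-cong  : ∀ {g h} → g ≈ h → Y g ≡ Y h [ P ^ e ]
      X-ε     : X ε ≡ 0ℤ [ P ^ d ]
      Y-ε     : Y ε ≡ 0ℤ [ P ^ e ]
      X-a     : ∀ g → X (a ∙ g) ≡ 1ℤ + (1ℤ + + α) * X g [ P ^ d ]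
      X-b     : ∀ g → X (b ∙ g) ≡ (1ℤ + + β) * X g [ P ^ d ]
      Y-a     : ∀ g → Y (a ∙ g) ≡ (1ℤ + + α) * Y g [ P ^ e ]
      Y-b     : ∀ g → Y (b ∙ g) ≡ 1ℤ + (1ℤ + + β) * Y g [ P ^ e ]

  affine-power : ∀ {n} L i x → 1ℤ + L * (L ^ i * x + geo L i) ≡ L ^ suc i * x + geo L (suc i) [ n ]
  affine-power L i x = ≡⇒≡[] (lem L (L ^ i) x (geo L i))
    where
    lem : ∀ L u x g → 1ℤ + L * (u * x + g) ≡ L * u * x + (1ℤ + L * g)
    lem = solve-∀

  module ChartProperties {G : Monoid 0ℓ 0ℓ} {d e : ℕ} {B : Bicyclic G (p ℕ.^ d) (p ℕ.^ e)} (C : Chart d e B) where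
    open Monoid G
    open Powers G using (_·_)
    open Bicyclic B using (a; b)
    open Chart C public

    L M : ℤ
    L = 1ℤ + + α
    M = 1ℤ + + β

    L≡1 : L ≡ 1ℤ [ P ]
    L≡1 = +-congˡ 1ℤ α≡0

    M≡1 : M ≡ 1ℤ [ P ]
    M≡1 = +-congˡ 1ℤ β≡0

    X-a^ : ∀ i g → X (i · a ∙ g) ≡ L ^ i * X g + geo L i [ P ^ d ]
    X-a^ zero    g = ≡-trans (X-cong (identityˡ g)) (≡⇒≡[] (lem (X g)))
      where
      lem : ∀ x → x ≡ 1ℤ * x + 0ℤ
      lem = solve-∀
    X-a^ (suc i) g = ≡-trans (X-cong (assoc a (i · a) g))
      (≡-trans (X-a (i · a ∙ g)) (≡-trans (+-congˡ 1ℤ (*-congˡ L (X-a^ i g))) (affine-power L i (X g))))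

    Y-b^ : ∀ i g → Y (i · b ∙ g) ≡ M ^ i * Y g + geo M i [ P ^ e ]
    Y-b^ zero    g = ≡-trans (Y-cong (identityˡ g)) (≡⇒≡[] (lem (Y g)))
      where
      lem : ∀ x → x ≡ 1ℤ * x + 0ℤ
      lem = solve-∀
    Y-b^ (suc i) g = ≡-trans (Y-cong (assoc b (i · b) g))
      (≡-trans (Y-b (i · b ∙ g)) (≡-trans (+-congˡ 1ℤ (*-congˡ M (Y-b^ i g))) (affine-power M i (Y g))))

    X-b^ : ∀ i g → X (i · b ∙ g) ≡ M ^ i * X g [ P ^ d ]
    X-b^ zero    g = ≡-trans (X-cong (identityˡ g)) (≡⇒≡[] (≡.sym (ℤ.*-identityˡ (X g))))
    X-b^ (suc i) g = ≡-trans (X-cong (assoc b (i · b) g)) (≡-trans (X-b (i · b ∙ g))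
      (≡-trans (*-congˡ M (X-b^ i g)) (≡⇒≡[] (≡.sym (ℤ.*-assoc M (M ^ i) (X g))))))

    Y-a^ : ∀ i g → Y (i · a ∙ g) ≡ L ^ i * Y g [ P ^ e ]
    Y-a^ zero    g = ≡-trans (Y-cong (identityˡ g)) (≡⇒≡[] (≡.sym (ℤ.*-identityˡ (Y g))))
    Y-a^ (suc i) g = ≡-trans (Y-cong (assoc a (i · a) g)) (≡-trans (Y-a (i · a ∙ g))
      (≡-trans (*-congˡ L (Y-a^ i g)) (≡⇒≡[] (≡.sym (ℤ.*-assoc L (L ^ i) (Y g))))))

    private
      at-ε : ∀ {u g x n} → x ≡ 0ℤ [ n ] → u * x + g ≡ g [ n ]
      at-ε {u} {g} {x} h = comb₁ u h (lem u g x)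
        where
        lem : ∀ u g x → u * x + g - g ≡ u * (x - 0ℤ)
        lem = solve-∀

      at-ε′ : ∀ {u x n} → x ≡ 0ℤ [ n ] → u * x ≡ 0ℤ [ n ]
      at-ε′ {u} h = ≡-trans (*-congˡ u h) (≡⇒≡[] (ℤ.*-zeroʳ u))

    X-factor : ∀ i j → X (i · a ∙ j · b) ≡ geo L i [ P ^ d ]
    X-factor i j = ≡-trans (X-a^ i (j · b)) (at-ε {L ^ i} (≡-trans (X-cong (sym (identityʳ (j · b))))
      (≡-trans (X-b^ j ε) (at-ε′ {M ^ j} X-ε))))

    Y-factor : ∀ i j → Y (i · a ∙ j · b) ≡ L ^ i * geo M j [ P ^ e ]
    Y-factor i j = ≡-trans (Y-a^ i (j · b)) (*-congˡ (L ^ i) (≡-trans (Y-cong (sym (identityʳ (j · b))))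
      (≡-trans (Y-b^ j ε) (at-ε {M ^ j} Y-ε))))

    -- Both coordinates of one element are evaluated on each side. Besides the multipliers and their
    -- divisibility, this is all that the induction keeps of a chart of the quotient.
    relation : ∀ {i φ π} → b ∙ i · a ≈ φ · a ∙ π · b →
               geo L φ ≡ M * geo L i [ P ^ d ] × L ^ φ * geo M π ≡ 1ℤ [ P ^ e ]
    relation {i} {φ} {π} eq =
      ≡-trans (≡-sym (X-factor φ π)) (≡-trans (X-cong (sym eq)) (≡-trans (X-b (i · a)) (*-congˡ M
        (≡-trans (X-cong (sym (identityʳ (i · a)))) (X-factor i 0))))) ,
      ≡-trans (≡-sym (Y-factor φ π)) (≡-trans (Y-cong (sym eq)) (≡-trans (Y-b (i · a))
        (≡-trans (+-congˡ 1ℤ (at-ε′ {M} (≡-trans (Y-cong (sym (identityʳ (i · a))))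
          (≡-trans (Y-factor i 0) (≡⇒≡[] (ℤ.*-zeroʳ (L ^ i)))))))
          (≡⇒≡[] ≡.refl))))

  p^-nonZero : ∀ k → ℕ.NonZero (p ℕ.^ k)
  p^-nonZero k = ℕ.m^n≢0 p k

  swapped : ∀ {G d e} → Bicyclic G (p ℕ.^ d) (p ℕ.^ e) → Bicyclic G (p ℕ.^ e) (p ℕ.^ d)
  swapped {d = d} {e} B = BicyclicProperties.swap ⦃ p^-nonZero d ⦄ ⦃ p^-nonZero e ⦄ B

  unswap-chart : ∀ {G d e} (B : Bicyclic G (p ℕ.^ d) (p ℕ.^ e)) →
                 Chart e d (swapped {d = d} {e} B) → Chart d e B
  unswap-chart {d = d} {e} B C = record
    { α = β ; β = α ; α< = β< ; β< = α< ; α≡0 = β≡0 ; β≡0 = α≡0 ; α-kills = β-kills ; β-kills = α-kills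
    ; X = Y ; Y = X ; X-cong = Y-cong ; Y-cong = X-cong ; X-ε = Y-ε ; Y-ε = X-ε
    ; X-a = Y-b ; X-b = Y-a ; Y-a = X-b ; Y-b = X-a }
    where open Chart {B = swapped {d = d} {e} B} C

  module _ {G : Monoid 0ℓ 0ℓ} {d e : ℕ} (B : Bicyclic G (p ℕ.^ d) (p ℕ.^ e)) where
    private instance
      m-nonZero : ℕ.NonZero (p ℕ.^ d)
      m-nonZero = p^-nonZero d
      n-nonZero : ℕ.NonZero (p ℕ.^ e)
      n-nonZero = p^-nonZero e

    open Monoid G
    open BicyclicProperties B

    exponents : ∀ i j i′ j′ → i · a ∙ j · b ≈ i′ · a ∙ j′ · b →
                + i ≡ + i′ [ P ^ d ] × + j ≡ + j′ [ P ^ e ]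
    exponents i j i′ j′ eq = let i≡ , j≡ = factor-unique {i} {j} {i′} {j′} eq in [p^]⇐ d i≡ , [p^]⇐ e j≡

    a-mod : ∀ i j → + i ≡ + j [ P ^ d ] → i · a ≈ j · a
    a-mod i j i≡j = ·-mod (p ℕ.^ d) a-order {i} {j} ([p^]⇒ d i≡j)

    b-mod : ∀ i j → + i ≡ + j [ P ^ e ] → i · b ≈ j · b
    b-mod i j i≡j = ·-mod (p ℕ.^ e) b-order {i} {j} ([p^]⇒ e i≡j)

    a∙factor : ∀ g i j → g ≈ i · a ∙ j · b → a ∙ g ≈ suc i · a ∙ j · b
    a∙factor g i j eq = trans (∙-congˡ eq) (sym (assoc a (i · a) (j · b)))

    b∙factor : ∀ g i j φ π → b ∙ i · a ≈ φ · a ∙ π · b → g ≈ i · a ∙ j · b → b ∙ g ≈ φ · a ∙ (π ℕ.+ j) · b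
    b∙factor g i j φ π rel eq = begin
      b ∙ g                      ≈⟨ ∙-congˡ eq ⟩
      b ∙ (i · a ∙ j · b)        ≈⟨ sym (assoc b (i · a) (j · b)) ⟩
      (b ∙ i · a) ∙ j · b        ≈⟨ ∙-congʳ rel ⟩
      (φ · a ∙ π · b) ∙ j · b    ≈⟨ assoc (φ · a) (π · b) (j · b) ⟩
      φ · a ∙ (π · b ∙ j · b)    ≈⟨ ∙-congˡ (sym (·-+ b π j)) ⟩
      φ · a ∙ (π ℕ.+ j) · b      ∎
      where open Relation.Binary.Reasoning.Setoid setoid

    ε-factor : ε ≈ 0 · a ∙ 0 · b
    ε-factor = sym (identityˡ ε)

    module Build (d≤e : d ℕ.≤ e) (α β : ℕ) (α< : α ℕ.< p ℕ.^ e) (β< : β ℕ.< p ℕ.^ d)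
      (α≡0 : + α ≡ 0ℤ [ P ]) (β≡0 : + β ≡ 0ℤ [ P ]) (β-kills : + β * P ^ e ≡ 0ℤ [ P ^ d ])
      (φ π : ℕ → ℕ) (rel : ∀ i → b ∙ i · a ≈ φ i · a ∙ π i · b)
      (φ-geo : ∀ i → geo (1ℤ + + α) (φ i) ≡ (1ℤ + + β) * geo (1ℤ + + α) i [ P ^ e ])
      (trivial : ∀ i → (1ℤ + + α) ^ φ i * geo (1ℤ + + β) (π i) ≡ 1ℤ [ P ^ e ])
      where

      private
        L = 1ℤ + + α
        M = 1ℤ + + β

        L≡1 : L ≡ 1ℤ [ P ]
        L≡1 = +-congˡ 1ℤ α≡0

        M≡1 : M ≡ 1ℤ [ P ]
        M≡1 = +-congˡ 1ℤ β≡0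

        L^-φ : ∀ x → L ^ φ x ≡ 1ℤ + + α * (M * geo L x) [ P ^ e ]
        L^-φ x = ≡-trans (≡⇒≡[] (^-geo (+ α) (φ x))) (+-congˡ 1ℤ (*-congˡ (+ α) (φ-geo x)))

        π-period : + π (p ℕ.^ d) ≡ + 1 [ P ^ e ]
        π-period = proj₂ (exponents (φ (p ℕ.^ d)) (π (p ℕ.^ d)) 0 1 (trans (sym (rel (p ℕ.^ d))) (trans (∙-congˡ a-order)
          (trans (identityʳ b) (sym (trans (identityˡ (1 · b)) (identityʳ b)))))))

        -- Forced by the order of a: at i = pᵈ one has π(i) ≡ 1, so L^φ(i) ≡ 1 and α M geo L (pᵈ) ≡
        -- 0, where geo L (pᵈ) is pᵈ times a unit.
        α-kills : + α * P ^ d ≡ 0ℤ [ P ^ e ]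
        α-kills = from (geo-isometry d {p ℕ.^ d} {0} L≡1 (⇒0[] 1ℤ (≡.trans (pos-^ d) (≡.sym (ℤ.*-identityʳ (P ^ d))))))
          where
          α-geo : + α * (M * geo L (p ℕ.^ d)) ≡ 0ℤ [ P ^ e ]
          α-geo = comb₃ -1ℤ 1ℤ (- L ^ φ (p ℕ.^ d)) (L^-φ (p ℕ.^ d)) (trivial (p ℕ.^ d)) (geo-exp-cong e M≡1 π-period)
            (lem (+ α * (M * geo L (p ℕ.^ d))) (L ^ φ (p ℕ.^ d)) (geo M (π (p ℕ.^ d))) M)
            where
            lem : ∀ x u G M → x - 0ℤ ≡ -1ℤ * (u - (1ℤ + x)) + 1ℤ * (u * G - 1ℤ) + - u * (G - (1ℤ + M * 0ℤ))
            lem = solve-∀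
          from : geo L (p ℕ.^ d) - geo L 0 ≡ + (p ℕ.^ d) - + 0 [ P ^ suc d ] → + α * P ^ d ≡ 0ℤ [ P ^ e ]
          from (by q eq) = cancel {M * (1ℤ + P * q)} e unit (≡-trans (≡⇒≡[] eq′) (≡-trans α-geo (≡⇒≡[] (≡.sym (ℤ.*-zeroʳ (M * (1ℤ + P * q)))))))
            where
            unit : M * (1ℤ + P * q) ≡ 1ℤ [ P ]
            unit = comb₂ (1ℤ + P * q) q M≡1 P≡0 (lem M P q)
              where
              lem : ∀ M P q → M * (1ℤ + P * q) - 1ℤ ≡ (1ℤ + P * q) * (M - 1ℤ) + q * (P - 0ℤ)
              lem = solve-∀
            geo≡ᵈ : geo L (p ℕ.^ d) ≡ P ^ d * (1ℤ + P * q)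
            geo≡ᵈ = ≡.trans (lem₁ (geo L (p ℕ.^ d)) (+ (p ℕ.^ d)))
              (≡.trans (cong₂ _+_ eq (pos-^ d)) (lem₂ P (P ^ d) q))
              where
              lem₁ : ∀ x y → x ≡ ((x - 0ℤ) - (y - 0ℤ)) + y
              lem₁ = solve-∀
              lem₂ : ∀ P m q → P * m * q + m ≡ m * (1ℤ + P * q)
              lem₂ = solve-∀
            eq′ : M * (1ℤ + P * q) * (+ α * P ^ d) ≡ + α * (M * geo L (p ℕ.^ d))
            eq′ = ≡.trans (lem M (1ℤ + P * q) (+ α) (P ^ d)) (cong (λ t → + α * (M * t)) (≡.sym geo≡ᵈ))
              where
              lem : ∀ M u α m → M * u * (α * m) ≡ α * (M * (m * u))
              lem = solve-∀

        L^-cong : ∀ {i j} → + i ≡ + j [ P ^ d ] → L ^ i ≡ L ^ j [ P ^ e ]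
        L^-cong {i} {j} i≡j = ≡-trans (≡⇒≡[] (^-geo (+ α) i))
          (≡-trans (+-congˡ 1ℤ (scale-kills (+ α) α-kills (geo-exp-cong d {i} {j} L≡1 i≡j))) (≡⇒≡[] (≡.sym (^-geo (+ α) j))))

        I J : Carrier → ℕ
        I g = proj₁ (factor g)
        J g = proj₁ (proj₂ (factor g))

        factor-eq : ∀ g → g ≈ I g · a ∙ J g · b
        factor-eq g = proj₂ (proj₂ (factor g))

        -- The image of the origin under aⁱ bʲ in the affine model. The exponent of a is known only
        -- modulo pᵈ; `α-kills` makes Lⁱ well defined modulo pᵉ all the same.
        X Y : Carrier → ℤ
        X g = geo L (I g)
        Y g = L ^ I g * geo M (J g)

        X-at : ∀ g i j → g ≈ i · a ∙ j · b → X g ≡ geo L i [ P ^ d ]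
        X-at g i j eq = geo-exp-cong d {I g} {i} L≡1 (proj₁ (exponents (I g) (J g) i j (trans (sym (factor-eq g)) eq)))

        Y-at : ∀ g i j → g ≈ i · a ∙ j · b → Y g ≡ L ^ i * geo M j [ P ^ e ]
        Y-at g i j eq = let i≡ , j≡ = exponents (I g) (J g) i j (trans (sym (factor-eq g)) eq) in
          *-cong (L^-cong {I g} {i} i≡) (geo-exp-cong e {J g} {j} M≡1 j≡)

        Y-b : ∀ i j → L ^ φ i * geo M (π i ℕ.+ j) ≡ 1ℤ + M * (L ^ i * geo M j) [ P ^ e ]
        Y-b i j = ≡-trans (≡⇒≡[] (cong (L ^ φ i *_) (≡.trans (geo-+ M (π i) j)
            (cong (λ t → geo M (π i) + t * geo M j) (^-geo (+ β) (π i))))))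
          (comb₂ (1ℤ + + β * geo M j) (geo M j) (trivial i) (L^-φ i)
            (≡.trans (cong (λ t → L ^ φ i * (geo M (π i) + (1ℤ + + β * geo M (π i)) * geo M j) - (1ℤ + M * (t * geo M j)))
                (^-geo (+ α) i))
              (lem (L ^ φ i) (geo M (π i)) (+ β) (geo M j) (+ α) (geo L i))))
          where
          lem : ∀ u G β H α g → u * (G + (1ℤ + β * G) * H) - (1ℤ + (1ℤ + β) * ((1ℤ + α * g) * H)) ≡
                (1ℤ + β * H) * (u * G - 1ℤ) + H * (u - (1ℤ + α * ((1ℤ + β) * g)))
          lem = solve-∀

      chart : Chart d e B
      chart = record
        { α = α ; β = β ; α< = α< ; β< = β< ; α≡0 = α≡0 ; β≡0 = β≡0 ; α-kills = α-kills ; β-kills = β-kills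
        ; X = X ; Y = Y
        ; X-cong = λ {g} {h} eq → X-at g (I h) (J h) (trans eq (factor-eq h))
        ; Y-cong = λ {g} {h} eq → Y-at g (I h) (J h) (trans eq (factor-eq h))
        ; X-ε = X-at ε 0 0 ε-factor
        ; Y-ε = Y-at ε 0 0 ε-factor
        ; X-a = λ g → X-at (a ∙ g) (suc (I g)) (J g) (a∙factor g (I g) (J g) (factor-eq g))
        ; X-b = λ g → ≡-trans (X-at (b ∙ g) (φ (I g)) (π (I g) ℕ.+ J g) (b∙g g))
                        (^-weaken d≤e (φ-geo (I g)))
        ; Y-a = λ g → ≡-trans (Y-at (a ∙ g) (suc (I g)) (J g) (a∙factor g (I g) (J g) (factor-eq g)))
                        (≡⇒≡[] (ℤ.*-assoc L (L ^ I g) (geo M (J g))))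
        ; Y-b = λ g → ≡-trans (Y-at (b ∙ g) (φ (I g)) (π (I g) ℕ.+ J g) (b∙g g)) (Y-b (I g) (J g))
        }
        where
        b∙g : ∀ g → b ∙ g ≈ φ (I g) · a ∙ (π (I g) ℕ.+ J g) · b
        b∙g g = b∙factor g (I g) (J g) (φ (I g)) (π (I g)) (rel (I g)) (factor-eq g)

    commuting-chart : d ℕ.≤ e → a ∙ b ≈ b ∙ a → Chart d e B
    commuting-chart d≤e ab≈ba = Build.chart d≤e 0 0 (ℕ.>-nonZero⁻¹ (p ℕ.^ e)) (ℕ.>-nonZero⁻¹ (p ℕ.^ d))
      ≡-refl ≡-refl (≡⇒≡[] ≡.refl) (λ i → i) (λ _ → 1)
      (λ i → trans (sym (commute-· ab≈ba i)) (∙-congˡ (sym (identityʳ b))))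
      (λ i → ≡⇒≡[] (≡.sym (ℤ.*-identityˡ (geo 1ℤ i))))
      (λ i → ≡⇒≡[] (cong (_* 1ℤ) (ℤ.^-zeroˡ i)))

  lift-< : ∀ {x w q} m → x ℕ.< m → w ℕ.< q → x ℕ.+ m ℕ.* w ℕ.< q ℕ.* m
  lift-< {x} {w} {q} m x<m w<q = ℕ.<-≤-trans (ℕ.+-monoˡ-< (m ℕ.* w) x<m)
    (ℕ.≤-trans (ℕ.≤-reflexive (≡.trans (≡.sym (ℕ.*-suc m w)) (ℕ.*-comm m (suc w)))) (ℕ.*-monoˡ-≤ m w<q))

  -- Lifting a chart from the quotient

  module _ {G : Monoid 0ℓ 0ℓ} {d n : ℕ} (d≤e : d ℕ.≤ suc n) (1≤n : 1 ℕ.≤ n)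
    (B : Bicyclic G (p ℕ.^ d) (p ℕ.^ suc n)) where

    private
      e = suc n
      instance
        m-nonZero : ℕ.NonZero (p ℕ.^ d)
        m-nonZero = p^-nonZero d
        n-nonZero : ℕ.NonZero (p ℕ.^ suc n)
        n-nonZero = p^-nonZero (suc n)

    open Monoid G
    open BicyclicProperties B
    open Relation.Binary.Reasoning.Setoid setoid

    module _ (α₀ β : ℕ) (α₀< : α₀ ℕ.< p ℕ.^ n) (β< : β ℕ.< p ℕ.^ d)
      (α₀≡0 : + α₀ ≡ 0ℤ [ P ]) (β≡0 : + β ≡ 0ℤ [ P ])
      (α₀-kills : + α₀ * P ^ d ≡ 0ℤ [ P ^ n ]) (β-kills : + β * P ^ n ≡ 0ℤ [ P ^ d ])
      (φ₀ π : ℕ → ℕ) (rel₀ : ∀ i → b ∙ i · a ≈ φ₀ i · a ∙ π i · b)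
      (φ₀-geo : ∀ i → geo (1ℤ + + α₀) (φ₀ i) ≡ (1ℤ + + β) * geo (1ℤ + + α₀) i [ P ^ d ])
      (π-lift₀ : ∀ i → (1ℤ + + α₀) ^ φ₀ i * geo (1ℤ + + β) (π i) ≡ 1ℤ [ P ^ n ])
      where

      private
        L₀ = 1ℤ + + α₀
        M = 1ℤ + + β

        L₀≡1 : L₀ ≡ 1ℤ [ P ]
        L₀≡1 = +-congˡ 1ℤ α₀≡0

        M≡1 : M ≡ 1ℤ [ P ]
        M≡1 = +-congˡ 1ℤ β≡0

        P^n⇒P : ∀ {x y} → x ≡ y [ P ^ n ] → x ≡ y [ P ]
        P^n⇒P x≡y = modP⁻ 0 (^-weaken 1≤n x≡y)

        G₁ = geo M (π 1)

        -- L₀^φ₀(i) is rewritten without φ₀, so that the congruence can be carried over to the new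
        -- multiplier and the new exponents φ.
        π-lift : ∀ i → (1ℤ + + α₀ * (M * geo L₀ i)) * geo M (π i) ≡ 1ℤ [ P ^ n ]
        π-lift i = ≡-trans (*-cong (≡-trans (+-congˡ 1ℤ (≡-sym (scale-kills (+ α₀) α₀-kills (φ₀-geo i))))
          (≡⇒≡[] (≡.sym (^-geo (+ α₀) (φ₀ i))))) (≡-refl {geo M (π i)})) (π-lift₀ i)

        G₁≡1 : G₁ ≡ 1ℤ [ P ]
        G₁≡1 = comb₂ 1ℤ (- (M * geo L₀ 1 * G₁)) (P^n⇒P (π-lift 1)) α₀≡0 (lem (+ α₀) (M * geo L₀ 1) G₁)
          where
          lem : ∀ α m G → G - 1ℤ ≡ 1ℤ * ((1ℤ + α * m) * G - 1ℤ) + - (m * G) * (α - 0ℤ)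
          lem = solve-∀

        module Lift (w : ℕ) (w<p : w ℕ.< p)
          (base : (1ℤ + (+ α₀ + P ^ n * + w) * (M * (1ℤ + 0ℤ))) * G₁ ≡ 1ℤ [ P ^ e ]) where

          α = α₀ ℕ.+ p ℕ.^ n ℕ.* w

          +α : + α ≡ + α₀ + P ^ n * + w
          +α = cong (λ t → + α₀ + t) (≡.trans (ℤ.pos-* (p ℕ.^ n) w) (cong (_* + w) (pos-^ n)))

          α≡α₀ : + α ≡ + α₀ [ P ^ n ]
          α≡α₀ = by (+ w) (≡.trans (cong (_- + α₀) +α) (lem (+ α₀) (P ^ n * + w)))
            where
            lem : ∀ x y → x + y - x ≡ y
            lem = solve-∀

          α≡0 : + α ≡ 0ℤ [ P ]
          α≡0 = ≡-trans (P^n⇒P α≡α₀) α₀≡0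

          L = 1ℤ + + α

          L≡1 : L ≡ 1ℤ [ P ]
          L≡1 = +-congˡ 1ℤ α≡0

          L≡L₀ : L ≡ L₀ [ P ^ n ]
          L≡L₀ = +-congˡ 1ℤ α≡α₀

          -- The group fixes these exponents only modulo pᵈ, whereas the cocycle argument needs the
          -- first equation modulo pᵉ. So φ is defined by that equation, and `rel` checks that it
          -- agrees with φ₀ modulo pᵈ.
          φ : ℕ → ℕ
          φ i = proj₁ (log e (M * geo L i) L≡1)

          φ-geo : ∀ i → geo L (φ i) ≡ M * geo L i [ P ^ e ]
          φ-geo i = proj₂ (log e (M * geo L i) L≡1)

          -- Replacing L₀ by L moves the sums of lengths φ₀(i) and i by equal amounts modulo pⁿ⁺¹,
          -- as φ₀(i) ≡ i modulo p. Multiplication by M does not change that amount, since pⁿ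
          -- divides it and M ≡ 1 modulo p.
          φ₀≡ : ∀ d i → d ℕ.≤ e → geo L₀ (φ₀ i) ≡ M * geo L₀ i [ P ^ d ] →
                geo L (φ₀ i) ≡ M * geo L i [ P ^ d ]
          φ₀≡ zero    i _   _  = ≡[p^0]
          φ₀≡ (suc d) i d≤e eq = comb₃ 1ℤ 1ℤ -1ℤ
            (^-weaken d≤e (subst (λ m → geo L (φ₀ i) - geo L₀ (φ₀ i) ≡ geo L i - geo L₀ i [ m ]) (ℤ.*-comm (P ^ n) P)
              (geo-difference-cong (P ^ n) (φ₀ i) i L≡1 L₀≡1 L≡L₀ φ₀i≡i))) eq
            (^-weaken d≤e (difference-M (geo-cong i L≡L₀)))
            (lem (geo L (φ₀ i)) (geo L₀ (φ₀ i)) (geo L i) (geo L₀ i) M)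
            where
            φ₀i≡i : + φ₀ i ≡ + i [ P ]
            φ₀i≡i = modP⁻ 0 (geo-injective 1 L₀≡1 (modP (≡-trans (modP⁻ d eq)
              (comb₁ (geo L₀ i) M≡1 (lem₀ M (geo L₀ i))))))
              where
              lem₀ : ∀ M g → M * g - g ≡ g * (M - 1ℤ)
              lem₀ = solve-∀
            difference-M : geo L i ≡ geo L₀ i [ P ^ n ] → M * (geo L i - geo L₀ i) ≡ geo L i - geo L₀ i [ P ^ suc n ]
            difference-M (by q eq′) = comb₁ q (scale-P^ n M≡1)
              (≡.trans (cong (λ t → M * t - t) eq′) (lem₀ M (P ^ n) q))
              where
              lem₀ : ∀ M m q → M * (m * q) - m * q ≡ q * (m * M - m * 1ℤ)
              lem₀ = solve-∀
            lem : ∀ a b c d M → a - M * c ≡ 1ℤ * ((a - b) - (c - d)) + 1ℤ * (b - M * d) + -1ℤ * (M * (c - d) - (c - d))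
            lem = solve-∀

          rel : ∀ i → b ∙ i · a ≈ φ i · a ∙ π i · b
          rel i = trans (rel₀ i) (∙-congʳ (a-mod {d = d} {e} B (φ₀ i) (φ i) (geo-injective d {φ₀ i} {φ i} L≡1
            (≡-trans (φ₀≡ d i d≤e (φ₀-geo i)) (≡-sym (^-weaken d≤e (φ-geo i)))))))

          L^-φ : ∀ x → L ^ φ x ≡ 1ℤ + + α * (M * geo L x) [ P ^ e ]
          L^-φ x = ≡-trans (≡⇒≡[] (^-geo (+ α) (φ x))) (+-congˡ 1ℤ (*-congˡ (+ α) (φ-geo x)))

          π-lifted : ∀ i → L ^ φ i * geo M (π i) ≡ 1ℤ [ P ^ n ]
          π-lifted i = ≡-trans (*-cong (≡-trans (^-weaken (ℕ.n≤1+n n) (L^-φ i))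
            (+-congˡ 1ℤ (*-cong α≡α₀ (*-congˡ M (geo-cong i L≡L₀))))) (≡-refl {geo M (π i)})) (π-lift i)

          π-one : L ^ φ 1 * geo M (π 1) ≡ 1ℤ [ P ^ e ]
          π-one = ≡-trans (*-cong (≡-trans (L^-φ 1) (≡⇒≡[] (cong₂ (λ s t → 1ℤ + s * (M * (1ℤ + t))) +α (ℤ.*-zeroʳ L))))
            (≡-refl {G₁})) base

          S = skew-sum φ π

          b^-a^ : ∀ m k → m · b ∙ k · a ≈ fold k φ m · a ∙ S m k · b
          b^-a^ zero    k = trans (identityˡ (k · a)) (sym (identityʳ (k · a)))
          b^-a^ (suc m) k = begin
            (b ∙ m · b) ∙ k · a                  ≈⟨ assoc b (m · b) (k · a) ⟩
            b ∙ (m · b ∙ k · a)                  ≈⟨ b∙factor {d = d} {e} B (m · b ∙ k · a) x (S m k) (φ x) (π x) (rel x) (b^-a^ m k) ⟩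
            φ x · a ∙ (π x ℕ.+ S m k) · b        ∎
            where x = fold k φ m

          π-skew : ∀ i k → + π (i ℕ.+ k) ≡ + S (π i) k [ P ^ e ]
          π-skew i k = proj₂ (exponents {d = d} {e} B (φ (i ℕ.+ k)) (π (i ℕ.+ k)) (φ i ℕ.+ x) (S (π i) k) (begin
            φ (i ℕ.+ k) · a ∙ π (i ℕ.+ k) · b        ≈⟨ sym (rel (i ℕ.+ k)) ⟩
            b ∙ (i ℕ.+ k) · a                        ≈⟨ ∙-congˡ (·-+ a i k) ⟩
            b ∙ (i · a ∙ k · a)                      ≈⟨ sym (assoc b (i · a) (k · a)) ⟩
            (b ∙ i · a) ∙ k · a                      ≈⟨ ∙-congʳ (rel i) ⟩
            (φ i · a ∙ π i · b) ∙ k · a              ≈⟨ assoc (φ i · a) (π i · b) (k · a) ⟩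
            φ i · a ∙ (π i · b ∙ k · a)              ≈⟨ ∙-congˡ (b^-a^ (π i) k) ⟩
            φ i · a ∙ (x · a ∙ S (π i) k · b)        ≈⟨ sym (assoc (φ i · a) (x · a) (S (π i) k · b)) ⟩
            (φ i · a ∙ x · a) ∙ S (π i) k · b        ≈⟨ ∙-congʳ (sym (·-+ a (φ i) x)) ⟩
            (φ i ℕ.+ x) · a ∙ S (π i) k · b          ∎))
            where x = fold k φ (π i)

          π-periodic : ∀ x y → + x ≡ + y [ P ^ e ] → + π x ≡ + π y [ P ^ e ]
          π-periodic x y x≡y = proj₂ (exponents {d = d} {e} B (φ x) (π x) (φ y) (π y)
            (trans (sym (rel x)) (trans (∙-congˡ (a-mod {d = d} {e} B x y (^-weaken d≤e x≡y))) (rel y))))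

          chart : Chart d e B
          chart = Build.chart B d≤e α β (lift-< (p ℕ.^ n) α₀< w<p) β< α≡0 β≡0
            (comb₁ P β-kills (lem (+ β) P (P ^ n))) φ π rel φ-geo
            (cocycle-trivial n 1≤n (+ α) (+ β) α≡0 β≡0 φ π φ-geo π-lifted π-skew π-periodic π-one)
            where
            lem : ∀ β P m → β * (P * m) - 0ℤ ≡ P * (β * m - 0ℤ)
            lem = solve-∀

      -- The digit w is fixed by the single condition F(1) ≡ 1 modulo pᵉ: with α₀ the error is pⁿ q,
      -- and adding pⁿ w to α₀ adds pⁿ w M G₁ ≡ pⁿ w. Hence w ≡ - q.
      lift-chart : Chart d e B
      lift-chart = from (π-lift 1)
        where
        choose : ∀ q → (1ℤ + + α₀ * (M * geo L₀ 1)) * G₁ - 1ℤ ≡ P ^ n * q →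
                 (∃ λ w → w ℕ.< p × + w ≡ - q [ P ]) → Chart d e B
        choose q eq (w , w<p , w≡) = Lift.chart w w<p (comb₂ 1ℤ 1ℤ (scale-P^ n unit) (scale-P^ n w≡)
          (≡.trans (lem₁ (+ α₀) M G₁ (P ^ n) (+ w))
            (≡.trans (cong₂ (λ s t → s + P ^ n * (M * G₁ * + w) + t * 0ℤ) (≡.trans (cong (λ t → (1ℤ + + α₀ * (M * t)) * G₁ - 1ℤ)
                (≡.sym (cong (λ t → 1ℤ + t) (ℤ.*-zeroʳ L₀)))) eq) (≡.refl {x = 0ℤ}))
              (lem₂ (P ^ n) q (M * G₁) (+ w)))))
          where
          unit : M * G₁ * + w ≡ + w [ P ]
          unit = comb₂ (G₁ * + w) (+ w) M≡1 G₁≡1 (lem M G₁ (+ w))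
            where
            lem : ∀ M G w → M * G * w - w ≡ G * w * (M - 1ℤ) + w * (G - 1ℤ)
            lem = solve-∀
          lem₁ : ∀ α M G m w → (1ℤ + (α + m * w) * (M * (1ℤ + 0ℤ))) * G - 1ℤ ≡
                 ((1ℤ + α * (M * (1ℤ + 0ℤ))) * G - 1ℤ) + m * (M * G * w) + 0ℤ * 0ℤ
          lem₁ = solve-∀
          lem₂ : ∀ m q u w → m * q + m * (u * w) + 0ℤ * 0ℤ ≡ 1ℤ * (m * (u * w) - m * w) + 1ℤ * (m * w - m * - q)
          lem₂ = solve-∀
        from : (1ℤ + + α₀ * (M * geo L₀ 1)) * G₁ ≡ 1ℤ [ P ^ n ] → Chart d e B
        from (by q eq) = choose q eq (residue (- q) p)

    step : (central : IsCentral G ((p ℕ.^ n) · b)) → Chart d n (Quotient.B/z p B central) → Chart d e B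
    step central C = lift-chart α β α< β< α≡0 β≡0 α-kills β-kills φ₀ π rel₀
      (λ i → proj₁ (rel-coordinates i)) (λ i → proj₂ (rel-coordinates i))
      where
      open ChartProperties {d = d} {n} C
      open Quotient p B central using (≈⇒∼; ·≡; G/z)
      open Powers G/z using () renaming (_·_ to _·′_)
      φ₀ π : ℕ → ℕ
      φ₀ i = proj₁ (factor (b ∙ i · a))
      π i = proj₁ (proj₂ (factor (b ∙ i · a)))
      rel₀ : ∀ i → b ∙ i · a ≈ φ₀ i · a ∙ π i · b
      rel₀ i = proj₂ (proj₂ (factor (b ∙ i · a)))
      rel-coordinates : ∀ i → geo L (φ₀ i) ≡ M * geo L i [ P ^ d ] × L ^ φ₀ i * geo M (π i) ≡ 1ℤ [ P ^ n ]
      rel-coordinates i = relation {i} {φ₀ i} {π i} (≈⇒∼ (trans (∙-congˡ (reflexive (·≡ i a)))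
        (trans (rel₀ i) (sym (∙-cong (reflexive (·≡ (φ₀ i) a)) (reflexive (·≡ (π i) b)))))))

-- Existence of charts by induction on the order

module Classify (p h : ℕ) (p-odd : p ≡ 1 ℕ.+ 2 ℕ.* h) (p-prime : Prime p) where

  open import Relation.Binary.PropositionalEquality using (subst)
  open OddPrimePower p h p-odd
  open Bicyclics
  open Central
  open Charts p h p-odd

  private
    -- For e = 1 the central element z is b itself; for e = 0 both a and b are trivial.
    commuting : ∀ {G} d e → d ℕ.≤ e → e ℕ.≤ 1 → (B : Bicyclic G (p ℕ.^ d) (p ℕ.^ e)) →
                Monoid._≈_ G (Monoid._∙_ G (Bicyclic.a B) (Bicyclic.b B)) (Monoid._∙_ G (Bicyclic.b B) (Bicyclic.a B))
    commuting {G} zero zero _ _ B = trans (∙-congʳ a≈ε) (trans (identityˡ b) (sym (trans (∙-congˡ a≈ε) (identityʳ b))))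
      where
      open Monoid G
      open Bicyclic B
      a≈ε : a ≈ ε
      a≈ε = trans (sym (identityʳ a)) a-order
    commuting {G} d (suc zero) d≤e _ B = trans (∙-congˡ (sym (identityʳ b))) (trans (sym (socle-central p-prime {d = d} {0} d≤e B a))
      (∙-congʳ (identityʳ b)))
      where
      open Monoid G
      open Bicyclic B
    commuting d (suc (suc e)) _ (ℕ.s≤s ()) B

  mutual
    -- The bound on d + e is symmetric, so a and b may be exchanged whenever passing to a quotient
    -- has reversed the inequality d ≤ e.
    classify : ∀ s {G} d e → d ℕ.+ e ℕ.≤ s → (B : Bicyclic G (p ℕ.^ d) (p ℕ.^ e)) → Chart d e B
    classify s d e d+e≤s B with ℕ.≤-total d e
    ... | inj₁ d≤e = classify-≤ s d e d≤e d+e≤s B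
    ... | inj₂ e≤d = unswap-chart {d = d} {e} B
          (classify-≤ s e d e≤d (subst (ℕ._≤ s) (ℕ.+-comm d e) d+e≤s) (swapped {d = d} {e} B))

    private
      classify-≤ : ∀ s {G} d e → d ℕ.≤ e → d ℕ.+ e ℕ.≤ s → (B : Bicyclic G (p ℕ.^ d) (p ℕ.^ e)) → Chart d e B
      classify-≤ s d zero d≤e _ B = commuting-chart {d = d} {0} B d≤e (commuting d 0 d≤e ℕ.z≤n B)
      classify-≤ s d (suc zero) d≤e _ B = commuting-chart {d = d} {1} B d≤e (commuting d 1 d≤e ℕ.≤-refl B)
      classify-≤ zero d (suc (suc n)) d≤e d+e≤s B with () ← ℕ.n≤0⇒n≡0 (ℕ.≤-trans (ℕ.m≤n+m (suc (suc n)) d) d+e≤s)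
      classify-≤ (suc s) d (suc (suc n)) d≤e d+e≤s B =
        step {d = d} {suc n} d≤e (ℕ.s≤s ℕ.z≤n) B central
          (classify s d (suc n) (ℕ.s≤s⁻¹ (subst (ℕ._≤ suc s) (ℕ.+-suc d (suc n)) d+e≤s))
            (Quotient.B/z p ⦃ p^-nonZero d ⦄ ⦃ p-nonZero ⦄ ⦃ p^-nonZero (suc (suc n)) ⦄ B central))
        where central = socle-central p-prime {d = d} {suc n} d≤e B

  chart : ∀ {G} d e → (B : Bicyclic G (p ℕ.^ d) (p ℕ.^ e)) → Chart d e B
  chart d e = classify (d ℕ.+ e) d e ℕ.≤-refl

-- Dessins with affine coordinates on their edges

module DessinCoordinates (p h : ℕ) (p-odd : p ≡ 1 ℕ.+ 2 ℕ.* h) where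

  open import Data.Integer hiding (suc)
  open import Data.Integer.Properties
  open import Relation.Binary.PropositionalEquality hiding ([_])
  open import Defs
  import Data.Nat.Tactic.RingSolver as ℕSolver
  open Congruences
  open OddPrimePower p h p-odd

  -- A chart read on the edges, with `x₀` at the origin. Freed from the group, it can be pulled back
  -- along isomorphisms and moved to another base edge.
  record Coordinates (d e α β : ℕ) (D : Dessin) (x₀ : Fin (N D)) : Set where
    field
      α≡0       : + α ≡ 0ℤ [ P ]
      β≡0       : + β ≡ 0ℤ [ P ]
      α-kills   : + α * P ^ d ≡ 0ℤ [ P ^ e ]
      β-kills   : + β * P ^ e ≡ 0ℤ [ P ^ d ]
      X Y       : Fin (N D) → ℤ
      X-base    : X x₀ ≡ 0ℤ [ P ^ d ]
      Y-base    : Y x₀ ≡ 0ℤ [ P ^ e ]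
      X-a       : ∀ x → X (a D ⟨$⟩ʳ x) ≡ 1ℤ + (1ℤ + + α) * X x [ P ^ d ]
      X-b       : ∀ x → X (b D ⟨$⟩ʳ x) ≡ (1ℤ + + β) * X x [ P ^ d ]
      Y-a       : ∀ x → Y (a D ⟨$⟩ʳ x) ≡ (1ℤ + + α) * Y x [ P ^ e ]
      Y-b       : ∀ x → Y (b D ⟨$⟩ʳ x) ≡ 1ℤ + (1ℤ + + β) * Y x [ P ^ e ]
      injective : ∀ {x y} → X x ≡ X y [ P ^ d ] → Y x ≡ Y y [ P ^ e ] → x ≡ y

  -- For u ≡ 1 modulo p, the inverse of u modulo pᵏ provided by `inverse`.
  inv : ℕ → ℤ → ℤ
  inv k u = geo (1ℤ - u) k

  module _ {d e α β : ℕ} {D : Dessin} {x₀ : Fin (N D)} where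

    swap-coordinates : Coordinates d e α β D x₀ → Coordinates e d β α (reciprocal D) x₀
    swap-coordinates C = record
      { α≡0 = β≡0 ; β≡0 = α≡0 ; α-kills = β-kills ; β-kills = α-kills ; X = Y ; Y = X
      ; X-base = Y-base ; Y-base = X-base ; X-a = Y-b ; X-b = Y-a ; Y-a = X-b ; Y-b = X-a
      ; injective = λ Y≡ X≡ → injective X≡ Y≡ }
      where open Coordinates C

  module CoordinateProperties {d e α β : ℕ} {D : Dessin} {x₀ : Fin (N D)} (C : Coordinates d e α β D x₀) where
    open Coordinates C public

    L M : ℤ
    L = 1ℤ + + α
    M = 1ℤ + + β

    L≡1 : L ≡ 1ℤ [ P ]
    L≡1 = +-congˡ 1ℤ α≡0

    M≡1 : M ≡ 1ℤ [ P ]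
    M≡1 = +-congˡ 1ℤ β≡0

    α-scale : ∀ {x y} → x ≡ y [ P ^ d ] → + α * x ≡ + α * y [ P ^ e ]
    α-scale = scale-kills (+ α) α-kills

    unit : ∀ {α} x → α ≡ 0ℤ [ P ] → 1ℤ + α * x ≡ 1ℤ [ P ]
    unit {α} x α≡0 = comb₁ x α≡0 (lem α x)
      where
      lem : ∀ α x → 1ℤ + α * x - 1ℤ ≡ x * (α - 0ℤ)
      lem = solve-∀

    -- The displacement X(a x) - X(x). Under a it is multiplied by 1 + α, just as Y is, and
    -- `α-kills` gives it a meaning modulo pᵉ.
    u : Fin (N D) → ℤ
    u x = 1ℤ + + α * X x

    u≡1 : ∀ x → u x ≡ 1ℤ [ P ]
    u≡1 x = unit (X x) α≡0

    X-a^ : ∀ k x → X (iter (a D) k x) ≡ X x + geo L k * u x [ P ^ d ]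
    X-a^ zero    x = ≡⇒≡[] (lem (X x) (u x))
      where
      lem : ∀ x u → x ≡ x + 0ℤ * u
      lem = solve-∀
    X-a^ (suc k) x = ≡-trans (X-a (iter (a D) k x)) (≡-trans (+-congˡ 1ℤ (*-congˡ L (X-a^ k x)))
      (≡⇒≡[] (lem (+ α) (X x) (geo L k))))
      where
      lem : ∀ α x g → 1ℤ + (1ℤ + α) * (x + g * (1ℤ + α * x)) ≡ x + (1ℤ + (1ℤ + α) * g) * (1ℤ + α * x)
      lem = solve-∀

    Y-a^ : ∀ k x → Y (iter (a D) k x) ≡ L ^ k * Y x [ P ^ e ]
    Y-a^ zero    x = ≡⇒≡[] (sym (*-identityˡ (Y x)))
    Y-a^ (suc k) x = ≡-trans (Y-a (iter (a D) k x)) (≡-trans (*-congˡ L (Y-a^ k x))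
      (≡⇒≡[] (sym (*-assoc L (L ^ k) (Y x)))))

    u-a^ : ∀ k x → u (iter (a D) k x) ≡ L ^ k * u x [ P ^ e ]
    u-a^ k x = ≡-trans (+-congˡ 1ℤ (α-scale (X-a^ k x)))
      (≡⇒≡[] (trans (lem (+ α) (X x) (geo L k)) (cong (_* u x) (sym (^-geo (+ α) k)))))
      where
      lem : ∀ α x g → 1ℤ + α * (x + g * (1ℤ + α * x)) ≡ (1ℤ + α * g) * (1ℤ + α * x)
      lem = solve-∀

    -- The cycles of a are the level sets of Y / (1 + α X) modulo pᵉ.
    a-cycle⇒ : ∀ k x → Y (iter (a D) k x) * u x ≡ Y x * u (iter (a D) k x) [ P ^ e ]
    a-cycle⇒ k x = ≡-trans (*-cong (Y-a^ k x) (≡-refl {u x}))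
      (≡-trans (≡⇒≡[] (lem (L ^ k) (Y x) (u x))) (*-congˡ (Y x) (≡-sym (u-a^ k x))))
      where
      lem : ∀ l y u → l * y * u ≡ y * (l * u)
      lem = solve-∀

    -- The exponent k is chosen to match the first coordinate, which moves by geo L k · u(x); the
    -- invariant Y / u then forces the second to match.
    a-cycle⇐ : ∀ x y → Y x * u y ≡ Y y * u x [ P ^ e ] → SameOrbit (a D) x y
    a-cycle⇐ x y eq = from (log d (inv d (u x) * (X y - X x)) L≡1)
      where
      from : (∃ λ k → geo L k ≡ inv d (u x) * (X y - X x) [ P ^ d ]) → SameOrbit (a D) x y
      from (k , geo≡) = k , injective X≡ (cancel e (u≡1 x) Y≡)
        where
        z = iter (a D) k x
        X≡ : X z ≡ X y [ P ^ d ]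
        X≡ = comb₃ 1ℤ (u x) (X y - X x) (X-a^ k x) geo≡ (inverse (u x) d (u≡1 x))
          (lem (X z) (X x) (X y) (geo L k) (u x) (inv d (u x)))
          where
          lem : ∀ z x y g u v → z - y ≡ 1ℤ * (z - (x + g * u)) + u * (g - v * (y - x)) + (y - x) * (u * v - 1ℤ)
          lem = solve-∀
        Y≡ : u x * Y z ≡ u x * Y y [ P ^ e ]
        Y≡ = comb₃ 1ℤ (Y x) 1ℤ (a-cycle⇒ k x) (+-congˡ 1ℤ (α-scale X≡)) eq
          (lem (u x) (Y z) (Y y) (Y x) (u z) (u y))
          where
          lem : ∀ ux Yz Yy Yx uz uy → ux * Yz - ux * Yy ≡
                1ℤ * (Yz * ux - Yx * uz) + Yx * (uz - uy) + 1ℤ * (Yx * uy - Yy * ux)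
          lem = solve-∀

    a-fixed⇒ : ∀ k x → iter (a D) k x ≡ x → + k ≡ 0ℤ [ P ^ d ]
    a-fixed⇒ k x eq = geo-injective d {k} {0} L≡1 (cancel {u x} d (u≡1 x)
      (comb₂ -1ℤ 1ℤ (X-a^ k x) (≡⇒≡[] (cong X eq)) (lem (X (iter (a D) k x)) (X x) (geo L k) (u x))))
      where
      lem : ∀ z x g u → u * g - u * 0ℤ ≡ -1ℤ * (z - (x + g * u)) + 1ℤ * (z - x)
      lem = solve-∀

    a-fixed⇐ : ∀ k x → + k ≡ 0ℤ [ P ^ d ] → iter (a D) k x ≡ x
    a-fixed⇐ k x k≡0 = injective
      (comb₂ 1ℤ (u x) (X-a^ k x) geo≡0 (lem (X (iter (a D) k x)) (X x) (geo L k) (u x)))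
      (comb₂ 1ℤ (Y x) (Y-a^ k x) (α-scale geo≡0)
        (trans (cong (λ t → Y (iter (a D) k x) - t) (lem₀ (Y x)))
          (lem′ (Y (iter (a D) k x)) (Y x) (geo L k) (+ α) (L ^ k) (^-geo (+ α) k))))
      where
      geo≡0 : geo L k ≡ 0ℤ [ P ^ d ]
      geo≡0 = geo-exp-cong d {k} {0} L≡1 k≡0
      lem : ∀ z x g u → z - x ≡ 1ℤ * (z - (x + g * u)) + u * (g - 0ℤ)
      lem = solve-∀
      lem₀ : ∀ y → y ≡ 1ℤ * y
      lem₀ y = sym (*-identityˡ y)
      lem′ : ∀ z y g α l → l ≡ 1ℤ + α * g → z - 1ℤ * y ≡ 1ℤ * (z - l * y) + y * (α * g - α * 0ℤ)
      lem′ z y g α l refl = lem″ z y g α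
        where
        lem″ : ∀ z y g α → z - 1ℤ * y ≡ 1ℤ * (z - (1ℤ + α * g) * y) + y * (α * g - α * 0ℤ)
        lem″ = solve-∀

  module _ {d e α β : ℕ} {D : Dessin} {x₀ : Fin (N D)} (C : Coordinates d e α β D x₀) where
    open CoordinateProperties C
    private module S = CoordinateProperties (swap-coordinates C)

    private
      X-b^ : ∀ j → X (iter (b D) j x₀) ≡ 0ℤ [ P ^ d ]
      X-b^ j = ≡-trans (S.Y-a^ j x₀) (≡-trans (*-congˡ (M ^ j) X-base) (≡⇒≡[] (*-zeroʳ (M ^ j))))

      Y-b^ : ∀ j → Y (iter (b D) j x₀) ≡ geo M j [ P ^ e ]
      Y-b^ j = ≡-trans (S.X-a^ j x₀) (comb₁ (1ℤ + geo M j * + β) Y-base (lem (Y x₀) (geo M j) (+ β)))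
        where
        lem : ∀ y g β → y + g * (1ℤ + β * y) - g ≡ (1ℤ + g * β) * (y - 0ℤ)
        lem = solve-∀

    X-at : ∀ i j → X (iter (a D) i (iter (b D) j x₀)) ≡ geo L i [ P ^ d ]
    X-at i j = comb₂ 1ℤ (1ℤ + geo L i * + α) (X-a^ i z) (X-b^ j) (lem (X (iter (a D) i z)) (X z) (geo L i) (+ α))
      where
      z = iter (b D) j x₀
      lem : ∀ w z g α → w - g ≡ 1ℤ * (w - (z + g * (1ℤ + α * z))) + (1ℤ + g * α) * (z - 0ℤ)
      lem = solve-∀

    Y-at : ∀ i j → Y (iter (a D) i (iter (b D) j x₀)) ≡ L ^ i * geo M j [ P ^ e ]
    Y-at i j = ≡-trans (Y-a^ i (iter (b D) j x₀)) (*-congˡ (L ^ i) (Y-b^ j))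

    -- Powers of b keep X at 0 on the base edge, so i is found from the first coordinate alone, and
    -- then j from the second.
    element-at : ∀ x y → ∃₂ λ i j → X (iter (a D) i (iter (b D) j x₀)) ≡ x [ P ^ d ] ×
                                    Y (iter (a D) i (iter (b D) j x₀)) ≡ y [ P ^ e ]
    element-at x y = from (log d x L≡1)
      where
      Result = ∃₂ λ i j → X (iter (a D) i (iter (b D) j x₀)) ≡ x [ P ^ d ] × Y (iter (a D) i (iter (b D) j x₀)) ≡ y [ P ^ e ]
      from : (∃ λ i → geo L i ≡ x [ P ^ d ]) → Result
      from (i , i≡) = from′ (log e (inv e (L ^ i) * y) M≡1)
        where
        from′ : (∃ λ j → geo M j ≡ inv e (L ^ i) * y [ P ^ e ]) → Result
        from′ (j , j≡) = i , j , ≡-trans (X-at i j) i≡ ,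
          ≡-trans (Y-at i j) (comb₂ (L ^ i) y j≡ (inverse (L ^ i) e (^≡1 i L≡1))
            (lem (L ^ i) y (geo M j) (inv e (L ^ i))))
          where
          lem : ∀ l y g v → l * g - y ≡ l * (g - v * y) + y * (l * v - 1ℤ)
          lem = solve-∀

    element : ∀ x y → ∃ λ g → X g ≡ x [ P ^ d ] × Y g ≡ y [ P ^ e ]
    element x y = let i , j , X≡ , Y≡ = element-at x y in iter (a D) i (iter (b D) j x₀) , X≡ , Y≡

  module _ {d e α β : ℕ} {D E : Dessin} {x₀ : Fin (N D)} {y₀ : Fin (N E)}
    (C : Coordinates d e α β D x₀) (C′ : Coordinates d e α β E y₀) where

    private
      module C = Coordinates C
      module C′ = Coordinates C′

    match : ∀ x → ∃ λ y → C′.X y ≡ C.X x [ P ^ d ] × C′.Y y ≡ C.Y x [ P ^ e ]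
    match x = element C′ (C.X x) (C.Y x)

  module _ {d e α β : ℕ} {D E : Dessin} {x₀ : Fin (N D)} {y₀ : Fin (N E)}
    (C : Coordinates d e α β D x₀) (C′ : Coordinates d e α β E y₀) where

    private
      module C = Coordinates C
      module C′ = Coordinates C′

      f : Fin (N D) → Fin (N E)
      f x = proj₁ (match C C′ x)

      g : Fin (N E) → Fin (N D)
      g y = proj₁ (match C′ C y)

      X-f : ∀ x → C′.X (f x) ≡ C.X x [ P ^ d ]
      X-f x = proj₁ (proj₂ (match C C′ x))

      Y-f : ∀ x → C′.Y (f x) ≡ C.Y x [ P ^ e ]
      Y-f x = proj₂ (proj₂ (match C C′ x))

      X-g : ∀ y → C.X (g y) ≡ C′.X y [ P ^ d ]
      X-g y = proj₁ (proj₂ (match C′ C y))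

      Y-g : ∀ y → C.Y (g y) ≡ C′.Y y [ P ^ e ]
      Y-g y = proj₂ (proj₂ (match C′ C y))

    -- Equal multipliers suffice: edges with equal coordinates correspond, and a and b are given by
    -- the same formulas in both dessins.
    iso : Iso D E
    iso = permutation f g
        (λ y → C′.injective (≡-trans (X-f (g y)) (X-g y)) (≡-trans (Y-f (g y)) (Y-g y)))
        (λ x → C.injective (≡-trans (X-g (f x)) (X-f x)) (≡-trans (Y-g (f x)) (Y-f x))) ,
      (λ x → C′.injective
        (≡-trans (X-f (a D ⟨$⟩ʳ x)) (≡-trans (C.X-a x) (≡-sym (≡-trans (C′.X-a (f x)) (+-congˡ 1ℤ (*-congˡ (1ℤ + + α) (X-f x)))))))
        (≡-trans (Y-f (a D ⟨$⟩ʳ x)) (≡-trans (C.Y-a x) (≡-sym (≡-trans (C′.Y-a (f x)) (*-congˡ (1ℤ + + α) (Y-f x))))))) ,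
      (λ x → C′.injective
        (≡-trans (X-f (b D ⟨$⟩ʳ x)) (≡-trans (C.X-b x) (≡-sym (≡-trans (C′.X-b (f x)) (*-congˡ (1ℤ + + β) (X-f x))))))
        (≡-trans (Y-f (b D ⟨$⟩ʳ x)) (≡-trans (C.Y-b x) (≡-sym (≡-trans (C′.Y-b (f x)) (+-congˡ 1ℤ (*-congˡ (1ℤ + + β) (Y-f x))))))))

    iso-base : proj₁ iso ⟨$⟩ʳ x₀ ≡ y₀
    iso-base = C′.injective (≡-trans (X-f x₀) (≡-trans C.X-base (≡-sym C′.X-base)))
                            (≡-trans (Y-f x₀) (≡-trans C.Y-base (≡-sym C′.Y-base)))

  pull-back : ∀ {d e α β D E x₀ y₀} (φ : Iso D E) → proj₁ φ ⟨$⟩ʳ x₀ ≡ y₀ →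
              Coordinates d e α β E y₀ → Coordinates d e α β D x₀
  pull-back {d} {e} {α} {β} {D} {E} (φ , φ-a , φ-b) refl C = record
    { α≡0 = α≡0 ; β≡0 = β≡0 ; α-kills = α-kills ; β-kills = β-kills
    ; X = λ x → X (φ ⟨$⟩ʳ x) ; Y = λ x → Y (φ ⟨$⟩ʳ x) ; X-base = X-base ; Y-base = Y-base
    ; X-a = λ x → ≡-trans (≡⇒≡[] (cong X (φ-a x))) (X-a (φ ⟨$⟩ʳ x))
    ; X-b = λ x → ≡-trans (≡⇒≡[] (cong X (φ-b x))) (X-b (φ ⟨$⟩ʳ x))
    ; Y-a = λ x → ≡-trans (≡⇒≡[] (cong Y (φ-a x))) (Y-a (φ ⟨$⟩ʳ x))
    ; Y-b = λ x → ≡-trans (≡⇒≡[] (cong Y (φ-b x))) (Y-b (φ ⟨$⟩ʳ x))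
    ; injective = λ {x} {y} X≡ Y≡ → trans (sym (inverseˡ φ)) (trans (cong (φ ⟨$⟩ˡ_) (injective X≡ Y≡)) (inverseˡ φ))
    }
    where open Coordinates C

  residue-unique : ∀ k {x y} → x ℕ.< p ℕ.^ k → y ℕ.< p ℕ.^ k → + x ≡ + y [ P ^ k ] → x ≡ y
  residue-unique k {x} {y} x< y< x≡y with difference ([p^]⇒ k x≡y)
  ... | inj₁ (zero  , e) = sym (trans e (trans (cong (x ℕ.+_) (ℕ.*-zeroʳ (p ℕ.^ k))) (ℕ.+-identityʳ x)))
  ... | inj₁ (suc s , e) = contradiction (ℕ.≤-trans (ℕ.≤-trans (ℕ.m≤m*n (p ℕ.^ k) (suc s)) (ℕ.m≤n+m _ x)) (ℕ.≤-reflexive (sym e))) (ℕ.<⇒≱ y<)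
  ... | inj₂ (zero  , e) = trans e (trans (cong (y ℕ.+_) (ℕ.*-zeroʳ (p ℕ.^ k))) (ℕ.+-identityʳ y))
  ... | inj₂ (suc s , e) = contradiction (ℕ.≤-trans (ℕ.≤-trans (ℕ.m≤m*n (p ℕ.^ k) (suc s)) (ℕ.m≤n+m _ y)) (ℕ.≤-reflexive (sym e))) (ℕ.<⇒≱ x<)

  fin : ∀ k → ℤ → Fin (p ℕ.^ k)
  fin k x = let r , r< , _ = residue x (p ℕ.^ k) ⦃ ℕ.m^n≢0 p k ⦄ in fromℕ< r<

  toℕ-fin : ∀ k x → + toℕ (fin k x) ≡ x [ P ^ k ]
  toℕ-fin k x = let r , r< , r≡ = residue x (p ℕ.^ k) ⦃ ℕ.m^n≢0 p k ⦄ in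
    ≡-trans (≡⇒≡[] (cong +_ (Fin.toℕ-fromℕ< r<))) ([p^]⇐ k r≡)

  fin-cong : ∀ k {x y} → x ≡ y [ P ^ k ] → fin k x ≡ fin k y
  fin-cong k {x} {y} x≡y = Fin.toℕ-injective (residue-unique k (Fin.toℕ<n (fin k x)) (Fin.toℕ<n (fin k y))
    (≡-trans (toℕ-fin k x) (≡-trans x≡y (≡-sym (toℕ-fin k y)))))

  fin-injective : ∀ k {x y} → fin k x ≡ fin k y → x ≡ y [ P ^ k ]
  fin-injective k {x} {y} e = ≡-trans (≡-sym (toℕ-fin k x)) (≡-trans (≡⇒≡[] (cong (λ t → + toℕ t) e)) (toℕ-fin k y))

  fin-toℕ : ∀ k i → fin k (+ toℕ i) ≡ i
  fin-toℕ k i = Fin.toℕ-injective (residue-unique k (Fin.toℕ<n (fin k (+ toℕ i))) (Fin.toℕ<n i) (toℕ-fin k (+ toℕ i)))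

  toℕ-injective-mod : ∀ k {i j : Fin (p ℕ.^ k)} → + toℕ i ≡ + toℕ j [ P ^ k ] → i ≡ j
  toℕ-injective-mod k {i} {j} e = Fin.toℕ-injective (residue-unique k (Fin.toℕ<n i) (Fin.toℕ<n j) e)

  ratio⇒ : ∀ k y u y′ u′ → u ≡ 1ℤ [ P ] → u′ ≡ 1ℤ [ P ] →
           y * inv k u ≡ y′ * inv k u′ [ P ^ k ] → y * u′ ≡ y′ * u [ P ^ k ]
  ratio⇒ k y u y′ u′ u≡1 u′≡1 e = comb₃ (u * u′) (- (y * u′)) (y′ * u) e (inverse u k u≡1) (inverse u′ k u′≡1)
    (lem y u y′ u′ (inv k u) (inv k u′))
    where
    lem : ∀ y u y′ u′ v v′ → y * u′ - y′ * u ≡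
          u * u′ * (y * v - y′ * v′) + - (y * u′) * (u * v - 1ℤ) + y′ * u * (u′ * v′ - 1ℤ)
    lem = solve-∀

  ratio⇐ : ∀ k y u y′ u′ → u ≡ 1ℤ [ P ] → u′ ≡ 1ℤ [ P ] →
           y * u′ ≡ y′ * u [ P ^ k ] → y * inv k u ≡ y′ * inv k u′ [ P ^ k ]
  ratio⇐ k y u y′ u′ u≡1 u′≡1 e = comb₃ (inv k u * inv k u′) (- (y * inv k u)) (y′ * inv k u′) e
    (inverse u′ k u′≡1) (inverse u k u≡1) (lem y u y′ u′ (inv k u) (inv k u′))
    where
    lem : ∀ y u y′ u′ v v′ → y * v - y′ * v′ ≡
          v * v′ * (y * u′ - y′ * u) + - (y * v) * (u′ * v′ - 1ℤ) + y′ * v′ * (u * v - 1ℤ)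
    lem = solve-∀

  *-unit : ∀ {u v} → u ≡ 1ℤ [ P ] → v ≡ 1ℤ [ P ] → u * v ≡ 1ℤ [ P ]
  *-unit = *-cong

  p^∣⇒≤ : ∀ k {j} → 0 ℕ.< j → + j ≡ 0ℤ [ P ^ k ] → p ℕ.^ k ℕ.≤ j
  p^∣⇒≤ k {j} 0<j j≡0 = ℕ.∣⇒≤ ⦃ ℕ.>-nonZero 0<j ⦄ (0[]⇒∣ ([p^]⇒ k j≡0))

  0<p^ : ∀ k → 0 ℕ.< p ℕ.^ k
  0<p^ k = ℕ.>-nonZero⁻¹ (p ℕ.^ k) ⦃ ℕ.m^n≢0 p k ⦄

  module _ {d e α β : ℕ} {D : Dessin} {x₀ : Fin (N D)} (C : Coordinates d e α β D x₀) where
    open CoordinateProperties C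
    private module S = CoordinateProperties (swap-coordinates C)

    a-cycle-length : ∀ x → CycleLength (a D) x (p ℕ.^ d)
    a-cycle-length x = 0<p^ d , a-fixed⇐ (p ℕ.^ d) x (p^≡0 d) ,
      λ j 0<j j< eq → ℕ.<⇒≱ j< (p^∣⇒≤ d 0<j (a-fixed⇒ j x eq))

    black : Fin (N D) → Fin (p ℕ.^ e)
    black x = fin e (Y x * inv e (u x))

    black⇔ : ∀ x y → (black x ≡ black y) ⇔ SameOrbit (a D) x y
    black⇔ x y = mk⇔ (λ eq → a-cycle⇐ x y (ratio⇒ e (Y x) (u x) (Y y) (u y) (u≡1 x) (u≡1 y) (fin-injective e {Y x * inv e (u x)} {Y y * inv e (u y)} eq)))
      (λ (k , eq) → subst (λ z → black x ≡ black z) eq (fin-cong e (ratio⇐ e (Y x) (u x) (Y (iter (a D) k x)) (u (iter (a D) k x))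
        (u≡1 x) (u≡1 (iter (a D) k x)) (≡-sym (a-cycle⇒ k x)))))

  module _ {d e α β : ℕ} {D : Dessin} {x₀ : Fin (N D)} (C : Coordinates d e α β D x₀) where
    open CoordinateProperties C
    private
      module S = CoordinateProperties (swap-coordinates C)
      w = S.u

    white : Fin (N D) → Fin (p ℕ.^ d)
    white = black (swap-coordinates C)

    -- Equality of both labels is a linear system for the coordinates of x, with determinant u(y)
    -- w(y) - αβ X(y) Y(y) ≡ 1 modulo p. The moduli differ, and Y is found before X.
    separated : ∀ x y → black C x ≡ black C y → white x ≡ white y → x ≡ y
    separated x y β≡ ω≡ = injective (δ≡0 ε≡0) ε≡0
      where
      Y≡ : Y x * u y ≡ Y y * u x [ P ^ e ]
      Y≡ = ratio⇒ e (Y x) (u x) (Y y) (u y) (u≡1 x) (u≡1 y) (fin-injective e {Y x * inv e (u x)} {Y y * inv e (u y)} β≡)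
      X≡ : X x * w y ≡ X y * w x [ P ^ d ]
      X≡ = ratio⇒ d (X x) (w x) (X y) (w y) (S.u≡1 x) (S.u≡1 y) (fin-injective d {X x * inv d (w x)} {X y * inv d (w y)} ω≡)
      unit′ : u y * w y - + α * + β * (X y * Y y) ≡ 1ℤ [ P ]
      unit′ = comb₃ (w y) 1ℤ (- (+ β * (X y * Y y))) (u≡1 y) (S.u≡1 y) α≡0 (lem (u y) (w y) (+ α) (+ β) (X y * Y y))
        where
        lem : ∀ u w α β z → u * w - α * β * z - 1ℤ ≡ w * (u - 1ℤ) + 1ℤ * (w - 1ℤ) + - (β * z) * (α - 0ℤ)
        lem = solve-∀
      ε≡0 : Y x ≡ Y y [ P ^ e ]
      ε≡0 = cancel e unit′ (comb₂ (w y) (Y y) Y≡ (α-scale X≡) (lem (+ α) (+ β) (X x) (X y) (Y x) (Y y)))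
        where
        lem : ∀ α β X X′ Y Y′ →
          ((1ℤ + α * X′) * (1ℤ + β * Y′) - α * β * (X′ * Y′)) * Y - ((1ℤ + α * X′) * (1ℤ + β * Y′) - α * β * (X′ * Y′)) * Y′ ≡
          (1ℤ + β * Y′) * (Y * (1ℤ + α * X′) - Y′ * (1ℤ + α * X)) +
          Y′ * (α * (X * (1ℤ + β * Y′)) - α * (X′ * (1ℤ + β * Y)))
        lem = solve-∀
      δ≡0 : Y x ≡ Y y [ P ^ e ] → X x ≡ X y [ P ^ d ]
      δ≡0 ε≡ = cancel d (S.u≡1 y) (comb₂ 1ℤ (X y) X≡ (S.α-scale ε≡) (lem (+ β) (X x) (X y) (Y x) (Y y)))
        where
        lem : ∀ β X X′ Y Y′ → (1ℤ + β * Y′) * X - (1ℤ + β * Y′) * X′ ≡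
              1ℤ * (X * (1ℤ + β * Y′) - X′ * (1ℤ + β * Y)) + X′ * (β * Y - β * Y′)
        lem = solve-∀

    -- The equations Y = I (1 + αX) and X = K (1 + βY) are solved by elimination: X (1 - αβ I K) = K
    -- (1 + β I), with `v` the coefficient on the left.
    edge : ∀ i j → ∃ λ x → black C x ≡ i × white x ≡ j
    edge i j = from (element C x* (I * (1ℤ + + α * x*)))
      where
      I = + toℕ i
      K = + toℕ j
      v = 1ℤ - + α * + β * (I * K)
      x* = K * (1ℤ + + β * I) * inv d v
      v≡1 : v ≡ 1ℤ [ P ]
      v≡1 = comb₁ (- (+ β * (I * K))) α≡0 (lem (+ α) (+ β) (I * K))
        where
        lem : ∀ α β z → 1ℤ - α * β * z - 1ℤ ≡ - (β * z) * (α - 0ℤ)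
        lem = solve-∀
      from : (∃ λ g → X g ≡ x* [ P ^ d ] × Y g ≡ I * (1ℤ + + α * x*) [ P ^ e ]) → ∃ λ x → black C x ≡ i × white x ≡ j
      from (g , X≡ , Y≡) = g ,
        trans (fin-cong e {Y g * inv e (u g)} {I} (comb₂ (inv e (u g)) I Y≡u (inverse (u g) e (u≡1 g)) (lem₁ (Y g) (inv e (u g)) I (u g)))) (fin-toℕ e i) ,
        trans (fin-cong d {X g * inv d (w g)} {K} (comb₂ (inv d (w g)) K X≡w (inverse (w g) d (S.u≡1 g)) (lem₁ (X g) (inv d (w g)) K (w g)))) (fin-toℕ d j)
        where
        lem₁ : ∀ y v I u → y * v - I ≡ v * (y - I * u) + I * (u * v - 1ℤ)
        lem₁ = solve-∀
        Y≡u : Y g ≡ I * u g [ P ^ e ]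
        Y≡u = comb₂ 1ℤ (- I) Y≡ (α-scale X≡) (lem (Y g) I (+ α) x* (X g))
          where
          lem : ∀ y I α x X → y - I * (1ℤ + α * X) ≡ 1ℤ * (y - I * (1ℤ + α * x)) + - I * (α * X - α * x)
          lem = solve-∀
        X≡w : X g ≡ K * w g [ P ^ d ]
        X≡w = comb₃ 1ℤ (K * (1ℤ + + β * I)) (- K) X≡ (inverse v d v≡1) (S.α-scale Y≡) (lem (X g) K (+ α) (+ β) I (Y g) (inv d v))
          where
          lem : ∀ X K α β I Y t → X - K * (1ℤ + β * Y) ≡
            1ℤ * (X - K * (1ℤ + β * I) * t) +
            K * (1ℤ + β * I) * ((1ℤ - α * β * (I * K)) * t - 1ℤ) +
            - K * (β * Y - β * (I * (1ℤ + α * (K * (1ℤ + β * I) * t))))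
          lem = solve-∀

    complete-bipartite : IsCompleteBipartite D (p ℕ.^ e) (p ℕ.^ d)
    complete-bipartite = black C , white , black⇔ C , black⇔ (swap-coordinates C) , separated , edge

  module _ {d e α β : ℕ} {D : Dessin} {x₀ : Fin (N D)} (d≤e : d ℕ.≤ e) (C : Coordinates d e α β D x₀) where
    open CoordinateProperties C
    private
      module S = CoordinateProperties (swap-coordinates C)

      -- The linear part of the affine map taking the origin to the coordinates of x: it is 1 at the
      -- base edge, and a and b multiply it by 1 + α and 1 + β.
      U : Fin (N D) → ℤ
      U x = 1ℤ + (+ α * X x + + β * Y x)

      U≡1 : ∀ x → U x ≡ 1ℤ [ P ]
      U≡1 x = comb₂ (X x) (Y x) α≡0 β≡0 (lem (+ α) (+ β) (X x) (Y x))
        where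
        lem : ∀ α β x y → 1ℤ + (α * x + β * y) - 1ℤ ≡ x * (α - 0ℤ) + y * (β - 0ℤ)
        lem = solve-∀

      U-a : ∀ x → U (a D ⟨$⟩ʳ x) ≡ L * U x [ P ^ e ]
      U-a x = comb₂ 1ℤ (+ β) (α-scale (X-a x)) (Y-a x) (lem (+ α) (+ β) (X (a D ⟨$⟩ʳ x)) (Y (a D ⟨$⟩ʳ x)) (X x) (Y x))
        where
        lem : ∀ α β x′ y′ x y → 1ℤ + (α * x′ + β * y′) - (1ℤ + α) * (1ℤ + (α * x + β * y)) ≡
              1ℤ * (α * x′ - α * (1ℤ + (1ℤ + α) * x)) + β * (y′ - (1ℤ + α) * y)
        lem = solve-∀

      U-b : ∀ x → U (b D ⟨$⟩ʳ x) ≡ M * U x [ P ^ e ]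
      U-b x = comb₂ 1ℤ (+ β) (α-scale (X-b x)) (Y-b x) (lem (+ α) (+ β) (X (b D ⟨$⟩ʳ x)) (Y (b D ⟨$⟩ʳ x)) (X x) (Y x))
        where
        lem : ∀ α β x′ y′ x y → 1ℤ + (α * x′ + β * y′) - (1ℤ + β) * (1ℤ + (α * x + β * y)) ≡
              1ℤ * (α * x′ - α * ((1ℤ + β) * x)) + β * (y′ - (1ℤ + (1ℤ + β) * y))
        lem = solve-∀

    -- With the product v * w = v + U(v) w on coordinate vectors, the new coordinates of w are those of w * v⁻¹.
    module Rebase (v : Fin (N D)) where
      private
        k = inv e (U v)
        k-inverse : U v * k ≡ 1ℤ [ P ^ e ]
        k-inverse = inverse (U v) e (U≡1 v)

        X′ Y′ : Fin (N D) → ℤ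
        X′ x = X x - U x * (k * X v)
        Y′ x = Y x - U x * (k * Y v)

        at-v : ∀ {n x} → U v * k ≡ 1ℤ [ n ] → x - U v * (k * x) ≡ 0ℤ [ n ]
        at-v {n} {x} e = comb₁ (- x) e (lem (U v) k x)
          where
          lem : ∀ u k x → x - u * (k * x) - 0ℤ ≡ - x * (u * k - 1ℤ)
          lem = solve-∀

        affine : ∀ {n x x′ u u′ L c} → x′ ≡ 1ℤ + L * x [ n ] → u′ ≡ L * u [ n ] → x′ - u′ * c ≡ 1ℤ + L * (x - u * c) [ n ]
        affine {n} {x} {x′} {u} {u′} {L} {c} e e′ = comb₂ 1ℤ (- c) e e′ (lem x x′ u u′ L c)
          where
          lem : ∀ x x′ u u′ L c → x′ - u′ * c - (1ℤ + L * (x - u * c)) ≡ 1ℤ * (x′ - (1ℤ + L * x)) + - c * (u′ - L * u)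
          lem = solve-∀

        linear : ∀ {n x x′ u u′ L c} → x′ ≡ L * x [ n ] → u′ ≡ L * u [ n ] → x′ - u′ * c ≡ L * (x - u * c) [ n ]
        linear {n} {x} {x′} {u} {u′} {L} {c} e e′ = comb₂ 1ℤ (- c) e e′ (lem x x′ u u′ L c)
          where
          lem : ∀ x x′ u u′ L c → x′ - u′ * c - (L * (x - u * c)) ≡ 1ℤ * (x′ - L * x) + - c * (u′ - L * u)
          lem = solve-∀

        U-from : ∀ x → 1ℤ + (+ α * X′ x + + β * Y′ x) ≡ U x * k [ P ^ e ]
        U-from x = comb₁ (- U x) k-inverse (lem (+ α) (+ β) (X x) (Y x) (X v) (Y v) k)
          where
          lem : ∀ α β x y x₀ y₀ k → 1ℤ + (α * (x - (1ℤ + (α * x + β * y)) * (k * x₀)) + β * (y - (1ℤ + (α * x + β * y)) * (k * y₀)))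
                - (1ℤ + (α * x + β * y)) * k ≡ - (1ℤ + (α * x + β * y)) * ((1ℤ + (α * x₀ + β * y₀)) * k - 1ℤ)
          lem = solve-∀

        recover : ∀ {n x y u v c} → x - u * (k * c) ≡ y - v * (k * c) [ n ] → u * k ≡ v * k [ n ] → x ≡ y [ n ]
        recover {n} {x} {y} {u} {v} {c} e e′ = comb₂ 1ℤ c e e′ (lem x y u v k c)
          where
          lem : ∀ x y u v k c → x - y ≡ 1ℤ * (x - u * (k * c) - (y - v * (k * c))) + c * (u * k - v * k)
          lem = solve-∀

      rebase : Coordinates d e α β D v
      rebase = record
        { α≡0 = α≡0 ; β≡0 = β≡0 ; α-kills = α-kills ; β-kills = β-kills ; X = X′ ; Y = Y′
        ; X-base = at-v {x = X v} (^-weaken d≤e k-inverse)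
        ; Y-base = at-v {x = Y v} k-inverse
        ; X-a = λ x → affine {x = X x} {u = U x} {L = L} (X-a x) (^-weaken d≤e (U-a x))
        ; X-b = λ x → linear {x = X x} {u = U x} {L = M} (X-b x) (^-weaken d≤e (U-b x))
        ; Y-a = λ x → linear {x = Y x} {u = U x} {L = L} (Y-a x) (U-a x)
        ; Y-b = λ x → affine {x = Y x} {u = U x} {L = M} (Y-b x) (U-b x)
        ; injective = λ {x} {y} X≡ Y≡ →
            let U≡ = ≡-trans (≡-sym (U-from x)) (≡-trans (+-congˡ 1ℤ (+-cong (α-scale X≡) (*-congˡ (+ β) Y≡))) (U-from y))
            in injective (recover {x = X x} {X y} {U x} {U y} {X v} X≡ (^-weaken d≤e U≡)) (recover {x = Y x} {Y y} {U x} {U y} {Y v} Y≡ U≡)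
        }

    -- Coordinates rebased at x and at y have the same multipliers, and matching them is an
    -- automorphism.
    regular : Regular D
    regular x y = iso (Rebase.rebase x) (Rebase.rebase y) , iso-base (Rebase.rebase x) (Rebase.rebase y)

    edge-count : N D ≡ p ℕ.^ d ℕ.* p ℕ.^ e
    edge-count = Fin.cantor-schröder-bernstein {f = to} {g = from} to-injective from-injective
      where
      to : Fin (N D) → Fin (p ℕ.^ d ℕ.* p ℕ.^ e)
      to x = combine (fin d (X x)) (fin e (Y x))
      to-injective : ∀ {x y} → to x ≡ to y → x ≡ y
      to-injective {x} {y} eq = let X≡ , Y≡ = Fin.combine-injective _ _ _ _ eq in
        injective (fin-injective d {X x} {X y} X≡) (fin-injective e {Y x} {Y y} Y≡)
      pick : (q : Fin (p ℕ.^ d) × Fin (p ℕ.^ e)) → ∃ λ g → X g ≡ + toℕ (proj₁ q) [ P ^ d ] × Y g ≡ + toℕ (proj₂ q) [ P ^ e ]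
      pick (i , j) = element C (+ toℕ i) (+ toℕ j)
      from : Fin (p ℕ.^ d ℕ.* p ℕ.^ e) → Fin (N D)
      from k = proj₁ (pick (remQuot (p ℕ.^ e) k))
      same : ∀ q r → proj₁ (pick q) ≡ proj₁ (pick r) → q ≡ r
      same q@(i , j) r@(i′ , j′) eq = cong₂ _,_
        (toℕ-injective-mod d (≡-trans (≡-sym (proj₁ (proj₂ (pick q)))) (≡-trans (≡⇒≡[] (cong X eq)) (proj₁ (proj₂ (pick r))))))
        (toℕ-injective-mod e (≡-trans (≡-sym (proj₂ (proj₂ (pick q)))) (≡-trans (≡⇒≡[] (cong Y eq)) (proj₂ (proj₂ (pick r))))))
      from-injective : ∀ {x y} → from x ≡ from y → x ≡ y
      from-injective {x} {y} eq = trans (sym (Fin.combine-remQuot {p ℕ.^ d} (p ℕ.^ e) x))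
        (trans (cong (λ (i , j) → combine i j) (same _ _ eq)) (Fin.combine-remQuot {p ℕ.^ d} (p ℕ.^ e) y))

    private
      c : Fin (N D) → Fin (N D)
      c = comp (a D) (b D)

      -- Chosen so that 1 + γ = (1 + α)(1 + β), the linear part of the face permutation.
      γ : ℤ
      γ = + α + (+ β + + α * + β)

      K : ℤ
      K = 1ℤ + γ

      K≡1 : K ≡ 1ℤ [ P ]
      K≡1 = comb₂ (1ℤ + + β) 1ℤ α≡0 β≡0 (lem (+ α) (+ β))
        where
        lem : ∀ α β → 1ℤ + (α + (β + α * β)) - 1ℤ ≡ (1ℤ + β) * (α - 0ℤ) + 1ℤ * (β - 0ℤ)
        lem = solve-∀

      X-c : ∀ x → X (c x) ≡ 1ℤ + K * X x [ P ^ d ]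
      X-c x = comb₂ 1ℤ L (X-a (b D ⟨$⟩ʳ x)) (X-b x) (lem (X (c x)) (X (b D ⟨$⟩ʳ x)) (X x) (+ α) (+ β))
        where
        lem : ∀ z y x α β → z - (1ℤ + (1ℤ + (α + (β + α * β))) * x) ≡
              1ℤ * (z - (1ℤ + (1ℤ + α) * y)) + (1ℤ + α) * (y - (1ℤ + β) * x)
        lem = solve-∀

      Y-c : ∀ x → Y (c x) ≡ L + K * Y x [ P ^ e ]
      Y-c x = comb₂ 1ℤ L (Y-a (b D ⟨$⟩ʳ x)) (Y-b x) (lem (Y (c x)) (Y (b D ⟨$⟩ʳ x)) (Y x) (+ α) (+ β))
        where
        lem : ∀ z y x α β → z - ((1ℤ + α) + (1ℤ + (α + (β + α * β))) * x) ≡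
              1ℤ * (z - (1ℤ + α) * y) + (1ℤ + α) * (y - (1ℤ + (1ℤ + β) * x))
        lem = solve-∀

      affine-orbit : ∀ {n} l (z : Fin (N D) → ℤ) → (∀ x → z (c x) ≡ l + K * z x [ n ]) →
                     ∀ k x → z (fold x c k) ≡ z x + geo K k * (l + γ * z x) [ n ]
      affine-orbit l z z-c zero    x = ≡⇒≡[] (lem (z x) (l + γ * z x))
        where
        lem : ∀ x u → x ≡ x + 0ℤ * u
        lem = solve-∀
      affine-orbit l z z-c (suc k) x = ≡-trans (z-c (fold x c k)) (comb₁ K (affine-orbit l z z-c k x)
        (lem (z (fold x c k)) (z x) (geo K k) γ l))
        where
        lem : ∀ w z g γ l → l + (1ℤ + γ) * w - (z + (1ℤ + (1ℤ + γ) * g) * (l + γ * z)) ≡ (1ℤ + γ) * (w - (z + g * (l + γ * z)))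
        lem = solve-∀

      -- The displacement Y(c x) - Y(x). It is a unit, so along a face Y runs through all residues
      -- modulo pᵉ, and when Y returns so does X.
      V : Fin (N D) → ℤ
      V x = L + γ * Y x

      V≡1 : ∀ x → V x ≡ 1ℤ [ P ]
      V≡1 x = comb₂ 1ℤ (Y x) L≡1 K≡1 (lem L γ (Y x))
        where
        lem : ∀ L γ y → L + γ * y - 1ℤ ≡ 1ℤ * (L - 1ℤ) + y * (1ℤ + γ - 1ℤ)
        lem = solve-∀

      Y-c^ : ∀ k x → Y (fold x c k) ≡ Y x + geo K k * V x [ P ^ e ]
      Y-c^ = affine-orbit L Y Y-c

      X-c^ : ∀ k x → X (fold x c k) ≡ X x + geo K k * (1ℤ + γ * X x) [ P ^ d ]
      X-c^ = affine-orbit 1ℤ X X-c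

      shift : ∀ {n z x g v} → z ≡ x + g * v [ n ] → g ≡ 0ℤ [ n ] → z ≡ x [ n ]
      shift {n} {z} {x} {g} {v} e e′ = comb₂ 1ℤ v e e′ (lem z x g v)
        where
        lem : ∀ z x g v → z - x ≡ 1ℤ * (z - (x + g * v)) + v * (g - 0ℤ)
        lem = solve-∀

      Y-fixed⇒ : ∀ k x → Y (fold x c k) ≡ Y x [ P ^ e ] → + k ≡ 0ℤ [ P ^ e ]
      Y-fixed⇒ k x eq = geo-injective e {k} {0} K≡1 (cancel {V x} e (V≡1 x)
        (comb₂ -1ℤ 1ℤ (Y-c^ k x) eq (lem (Y (fold x c k)) (Y x) (geo K k) (V x))))
        where
        lem : ∀ z x g v → v * g - v * 0ℤ ≡ -1ℤ * (z - (x + g * v)) + 1ℤ * (z - x)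
        lem = solve-∀

      fixed⇐ : ∀ k x → + k ≡ 0ℤ [ P ^ e ] → fold x c k ≡ x
      fixed⇐ k x k≡0 = injective (shift {g = geo K k} {1ℤ + γ * X x} (X-c^ k x) (^-weaken d≤e geo≡0)) (shift {g = geo K k} {V x} (Y-c^ k x) geo≡0)
        where
        geo≡0 : geo K k ≡ 0ℤ [ P ^ e ]
        geo≡0 = geo-exp-cong e {k} {0} K≡1 k≡0

    -- Stated for any sequence obeying the recursion of the face permutation, since the iterates in
    -- `HasType` and in `NumCycles` are local to these definitions.
    module _ {x : Fin (N D)} {z : ℕ → Fin (N D)} (z-zero : z 0 ≡ x) (z-suc : ∀ k → z (suc k) ≡ c (z k)) where

      z≡fold : ∀ k → z k ≡ fold x c k
      z≡fold zero    = z-zero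
      z≡fold (suc k) = trans (z-suc k) (cong c (z≡fold k))

      face-length : 0 ℕ.< p ℕ.^ e × z (p ℕ.^ e) ≡ x × (∀ j → 0 ℕ.< j → j ℕ.< p ℕ.^ e → z j ≢ x)
      face-length = 0<p^ e , trans (z≡fold (p ℕ.^ e)) (fixed⇐ (p ℕ.^ e) x (p^≡0 e)) ,
        λ j 0<j j< eq → ℕ.<⇒≱ j< (p^∣⇒≤ e 0<j (Y-fixed⇒ j x (≡⇒≡[] (cong Y (trans (sym (z≡fold j)) eq)))))

      fold⇒z : ∀ {y} → (∃ λ k → fold x c k ≡ y) → ∃ λ k → z k ≡ y
      fold⇒z (k , eq) = k , trans (z≡fold k) eq

      z⇒fold : ∀ {y} → (∃ λ k → z k ≡ y) → ∃ λ k → fold x c k ≡ y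
      z⇒fold (k , eq) = k , trans (sym (z≡fold k)) eq

    private
      -- Each face meets Y = 0 in exactly one edge, so the value of X there enumerates the faces.
      face : Fin (p ℕ.^ d) → Fin (N D)
      face i = proj₁ (element C (+ toℕ i) 0ℤ)

      X-face : ∀ i → X (face i) ≡ + toℕ i [ P ^ d ]
      X-face i = proj₁ (proj₂ (element C (+ toℕ i) 0ℤ))

      Y-face : ∀ i → Y (face i) ≡ 0ℤ [ P ^ e ]
      Y-face i = proj₂ (proj₂ (element C (+ toℕ i) 0ℤ))

    faces-distinct : ∀ i j → (∃ λ k → fold (face i) c k ≡ face j) → i ≡ j
    faces-distinct i j (k , eq) = toℕ-injective-mod d (≡-trans (≡-sym (X-face i)) (≡-trans (≡⇒≡[] (cong X face≡)) (X-face j)))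
      where
      face≡ : face i ≡ face j
      face≡ = trans (sym (fixed⇐ k (face i) (Y-fixed⇒ k (face i)
        (≡-trans (≡⇒≡[] (cong Y eq)) (≡-trans (Y-face j) (≡-sym (Y-face i))))))) eq

    faces-cover : ∀ x → ∃ λ i → ∃ λ k → fold x c k ≡ face i
    faces-cover x = from (log e (- (inv e (V x) * Y x)) K≡1)
      where
      from : (∃ λ k → geo K k ≡ - (inv e (V x) * Y x) [ P ^ e ]) → ∃ λ i → ∃ λ k → fold x c k ≡ face i
      from (k , k≡) = i , k , injective
        (≡-trans (≡-sym (toℕ-fin d (X (fold x c k)))) (≡-sym (X-face i)))
        (≡-trans (comb₃ 1ℤ (V x) (- Y x) (Y-c^ k x) k≡ (inverse (V x) e (V≡1 x))
          (lem (Y (fold x c k)) (Y x) (geo K k) (V x) (inv e (V x)))) (≡-sym (Y-face i)))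
        where
        i = fin d (X (fold x c k))
        lem : ∀ z y g v w → z - 0ℤ ≡ 1ℤ * (z - (y + g * v)) + v * (g - - (w * y)) + - y * (v * w - 1ℤ)
        lem = solve-∀

    face-cycles : NumCycles c (p ℕ.^ d)
    face-cycles = face , (λ _ → tt) ,
      (λ i j s → faces-distinct i j (z⇒fold refl (λ _ → refl) s)) ,
      (λ x _ → let i , s = faces-cover x in i , fold⇒z refl (λ _ → refl) s)

    has-type : HasType D (p ℕ.^ d) (p ℕ.^ e) (p ℕ.^ e)
    has-type x = a-cycle-length C x , a-cycle-length (swap-coordinates C) x , face-length refl (λ _ → refl)

  module _ {d e α β : ℕ} {D : Dessin} {x₀ : Fin (N D)} (C : Coordinates d e α β D x₀) where

    module _ {x : Fin (N D)} {z : ℕ → Fin (N D)} (z-zero : z 0 ≡ x) (z-suc : ∀ k → z (suc k) ≡ a D ⟨$⟩ʳ z k) where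

      z≡iter : ∀ k → z k ≡ iter (a D) k x
      z≡iter zero    = z-zero
      z≡iter (suc k) = trans (z-suc k) (cong (a D ⟨$⟩ʳ_) (z≡iter k))

      iter⇒z : ∀ {y} → SameOrbit (a D) x y → ∃ λ k → z k ≡ y
      iter⇒z (k , eq) = k , trans (z≡iter k) eq

      z⇒iter : ∀ {y} → (∃ λ k → z k ≡ y) → SameOrbit (a D) x y
      z⇒iter (k , eq) = k , trans (sym (z≡iter k)) eq

    black-cycles : NumCycles (a D ⟨$⟩ʳ_) (p ℕ.^ e)
    black-cycles = rep , (λ _ → tt) ,
      (λ i j s → trans (sym (rep-black i)) (trans (Equivalence.from (black⇔ C (rep i) (rep j)) (z⇒iter refl (λ _ → refl) s)) (rep-black j))) ,
      (λ x _ → black C x , iter⇒z refl (λ _ → refl) (Equivalence.to (black⇔ C x (rep (black C x))) (sym (rep-black (black C x)))))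
      where
      rep : Fin (p ℕ.^ e) → Fin (N D)
      rep i = proj₁ (edge C i (fin d 0ℤ))
      rep-black : ∀ i → black C (rep i) ≡ i
      rep-black i = proj₁ (proj₂ (edge C i (fin d 0ℤ)))

  module _ {d e α β : ℕ} {D : Dessin} {x₀ : Fin (N D)} (d≤e : d ℕ.≤ e) (C : Coordinates d e α β D x₀) where

    private
      -- Writing pᵈ = 1 + 2t gives the genus as t (pᵉ - 2), without division.
      half : ∀ k → ∃ λ t → p ℕ.^ k ≡ 1 ℕ.+ 2 ℕ.* t
      half zero    = 0 , refl
      half (suc k) = let t , eq = half k in h ℕ.+ t ℕ.+ 2 ℕ.* h ℕ.* t , trans (cong₂ ℕ._*_ p-odd eq) (lem h t)
        where
        lem : ∀ h t → (1 ℕ.+ 2 ℕ.* h) ℕ.* (1 ℕ.+ 2 ℕ.* t) ≡ 1 ℕ.+ 2 ℕ.* (h ℕ.+ t ℕ.+ 2 ℕ.* h ℕ.* t)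
        lem = ℕSolver.solve-∀

      euler : ∀ t s → t ℕ.≤ s → (1 ℕ.+ 2 ℕ.* s) ℕ.+ (1 ℕ.+ 2 ℕ.* t) ℕ.+ (1 ℕ.+ 2 ℕ.* t) ℕ.+ 2 ℕ.* (t ℕ.* (1 ℕ.+ 2 ℕ.* s ℕ.∸ 2)) ≡
              2 ℕ.+ (1 ℕ.+ 2 ℕ.* t) ℕ.* (1 ℕ.+ 2 ℕ.* s)
      -- Here pᵉ = 1 and the truncated 1 ∸ 2 is 0; the equation survives because t = 0.
      euler zero    zero    _ = refl
      euler t       (suc s) _ rewrite ℕ.+-suc s (s ℕ.+ 0) = lem t s
        where
        lem : ∀ t s → (3 ℕ.+ 2 ℕ.* s) ℕ.+ (1 ℕ.+ 2 ℕ.* t) ℕ.+ (1 ℕ.+ 2 ℕ.* t) ℕ.+ 2 ℕ.* (t ℕ.* (1 ℕ.+ 2 ℕ.* s)) ≡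
              2 ℕ.+ (1 ℕ.+ 2 ℕ.* t) ℕ.* (3 ℕ.+ 2 ℕ.* s)
        lem = ℕSolver.solve-∀

    genus : ∃ λ g → Genus D g × 2 ℕ.* g ≡ (p ℕ.^ d ℕ.∸ 1) ℕ.* (p ℕ.^ e ℕ.∸ 2)
    genus = from (half d) (half e)
      where
      from : (∃ λ t → p ℕ.^ d ≡ 1 ℕ.+ 2 ℕ.* t) → (∃ λ s → p ℕ.^ e ≡ 1 ℕ.+ 2 ℕ.* s) →
             ∃ λ g → Genus D g × 2 ℕ.* g ≡ (p ℕ.^ d ℕ.∸ 1) ℕ.* (p ℕ.^ e ℕ.∸ 2)
      from (t , pᵈ) (s , pᵉ) = t ℕ.* (p ℕ.^ e ℕ.∸ 2) ,
        (p ℕ.^ e , p ℕ.^ d , p ℕ.^ d , black-cycles C , black-cycles (swap-coordinates C) , face-cycles d≤e C ,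
          trans (subst₂ (λ m n → n ℕ.+ m ℕ.+ m ℕ.+ 2 ℕ.* (t ℕ.* (n ℕ.∸ 2)) ≡ 2 ℕ.+ m ℕ.* n) (sym pᵈ) (sym pᵉ) (euler t s t≤s))
            (cong (2 ℕ.+_) (sym (edge-count d≤e C)))) ,
        trans (sym (ℕ.*-assoc 2 t (p ℕ.^ e ℕ.∸ 2))) (cong (ℕ._* (p ℕ.^ e ℕ.∸ 2)) (sym (cong (ℕ._∸ 1) pᵈ)))
        where
        t≤s : t ℕ.≤ s
        t≤s = ℕ.*-cancelˡ-≤ 2 (ℕ.s≤s⁻¹ (subst₂ ℕ._≤_ pᵈ pᵉ (ℕ.^-monoʳ-≤ p d≤e)))

  -- The multipliers as invariants of the dessin

  module _ {d e r s : ℕ} where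

    -- The equations express b a = aʳ bˢ, applied to the base edge, in the two coordinates.
    record Relation (α β : ℕ) : Set where
      field
        α<  : α ℕ.< p ℕ.^ e
        β<  : β ℕ.< p ℕ.^ d
        α≡0 : + α ≡ 0ℤ [ P ]
        β≡0 : + β ≡ 0ℤ [ P ]
        X≡  : geo (1ℤ + + α) r ≡ 1ℤ + + β [ P ^ d ]
        Y≡  : (1ℤ + + α * (1ℤ + + β)) * geo (1ℤ + + β) s ≡ 1ℤ [ P ^ e ]

      L≡1 : 1ℤ + + α ≡ 1ℤ [ P ]
      L≡1 = +-congˡ 1ℤ α≡0

      M≡1 : 1ℤ + + β ≡ 1ℤ [ P ]
      M≡1 = +-congˡ 1ℤ β≡0

      r≡1 : 1 ℕ.≤ d → + r ≡ 1ℤ [ P ]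
      r≡1 1≤d = ≡-trans (≡-sym (geo≡ r L≡1)) (≡-trans (modP⁻ 0 (^-weaken 1≤d X≡)) M≡1)

      s≡1 : 1 ℕ.≤ e → + s ≡ 1ℤ [ P ]
      s≡1 1≤e = comb₃ 1ℤ (- (geo (1ℤ + + β) s * (1ℤ + + β))) -1ℤ (modP⁻ 0 (^-weaken 1≤e Y≡)) α≡0 (geo≡ s M≡1)
        (lem (+ s) (+ α) (1ℤ + + β) (geo (1ℤ + + β) s))
        where
        lem : ∀ s α M g → s - 1ℤ ≡ 1ℤ * ((1ℤ + α * M) * g - 1ℤ) + - (g * M) * (α - 0ℤ) + -1ℤ * (g - s)
        lem = solve-∀

    module _ {α β α′ β′ : ℕ} (R : Relation α β) (R′ : Relation α′ β′) where
      private
        module R = Relation R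
        module R′ = Relation R′
        L = 1ℤ + + α
        L′ = 1ℤ + + α′
        M = 1ℤ + + β
        M′ = 1ℤ + + β′

      -- One power of p is gained because the exponents r and s are 1 modulo p.
      geo-step : ∀ {L L′} k m → 1 ℕ.≤ k → + m ≡ 1ℤ [ P ] → L ≡ 1ℤ [ P ] → L′ ≡ 1ℤ [ P ] → L ≡ L′ [ P ^ k ] →
                 geo L m ≡ geo L′ m [ P ^ suc k ]
      geo-step {L} {L′} k m 1≤k m≡1 L≡1 L′≡1 L≡L′ = comb₁ 1ℤ
        (subst (λ n → geo L m - geo L′ m ≡ geo L 1 - geo L′ 1 [ n ]) (*-comm (P ^ k) P)
          (geo-difference-cong (P ^ k) m 1 L≡1 L′≡1 L≡L′ m≡1))
        (lem (geo L m) (geo L′ m) L L′)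
        where
        lem : ∀ g g′ L L′ → g - g′ ≡ 1ℤ * ((g - g′) - ((1ℤ + L * 0ℤ) - (1ℤ + L′ * 0ℤ)))
        lem = solve-∀

      β-step : ∀ k → 1 ℕ.≤ k → + α ≡ + α′ [ P ^ k ] → + β ≡ + β′ [ P ^ k ] → + β ≡ + β′ [ P ^ suc k ]
      β-step k 1≤k α≡ β≡ with suc k ℕ.≤? d
      ... | no k≮d = ≡⇒≡[] (cong +_ (residue-unique d R.β< R′.β< (^-weaken (ℕ.s≤s⁻¹ (ℕ.≰⇒> k≮d)) β≡)))
      ... | yes k<d = comb₃ 1ℤ -1ℤ 1ℤ
        (geo-step k r 1≤k (R.r≡1 (ℕ.≤-trans 1≤k (ℕ.<⇒≤ k<d))) R.L≡1 R′.L≡1 (+-congˡ 1ℤ α≡))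
        (^-weaken k<d R.X≡) (^-weaken k<d R′.X≡) (lem (+ β) (+ β′) (geo L r) (geo L′ r))
        where
        lem : ∀ β β′ g g′ → β - β′ ≡ 1ℤ * (g - g′) + -1ℤ * (g - (1ℤ + β)) + 1ℤ * (g′ - (1ℤ + β′))
        lem = solve-∀

      α-step : ∀ k → 1 ℕ.≤ k → + α ≡ + α′ [ P ^ k ] → + β ≡ + β′ [ P ^ suc k ] → + α ≡ + α′ [ P ^ suc k ]
      α-step k 1≤k α≡ β≡ with suc k ℕ.≤? e
      ... | no k≮e = ≡⇒≡[] (cong +_ (residue-unique e R.α< R′.α< (^-weaken (ℕ.s≤s⁻¹ (ℕ.≰⇒> k≮e)) α≡)))
      ... | yes k<e = cancel (suc k) (*-unit R.M≡1 G≡1) (comb₃ 1ℤ (- (1ℤ + + α′ * M)) (- (+ α′ * geo M′ s))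
          products≡ G≡G′ (+-congˡ 1ℤ β≡) (lem (+ α) (+ α′) M M′ (geo M s) (geo M′ s)))
        where
        G≡G′ : geo M s ≡ geo M′ s [ P ^ suc k ]
        G≡G′ = geo-step k s 1≤k (R.s≡1 (ℕ.≤-trans 1≤k (ℕ.<⇒≤ k<e))) R.M≡1 R′.M≡1 (+-congˡ 1ℤ (^-weaken (ℕ.n≤1+n k) β≡))
        G≡1 : geo M s ≡ 1ℤ [ P ]
        G≡1 = ≡-trans (geo≡ s R.M≡1) (R.s≡1 (ℕ.≤-trans 1≤k (ℕ.<⇒≤ k<e)))
        products≡ : (1ℤ + + α * M) * geo M s ≡ (1ℤ + + α′ * M′) * geo M′ s [ P ^ suc k ]
        products≡ = ^-weaken k<e (≡-trans R.Y≡ (≡-sym R′.Y≡))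
        lem : ∀ α α′ M M′ G G′ → M * G * α - M * G * α′ ≡
              1ℤ * ((1ℤ + α * M) * G - (1ℤ + α′ * M′) * G′) + - (1ℤ + α′ * M) * (G - G′) + - (α′ * G′) * (M - M′)
        lem = solve-∀

      -- `X≡` yields β modulo pᵏ⁺¹ from α modulo pᵏ, and `Y≡` then yields α modulo pᵏ⁺¹ from β
      -- modulo pᵏ⁺¹; once k reaches d or e, the respective multiplier is already known completely.
      agree : ∀ k → + α ≡ + α′ [ P ^ suc k ] × + β ≡ + β′ [ P ^ suc k ]
      agree zero = modP (≡-trans R.α≡0 (≡-sym R′.α≡0)) , modP (≡-trans R.β≡0 (≡-sym R′.β≡0))
      agree (suc k) = from (agree k)
        where
        from : + α ≡ + α′ [ P ^ suc k ] × + β ≡ + β′ [ P ^ suc k ] → + α ≡ + α′ [ P ^ suc (suc k) ] × + β ≡ + β′ [ P ^ suc (suc k) ]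
        from (α≡ , β≡) = let β≡′ = β-step (suc k) (ℕ.s≤s ℕ.z≤n) α≡ β≡ in α-step (suc k) (ℕ.s≤s ℕ.z≤n) α≡ β≡′ , β≡′

      unique : α ≡ α′ × β ≡ β′
      unique = residue-unique e R.α< R′.α< (^-weaken (ℕ.n≤1+n e) (proj₁ (agree e))) ,
               residue-unique d R.β< R′.β< (^-weaken (ℕ.n≤1+n d) (proj₂ (agree d)))

    module _ {α β : ℕ} {D : Dessin} {x₀ : Fin (N D)} (C : Coordinates d e α β D x₀) where
      open CoordinateProperties C

      private
        ba≡ : X (b D ⟨$⟩ʳ (a D ⟨$⟩ʳ x₀)) ≡ M [ P ^ d ] × Y (b D ⟨$⟩ʳ (a D ⟨$⟩ʳ x₀)) ≡ 1ℤ [ P ^ e ]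
        ba≡ = comb₃ 1ℤ M (M * L) (X-b (a D ⟨$⟩ʳ x₀)) (X-a x₀) X-base
                (lem (X (b D ⟨$⟩ʳ (a D ⟨$⟩ʳ x₀))) (X (a D ⟨$⟩ʳ x₀)) (X x₀) L M) ,
              comb₃ 1ℤ M (M * L) (Y-b (a D ⟨$⟩ʳ x₀)) (Y-a x₀) Y-base
                (lem′ (Y (b D ⟨$⟩ʳ (a D ⟨$⟩ʳ x₀))) (Y (a D ⟨$⟩ʳ x₀)) (Y x₀) L M)
          where
          lem : ∀ z y x L M → z - M ≡ 1ℤ * (z - M * y) + M * (y - (1ℤ + L * x)) + M * L * (x - 0ℤ)
          lem = solve-∀
          lem′ : ∀ z y x L M → z - 1ℤ ≡ 1ℤ * (z - (1ℤ + M * y)) + M * (y - L * x) + M * L * (x - 0ℤ)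
          lem′ = solve-∀

      relation : α ℕ.< p ℕ.^ e → β ℕ.< p ℕ.^ d →
                 b D ⟨$⟩ʳ (a D ⟨$⟩ʳ x₀) ≡ iter (a D) r (iter (b D) s x₀) → Relation α β
      relation α< β< eq = record
        { α< = α< ; β< = β< ; α≡0 = α≡0 ; β≡0 = β≡0
        ; X≡ = X≡
        ; Y≡ = ≡-trans (*-cong (≡-sym (≡-trans (≡⇒≡[] (^-geo (+ α) r)) (+-congˡ 1ℤ (α-scale X≡)))) (≡-refl {geo M s}))
                 (≡-trans (≡-sym (Y-at C r s)) (≡-trans (≡⇒≡[] (cong Y (sym eq))) (proj₂ ba≡)))
        }
        where
        X≡ : geo L r ≡ M [ P ^ d ]
        X≡ = ≡-trans (≡-sym (X-at C r s)) (≡-trans (≡⇒≡[] (cong X (sym eq))) (proj₁ ba≡))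

  module _ {d e α β α′ β′ : ℕ} {D : Dessin} {x₀ : Fin (N D)}
    (C : Coordinates d e α β D x₀) (C′ : Coordinates d e α′ β′ D x₀) where
    open Coordinates C

    -- The exponents r and s are found in the first coordinate system, but b a x₀ = aʳ bˢ x₀ speaks
    -- only of the permutations and so serves both systems.
    multipliers-unique : α ℕ.< p ℕ.^ e → β ℕ.< p ℕ.^ d → α′ ℕ.< p ℕ.^ e → β′ ℕ.< p ℕ.^ d → α ≡ α′ × β ≡ β′
    multipliers-unique α< β< α′< β′< = from (element-at C (X ba) (Y ba))
      where
      ba = b D ⟨$⟩ʳ (a D ⟨$⟩ʳ x₀)
      from : (∃₂ λ r s → X (iter (a D) r (iter (b D) s x₀)) ≡ X ba [ P ^ d ] × Y (iter (a D) r (iter (b D) s x₀)) ≡ Y ba [ P ^ e ]) →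
             α ≡ α′ × β ≡ β′
      from (r , s , X≡ , Y≡) = unique (relation {r = r} {s} C α< β< eq) (relation {r = r} {s} C′ α′< β′< eq)
        where
        eq : ba ≡ iter (a D) r (iter (b D) s x₀)
        eq = sym (injective X≡ Y≡)

  -- Construction of the dessin with given multipliers

  reach-trans : ∀ {n} {a b : Permutation′ n} {x y z} → Reach a b x y → Reach a b y z → Reach a b x z
  reach-trans r here       = r
  reach-trans r (stepa s)  = stepa (reach-trans r s)
  reach-trans r (stepb s)  = stepb (reach-trans r s)
  reach-trans r (stepa⁻ s) = stepa⁻ (reach-trans r s)
  reach-trans r (stepb⁻ s) = stepb⁻ (reach-trans r s)

  reach-sym : ∀ {n} {a b : Permutation′ n} {x y} → Reach a b x y → Reach a b y x
  reach-sym here                          = here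
  reach-sym {a = a} {b} (stepa {y = y} r)  = reach-trans (subst (Reach a b _) (inverseˡ a) (stepa⁻ here)) (reach-sym r)
  reach-sym {a = a} {b} (stepb {y = y} r)  = reach-trans (subst (Reach a b _) (inverseˡ b) (stepb⁻ here)) (reach-sym r)
  reach-sym {a = a} {b} (stepa⁻ {y = y} r) = reach-trans (subst (Reach a b _) (inverseʳ a) (stepa here)) (reach-sym r)
  reach-sym {a = a} {b} (stepb⁻ {y = y} r) = reach-trans (subst (Reach a b _) (inverseʳ b) (stepb here)) (reach-sym r)

  reach-a^ : ∀ {n} {a b : Permutation′ n} {x y} k → Reach a b x y → Reach a b x (iter a k y)
  reach-a^ zero    r = r
  reach-a^ (suc k) r = stepa (reach-a^ k r)

  reach-b^ : ∀ {n} {a b : Permutation′ n} {x y} k → Reach a b x y → Reach a b x (iter b k y)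
  reach-b^ zero    r = r
  reach-b^ (suc k) r = stepb (reach-b^ k r)

  module _ (d e : ℕ) where

    private
      V = Fin (p ℕ.^ d ℕ.* p ℕ.^ e)

      X Y : V → ℤ
      X v = + toℕ (proj₁ (remQuot {p ℕ.^ d} (p ℕ.^ e) v))
      Y v = + toℕ (proj₂ (remQuot {p ℕ.^ d} (p ℕ.^ e) v))

      vec : ℤ → ℤ → V
      vec x y = combine (fin d x) (fin e y)

      X-vec : ∀ x y → X (vec x y) ≡ x [ P ^ d ]
      X-vec x y = ≡-trans (≡⇒≡[] (cong (λ q → + toℕ (proj₁ q)) (Fin.remQuot-combine (fin d x) (fin e y)))) (toℕ-fin d x)

      Y-vec : ∀ x y → Y (vec x y) ≡ y [ P ^ e ]
      Y-vec x y = ≡-trans (≡⇒≡[] (cong (λ q → + toℕ (proj₂ q)) (Fin.remQuot-combine (fin d x) (fin e y)))) (toℕ-fin e y)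

      vec-injective : ∀ {v w} → X v ≡ X w [ P ^ d ] → Y v ≡ Y w [ P ^ e ] → v ≡ w
      vec-injective {v} {w} X≡ Y≡ = trans (sym (Fin.combine-remQuot {p ℕ.^ d} (p ℕ.^ e) v))
        (trans (cong₂ combine (toℕ-injective-mod d X≡) (toℕ-injective-mod e Y≡)) (Fin.combine-remQuot {p ℕ.^ d} (p ℕ.^ e) w))

      module Affine (L l₁ l₂ : ℤ) (L≡1 : L ≡ 1ℤ [ P ]) where
        to from : V → V
        to v = vec (l₁ + L * X v) (l₂ + L * Y v)
        from v = vec (inv d L * (X v - l₁)) (inv e L * (Y v - l₂))

        lem₁ : ∀ k {l x y} → y ≡ inv k L * (x - l) [ P ^ k ] → l + L * y ≡ x [ P ^ k ]
        lem₁ k {l} {x} {y} eq = comb₂ L (x - l) eq (inverse L k L≡1) (lem L l x y (inv k L))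
          where
          lem : ∀ L l x y v → l + L * y - x ≡ L * (y - v * (x - l)) + (x - l) * (L * v - 1ℤ)
          lem = solve-∀

        lem₂ : ∀ k {l x y} → y ≡ l + L * x [ P ^ k ] → inv k L * (y - l) ≡ x [ P ^ k ]
        lem₂ k {l} {x} {y} eq = comb₂ (inv k L) x eq (inverse L k L≡1) (lem L l x y (inv k L))
          where
          lem : ∀ L l x y v → v * (y - l) - x ≡ v * (y - (l + L * x)) + x * (L * v - 1ℤ)
          lem = solve-∀

        affine : Permutation′ (p ℕ.^ d ℕ.* p ℕ.^ e)
        affine = permutation to from
          (λ v → vec-injective (≡-trans (X-vec (l₁ + L * X (from v)) (l₂ + L * Y (from v))) (lem₁ d {l₁} (X-vec (inv d L * (X v - l₁)) (inv e L * (Y v - l₂)))))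
                               (≡-trans (Y-vec (l₁ + L * X (from v)) (l₂ + L * Y (from v))) (lem₁ e {l₂} (Y-vec (inv d L * (X v - l₁)) (inv e L * (Y v - l₂))))))
          (λ v → vec-injective (≡-trans (X-vec (inv d L * (X (to v) - l₁)) (inv e L * (Y (to v) - l₂))) (lem₂ d {l₁} (X-vec (l₁ + L * X v) (l₂ + L * Y v))))
                               (≡-trans (Y-vec (inv d L * (X (to v) - l₁)) (inv e L * (Y (to v) - l₂))) (lem₂ e {l₂} (Y-vec (l₁ + L * X v) (l₂ + L * Y v)))))

        X-to : ∀ v → X (affine ⟨$⟩ʳ v) ≡ l₁ + L * X v [ P ^ d ]
        X-to v = X-vec (l₁ + L * X v) (l₂ + L * Y v)

        Y-to : ∀ v → Y (affine ⟨$⟩ʳ v) ≡ l₂ + L * Y v [ P ^ e ]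
        Y-to v = Y-vec (l₁ + L * X v) (l₂ + L * Y v)

        iterate : ∀ {n} l (z : V → ℤ) → (∀ v → z (affine ⟨$⟩ʳ v) ≡ l + L * z v [ n ]) →
                  ∀ k v → z (iter affine k v) ≡ L ^ k * z v + geo L k * l [ n ]
        iterate l z z-to zero    v = ≡⇒≡[] (lem (z v) l)
          where
          lem : ∀ z l → z ≡ 1ℤ * z + 0ℤ * l
          lem = solve-∀
        iterate l z z-to (suc k) v = ≡-trans (z-to (iter affine k v))
          (comb₁ L (iterate l z z-to k v) (lem (z (iter affine k v)) (z v) L (L ^ k) (geo L k) l))
          where
          lem : ∀ w z L m g l → l + L * w - (L * m * z + (1ℤ + L * g) * l) ≡ L * (w - (m * z + g * l))
          lem = solve-∀

    module _ (α β : ℕ) (α≡0 : + α ≡ 0ℤ [ P ]) (β≡0 : + β ≡ 0ℤ [ P ])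
      (α-kills : + α * P ^ d ≡ 0ℤ [ P ^ e ]) (β-kills : + β * P ^ e ≡ 0ℤ [ P ^ d ]) where

      private
        L M : ℤ
        L = 1ℤ + + α
        M = 1ℤ + + β

        L≡1 : L ≡ 1ℤ [ P ]
        L≡1 = +-congˡ 1ℤ α≡0

        M≡1 : M ≡ 1ℤ [ P ]
        M≡1 = +-congˡ 1ℤ β≡0

        module A = Affine L 1ℤ 0ℤ L≡1
        module B = Affine M 0ℤ 1ℤ M≡1

      origin : Fin (p ℕ.^ d ℕ.* p ℕ.^ e)
      origin = vec 0ℤ 0ℤ

      private
        X-origin : X origin ≡ 0ℤ [ P ^ d ]
        X-origin = X-vec 0ℤ 0ℤ

        Y-origin : Y origin ≡ 0ℤ [ P ^ e ]
        Y-origin = Y-vec 0ℤ 0ℤ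

        reach : ∀ v → Reach A.affine B.affine origin v
        reach v = from (log d (X v) L≡1)
          where
          from : (∃ λ i → geo L i ≡ X v [ P ^ d ]) → Reach A.affine B.affine origin v
          from (i , i≡) = from′ (log e (inv e (L ^ i) * Y v) M≡1)
            where
            from′ : (∃ λ j → geo M j ≡ inv e (L ^ i) * Y v [ P ^ e ]) → Reach A.affine B.affine origin v
            from′ (j , j≡) = subst (Reach A.affine B.affine origin) (vec-injective X≡ Y≡) (reach-a^ i (reach-b^ j here))
              where
              w = iter B.affine j origin
              X≡ : X (iter A.affine i w) ≡ X v [ P ^ d ]
              X≡ = ≡-trans (A.iterate 1ℤ X A.X-to i w) (comb₃ (L ^ i) (L ^ i * M ^ j) 1ℤ (B.iterate 0ℤ X B.X-to j origin) X-origin i≡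
                (lem (L ^ i) (M ^ j) (X w) (X origin) (geo L i) (geo M j) (X v)))
                where
                lem : ∀ l m w o g g′ x → l * w + g * 1ℤ - x ≡ l * (w - (m * o + g′ * 0ℤ)) + l * m * (o - 0ℤ) + 1ℤ * (g - x)
                lem = solve-∀
              Yw : Y w ≡ inv e (L ^ i) * Y v [ P ^ e ]
              Yw = comb₃ 1ℤ (M ^ j) 1ℤ (B.iterate 1ℤ Y B.Y-to j origin) Y-origin j≡
                (lem (M ^ j) (Y w) (Y origin) (geo M j) (inv e (L ^ i) * Y v))
                where
                lem : ∀ m w o g x → w - x ≡ 1ℤ * (w - (m * o + g * 1ℤ)) + m * (o - 0ℤ) + 1ℤ * (g - x)
                lem = solve-∀
              Y≡ : Y (iter A.affine i w) ≡ Y v [ P ^ e ]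
              Y≡ = ≡-trans (A.iterate 0ℤ Y A.Y-to i w) (comb₂ (L ^ i) (Y v) Yw (inverse (L ^ i) e (^≡1 i L≡1))
                (lem (L ^ i) (Y w) (geo L i) (inv e (L ^ i)) (Y v)))
                where
                lem : ∀ l w g v y → l * w + g * 0ℤ - y ≡ l * (w - v * y) + y * (l * v - 1ℤ)
                lem = solve-∀

      model : Dessin
      model = mkDessin (p ℕ.^ d ℕ.* p ℕ.^ e) A.affine B.affine (λ v w → reach-trans (reach-sym (reach v)) (reach w))

      model-coordinates : Coordinates d e α β model origin
      model-coordinates = record
        { α≡0 = α≡0 ; β≡0 = β≡0 ; α-kills = α-kills ; β-kills = β-kills ; X = X ; Y = Y
        ; X-base = X-origin ; Y-base = Y-origin
        ; X-a = A.X-to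
        ; X-b = λ v → ≡-trans (B.X-to v) (≡⇒≡[] (+-identityˡ (M * X v)))
        ; Y-a = λ v → ≡-trans (A.Y-to v) (≡⇒≡[] (+-identityˡ (L * Y v)))
        ; Y-b = B.Y-to
        ; injective = vec-injective
        }

-- The automorphism group of a regular dessin

module DessinGroup (p h : ℕ) (p-odd : p ≡ 1 ℕ.+ 2 ℕ.* h) (p-prime : Prime p) where

  open import Data.Integer using (+_; _+_; _*_; _^_; 1ℤ)
  open import Relation.Binary.PropositionalEquality hiding ([_])
  open import Defs
  open Congruences
  open OddPrimePower p h p-odd
  open Bicyclics
  open Charts p h p-odd
  open Classify p h p-odd p-prime
  open DessinCoordinates p h p-odd using (Coordinates)

  iter-+ : ∀ {n} (σ : Permutation′ n) i j x → iter σ (i ℕ.+ j) x ≡ iter σ i (iter σ j x)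
  iter-+ σ zero    j x = refl
  iter-+ σ (suc i) j x = cong (σ ⟨$⟩ʳ_) (iter-+ σ i j x)

  iter-injective : ∀ {n} (σ : Permutation′ n) i {x y} → iter σ i x ≡ iter σ i y → x ≡ y
  iter-injective σ zero    eq = eq
  iter-injective σ (suc i) eq = iter-injective σ i (trans (sym (inverseˡ σ)) (trans (cong (σ ⟨$⟩ˡ_) eq) (inverseˡ σ)))

  iter-multiple : ∀ {n} (σ : Permutation′ n) k {x} → iter σ k x ≡ x → ∀ q → iter σ (q ℕ.* k) x ≡ x
  iter-multiple σ k     eq zero    = refl
  iter-multiple σ k {x} eq (suc q) = trans (iter-+ σ k (q ℕ.* k) x) (trans (cong (iter σ k) (iter-multiple σ k eq q)) eq)

  iter-% : ∀ {n} (σ : Permutation′ n) k .⦃ _ : ℕ.NonZero k ⦄ {x} → iter σ k x ≡ x → ∀ i → iter σ i x ≡ iter σ (i ℕ.% k) x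
  iter-% σ k {x} eq i = trans (cong (λ t → iter σ t x) (ℕ.m≡m%n+[m/n]*n i k))
    (trans (iter-+ σ (i ℕ.% k) (i ℕ./ k ℕ.* k) x) (cong (iter σ (i ℕ.% k)) (iter-multiple σ k eq (i ℕ./ k))))

  module _ {n m : ℕ} (σ : Permutation′ n) (x : Fin n) (label : Fin n → Fin m)
    (label-injective : ∀ k l → label (iter σ k x) ≡ label (iter σ l x) → iter σ k x ≡ iter σ l x)
    (label-surjective : ∀ i → ∃ λ k → label (iter σ k x) ≡ i) where

    private
      minimal : ∀ k → 0 ℕ.< k → iter σ k x ≡ x → m ℕ.≤ k
      minimal k@(suc _) _ eq = Fin.injective⇒≤ {f = f} f-injective
        where
        f : Fin m → Fin k
        f i = Fin.fromℕ< (ℕ.m%n<n (proj₁ (label-surjective i)) k)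
        at : ∀ i → label (iter σ (toℕ (f i)) x) ≡ i
        at i = trans (cong (λ t → label (iter σ t x)) (Fin.toℕ-fromℕ< (ℕ.m%n<n (proj₁ (label-surjective i)) k)))
          (trans (cong label (sym (iter-% σ k eq (proj₁ (label-surjective i))))) (proj₂ (label-surjective i)))
        f-injective : ∀ {i j} → f i ≡ f j → i ≡ j
        f-injective {i} {j} e = trans (sym (at i)) (trans (cong (λ t → label (iter σ (toℕ t) x)) e) (at j))

    -- The m labels name the points of the cycle bijectively. A return time below m could not
    -- produce all labels, and two of the first m + 1 iterates coincide; so the first return is at
    -- m.
    orbit-period : iter σ m x ≡ x
    orbit-period with Fin.pigeonhole (ℕ.n<1+n m) (λ k → label (iter σ (toℕ k) x))
    ... | i , j , i<j , eq = subst (λ k → iter σ k x ≡ x) (ℕ.≤-antisym r≤m (minimal r (ℕ.m<n⇒0<n∸m i<j) period)) period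
      where
      r = toℕ j ℕ.∸ toℕ i
      r≤m : r ℕ.≤ m
      r≤m = ℕ.≤-trans (ℕ.m∸n≤m (toℕ j) (toℕ i)) (ℕ.s≤s⁻¹ (Fin.toℕ<n j))
      period : iter σ r x ≡ x
      period = iter-injective σ (toℕ i) (trans (sym (iter-+ σ (toℕ i) r x))
        (trans (cong (λ t → iter σ t x) (ℕ.m+[n∸m]≡n (ℕ.<⇒≤ i<j))) (sym (label-injective (toℕ i) (toℕ j) eq))))

    orbit-divides : ⦃ _ : ℕ.NonZero m ⦄ → ∀ k → iter σ k x ≡ x → m ∣ k
    orbit-divides k eq = from (k ℕ.% m) refl
      where
      from : ∀ r → k ℕ.% m ≡ r → m ∣ k
      from zero    e = divides (k ℕ./ m) (trans (ℕ.m≡m%n+[m/n]*n k m) (cong (ℕ._+ k ℕ./ m ℕ.* m) e))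
      from (suc r) e = contradiction (minimal (k ℕ.% m) (subst (0 ℕ.<_) (sym e) (ℕ.s≤s ℕ.z≤n))
        (trans (sym (iter-% σ m orbit-period k)) eq)) (ℕ.<⇒≱ (ℕ.m%n<n k m))

  module _ (D : Dessin) (R : Regular D) (x₀ : Fin (N D)) where

    private
      act : Fin (N D) → Fin (N D) → Fin (N D)
      act y x = proj₁ (proj₁ (R x₀ y)) ⟨$⟩ʳ x

      act-base : ∀ y → act y x₀ ≡ y
      act-base y = proj₂ (R x₀ y)

      act-a : ∀ y x → act y (a D ⟨$⟩ʳ x) ≡ a D ⟨$⟩ʳ act y x
      act-a y = proj₁ (proj₂ (proj₁ (R x₀ y)))

      act-b : ∀ y x → act y (b D ⟨$⟩ʳ x) ≡ b D ⟨$⟩ʳ act y x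
      act-b y = proj₂ (proj₂ (proj₁ (R x₀ y)))

      Equivariant : (Fin (N D) → Fin (N D)) → Permutation′ (N D) → Set
      Equivariant f σ = ∀ x → f (σ ⟨$⟩ʳ x) ≡ σ ⟨$⟩ʳ f x

      equivariant⁻ : ∀ {f} σ → Equivariant f σ → ∀ x → f (σ ⟨$⟩ˡ x) ≡ σ ⟨$⟩ˡ f x
      equivariant⁻ {f} σ E x = trans (sym (inverseˡ σ))
        (cong (σ ⟨$⟩ˡ_) (trans (sym (E (σ ⟨$⟩ˡ x))) (cong f (inverseʳ σ))))

      semiregular : ∀ {f g} → Equivariant f (a D) → Equivariant f (b D) → Equivariant g (a D) → Equivariant g (b D) →
                    f x₀ ≡ g x₀ → ∀ x → f x ≡ g x
      semiregular {f} {g} fa fb ga gb base x = go (transitive D x₀ x)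
        where
        go : ∀ {x} → Reach (a D) (b D) x₀ x → f x ≡ g x
        go here                 = base
        go (stepa {y = y} r)  = trans (fa y) (trans (cong (a D ⟨$⟩ʳ_) (go r)) (sym (ga y)))
        go (stepb {y = y} r)  = trans (fb y) (trans (cong (b D ⟨$⟩ʳ_) (go r)) (sym (gb y)))
        go (stepa⁻ {y = y} r) = trans (equivariant⁻ {f} (a D) fa y) (trans (cong (a D ⟨$⟩ˡ_) (go r)) (sym (equivariant⁻ {g} (a D) ga y)))
        go (stepb⁻ {y = y} r) = trans (equivariant⁻ {f} (b D) fb y) (trans (cong (b D ⟨$⟩ˡ_) (go r)) (sym (equivariant⁻ {g} (b D) gb y)))

    -- The edge x stands for the automorphism taking x₀ to x; left multiplication by a x₀ is then the rotation a itself.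
    G : Monoid 0ℓ 0ℓ
    G = record
      { Carrier  = Fin (N D)
      ; _≈_      = _≡_
      ; _∙_      = λ x y → act y x
      ; ε        = x₀
      ; isMonoid = record
        { isSemigroup = record
          { isMagma = record { isEquivalence = isEquivalence ; ∙-cong = cong₂ (λ x y → act y x) }
          ; assoc   = λ x y z → semiregular {λ x → act z (act y x)} {act (act z y)}
              (λ x → trans (cong (act z) (act-a y x)) (act-a z (act y x)))
              (λ x → trans (cong (act z) (act-b y x)) (act-b z (act y x)))
              (act-a (act z y)) (act-b (act z y))
              (trans (cong (act z) (act-base y)) (sym (act-base (act z y)))) x
          }
        ; identity = act-base , semiregular {act x₀} {λ x → x} (act-a x₀) (act-b x₀) (λ _ → refl) (λ _ → refl) (act-base x₀)
        }
      }

    open Monoid G using (_∙_; assoc; identityʳ; identityˡ)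
    open Powers G using (_·_)

    private
      A B : Fin (N D)
      A = a D ⟨$⟩ʳ x₀
      B = b D ⟨$⟩ʳ x₀

      A∙ : ∀ y → A ∙ y ≡ a D ⟨$⟩ʳ y
      A∙ y = trans (act-a y x₀) (cong (a D ⟨$⟩ʳ_) (act-base y))

      B∙ : ∀ y → B ∙ y ≡ b D ⟨$⟩ʳ y
      B∙ y = trans (act-b y x₀) (cong (b D ⟨$⟩ʳ_) (act-base y))

      power : ∀ {g σ} → (∀ y → g ∙ y ≡ σ ⟨$⟩ʳ y) → ∀ i y → i · g ∙ y ≡ iter σ i y
      power         g∙ zero    y = identityˡ y
      power {g} {σ} g∙ (suc i) y = trans (assoc g (i · g) y) (trans (g∙ (i · g ∙ y)) (cong (σ ⟨$⟩ʳ_) (power g∙ i y)))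

      A^ : ∀ i y → i · A ∙ y ≡ iter (a D) i y
      A^ = power A∙

      B^ : ∀ i y → i · B ∙ y ≡ iter (b D) i y
      B^ = power B∙

      A^₀ : ∀ i → i · A ≡ iter (a D) i x₀
      A^₀ i = trans (sym (identityʳ (i · A))) (A^ i x₀)

      B^₀ : ∀ i → i · B ≡ iter (b D) i x₀
      B^₀ i = trans (sym (identityʳ (i · B))) (B^ i x₀)

    module _ {m n : ℕ} ⦃ _ : ℕ.NonZero m ⦄ ⦃ _ : ℕ.NonZero n ⦄ (K : IsCompleteBipartite D n m) where

      private
        β = proj₁ K
        ω = proj₁ (proj₂ K)
        β⇔ = proj₁ (proj₂ (proj₂ K))
        ω⇔ = proj₁ (proj₂ (proj₂ (proj₂ K)))
        separated = proj₁ (proj₂ (proj₂ (proj₂ (proj₂ K))))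
        edge = proj₂ (proj₂ (proj₂ (proj₂ (proj₂ K))))

        β-a : ∀ k → β x₀ ≡ β (iter (a D) k x₀)
        β-a k = Equivalence.from (β⇔ x₀ (iter (a D) k x₀)) (k , refl)

        ω-b : ∀ k → ω x₀ ≡ ω (iter (b D) k x₀)
        ω-b k = Equivalence.from (ω⇔ x₀ (iter (b D) k x₀)) (k , refl)

        ω-injective : ∀ k l → ω (iter (a D) k x₀) ≡ ω (iter (a D) l x₀) → iter (a D) k x₀ ≡ iter (a D) l x₀
        ω-injective k l = separated (iter (a D) k x₀) (iter (a D) l x₀) (trans (sym (β-a k)) (β-a l))

        β-injective : ∀ k l → β (iter (b D) k x₀) ≡ β (iter (b D) l x₀) → iter (b D) k x₀ ≡ iter (b D) l x₀
        β-injective k l eq = separated (iter (b D) k x₀) (iter (b D) l x₀) eq (trans (sym (ω-b k)) (ω-b l))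

        ω-surjective : ∀ i → ∃ λ k → ω (iter (a D) k x₀) ≡ i
        ω-surjective i = let y , β≡ , ω≡ = edge (β x₀) i ; k , eq = Equivalence.to (β⇔ x₀ y) (sym β≡) in
          k , trans (cong ω eq) ω≡

        β-surjective : ∀ i → ∃ λ k → β (iter (b D) k x₀) ≡ i
        β-surjective i = let y , β≡ , ω≡ = edge i (ω x₀) ; k , eq = Equivalence.to (ω⇔ x₀ y) (sym ω≡) in
          k , trans (cong β eq) β≡

      -- An edge is determined by its ends, so if aⁱ x₀ = bʲ x₀, this edge shares both ends with x₀
      -- and equals it: the intersection is trivial. Factorisation uses the edge y joining the black
      -- end of g to the white end of x₀: y is bʲ x₀ and g is aⁱ y.
      bicyclic : Bicyclic G m n
      bicyclic = record
        { a = A ; b = B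
        ; a-order = trans (A^₀ m) (orbit-period (a D) x₀ ω ω-injective ω-surjective)
        ; b-order = trans (B^₀ n) (orbit-period (b D) x₀ β β-injective β-surjective)
        ; disjoint = λ i j eq → disjoint i j (trans (sym (A^₀ i)) (trans eq (B^₀ j)))
        ; factor = λ g →
            let y , β≡ , ω≡ = edge (β g) (ω x₀)
                j , y≡ = Equivalence.to (ω⇔ x₀ y) (sym ω≡)
                i , g≡ = Equivalence.to (β⇔ y g) β≡
            in i , j , sym (trans (A^ i (j · B)) (trans (cong (iter (a D) i) (trans (B^₀ j) y≡)) g≡))
        }
        where
        disjoint : ∀ i j → iter (a D) i x₀ ≡ iter (b D) j x₀ → m ∣ i × n ∣ j
        disjoint i j eq =
          orbit-divides (a D) x₀ ω ω-injective ω-surjective i a^i ,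
          orbit-divides (b D) x₀ β β-injective β-surjective j (trans (sym eq) a^i)
          where
          a^i : iter (a D) i x₀ ≡ x₀
          a^i = separated (iter (a D) i x₀) x₀ (sym (β-a i)) (trans (cong ω eq) (sym (ω-b j)))

  module _ {G : Monoid 0ℓ 0ℓ} {d e : ℕ} {B : Bicyclic G (p ℕ.^ d) (p ℕ.^ e)} (C : Chart d e B) where
    private instance
      m-nonZero : ℕ.NonZero (p ℕ.^ d)
      m-nonZero = p^-nonZero d
      n-nonZero : ℕ.NonZero (p ℕ.^ e)
      n-nonZero = p^-nonZero e
    open Monoid G using (_≈_; _∙_; ∙-cong) renaming (trans to ≈-trans; sym to ≈-sym)
    open BicyclicProperties B renaming (a to x; b to y)
    open ChartProperties C using (X; Y; L; M; L≡1; M≡1; α; α-kills; X-cong; Y-cong; X-factor; Y-factor)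

    -- X determines the exponent of a and, through `α-kills`, also Lⁱ modulo pᵉ; dividing Y by it
    -- gives the exponent of b.
    chart-injective : ∀ {g h} → X g ≡ X h [ P ^ d ] → Y g ≡ Y h [ P ^ e ] → g ≈ h
    chart-injective {g} {h} X≡ Y≡ = from (factor g) (factor h)
      where
      from : (∃₂ λ i j → g ≈ i · x ∙ j · y) → (∃₂ λ i j → h ≈ i · x ∙ j · y) → g ≈ h
      from (i , j , g≈) (i′ , j′ , h≈) = ≈-trans g≈ (≈-trans (∙-cong
          (a-mod {d = d} {e} B i i′ (geo-injective d {i} {i′} L≡1 i≡)) (b-mod {d = d} {e} B j j′ (geo-injective e {j} {j′} M≡1 j≡))) (≈-sym h≈))
        where
        i≡ : geo L i ≡ geo L i′ [ P ^ d ]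
        i≡ = ≡-trans (≡-sym (X-factor i j)) (≡-trans (X-cong (≈-sym g≈)) (≡-trans X≡ (≡-trans (X-cong h≈) (X-factor i′ j′))))
        L^≡ : L ^ i′ ≡ L ^ i [ P ^ e ]
        L^≡ = ≡-trans (≡⇒≡[] (^-geo (+ α) i′)) (≡-trans (+-congˡ 1ℤ (scale-kills (+ α) α-kills (≡-sym i≡)))
          (≡⇒≡[] (sym (^-geo (+ α) i))))
        j≡ : geo M j ≡ geo M j′ [ P ^ e ]
        j≡ = cancel {L ^ i} e (^≡1 i L≡1) (≡-trans (≡-sym (Y-factor i j)) (≡-trans (Y-cong (≈-sym g≈))
          (≡-trans Y≡ (≡-trans (Y-cong h≈) (≡-trans (Y-factor i′ j′) (*-cong L^≡ (≡-refl {geo M j′})))))))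

  record Classified (d e : ℕ) (D : Dessin) (x₀ : Fin (N D)) : Set where
    field
      α β         : ℕ
      α<          : α ℕ.< p ℕ.^ e
      β<          : β ℕ.< p ℕ.^ d
      coordinates : Coordinates d e α β D x₀

  classified : ∀ {d e} (D : Dessin) → Regular D → IsCompleteBipartite D (p ℕ.^ e) (p ℕ.^ d) → ∀ x₀ → Classified d e D x₀
  classified {d} {e} D R K x₀ = from (bicyclic D R x₀ ⦃ p^-nonZero d ⦄ ⦃ p^-nonZero e ⦄ K) refl refl
    where
    open Monoid (G D R x₀) using (_∙_)
    A∙ : ∀ x → (a D ⟨$⟩ʳ x₀) ∙ x ≡ a D ⟨$⟩ʳ x
    A∙ x = trans (proj₁ (proj₂ (proj₁ (R x₀ x))) x₀) (cong (a D ⟨$⟩ʳ_) (proj₂ (R x₀ x)))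
    B∙ : ∀ x → (b D ⟨$⟩ʳ x₀) ∙ x ≡ b D ⟨$⟩ʳ x
    B∙ x = trans (proj₂ (proj₂ (proj₁ (R x₀ x))) x₀) (cong (b D ⟨$⟩ʳ_) (proj₂ (R x₀ x)))
    from : (B : Bicyclic (G D R x₀) (p ℕ.^ d) (p ℕ.^ e)) → Bicyclic.a B ≡ a D ⟨$⟩ʳ x₀ → Bicyclic.b B ≡ b D ⟨$⟩ʳ x₀ → Classified d e D x₀
    from B a≡ b≡ = from′ (chart d e B)
      where
      from′ : Chart d e B → Classified d e D x₀
      from′ C = record
        { α = α ; β = β ; α< = α< ; β< = β<
        ; coordinates = record
          { α≡0 = α≡0 ; β≡0 = β≡0 ; α-kills = α-kills ; β-kills = β-kills ; X = X ; Y = Y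
          ; X-base = X-ε ; Y-base = Y-ε
          ; X-a = λ x → ≡-trans (X-cong (a∙ x)) (X-a x)
          ; X-b = λ x → ≡-trans (X-cong (b∙ x)) (X-b x)
          ; Y-a = λ x → ≡-trans (Y-cong (a∙ x)) (Y-a x)
          ; Y-b = λ x → ≡-trans (Y-cong (b∙ x)) (Y-b x)
          ; injective = chart-injective {d = d} {e} C
          }
        }
        where
        open Chart {d = d} {e} C
        a∙ : ∀ x → a D ⟨$⟩ʳ x ≡ Bicyclic.a B ∙ x
        a∙ x = trans (sym (A∙ x)) (cong (_∙ x) (sym a≡))
        b∙ : ∀ x → b D ⟨$⟩ʳ x ≡ Bicyclic.b B ∙ x
        b∙ x = trans (sym (B∙ x)) (cong (_∙ x) (sym b≡))

-- Counting admissible multipliers up to reciprocity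

module Counting (p h : ℕ) (p-odd : p ≡ 1 ℕ.+ 2 ℕ.* h) (p-prime : Prime p) where

  import Data.Nat.Tactic.RingSolver as ℕSolver
  open import Data.Integer as ℤ using (ℤ; +_; _+_; _*_; _^_; 0ℤ)
  import Data.Integer.Properties as ℤ
  open import Relation.Binary.PropositionalEquality hiding ([_])
  open import Defs
  open Congruences
  open OddPrimePower p h p-odd
  open DessinCoordinates p h p-odd
  open DessinGroup p h p-odd p-prime

  swap-iso : ∀ D E → Iso D E → Iso (reciprocal D) (reciprocal E)
  swap-iso D E (φ , φ-a , φ-b) = φ , φ-b , φ-a

  swap-isoˡ : ∀ D E → Iso (reciprocal D) E → Iso D (reciprocal E)
  swap-isoˡ D E (φ , φ-a , φ-b) = φ , φ-b , φ-a

  swap-isoʳ : ∀ D E → Iso (reciprocal D) (reciprocal E) → Iso D E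
  swap-isoʳ D E (φ , φ-a , φ-b) = φ , φ-b , φ-a

  same-pair-reciprocal : ∀ D E → SamePair (reciprocal D) E → SamePair D E
  same-pair-reciprocal D E (inj₁ i) = inj₂ (swap-isoˡ D E i)
  same-pair-reciprocal D E (inj₂ i) = inj₁ (swap-isoʳ D E i)

  swap-regular : ∀ D → Regular D → Regular (reciprocal D)
  swap-regular D R x y = let i , eq = R x y in swap-iso D D i , eq

  swap-bipartite : ∀ D {m n} → IsCompleteBipartite D m n → IsCompleteBipartite (reciprocal D) n m
  swap-bipartite D (β , ω , β⇔ , ω⇔ , separated , edge) = ω , β , ω⇔ , β⇔ , (λ x y e e′ → separated x y e′ e) ,
    λ i j → let x , e , e′ = edge j i in x , e′ , e

  record Admissible (d e α β : ℕ) : Set where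
    field
      α<      : α ℕ.< p ℕ.^ e
      β<      : β ℕ.< p ℕ.^ d
      α≡0     : + α ≡ 0ℤ [ P ]
      β≡0     : + β ≡ 0ℤ [ P ]
      α-kills : + α * P ^ d ≡ 0ℤ [ P ^ e ]
      β-kills : + β * P ^ e ≡ 0ℤ [ P ^ d ]

  modelOf : ∀ {d e α β} → Admissible d e α β → Dessin
  modelOf {d} {e} {α} {β} A = model d e α β α≡0 β≡0 α-kills β-kills
    where open Admissible A

  modelOf-coordinates : ∀ {d e α β} (A : Admissible d e α β) → ∃ λ x₀ → Coordinates d e α β (modelOf A) x₀
  modelOf-coordinates {d} {e} {α} {β} A = origin d e α β α≡0 β≡0 α-kills β-kills , model-coordinates d e α β α≡0 β≡0 α-kills β-kills
    where open Admissible A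

  module _ {d e : ℕ} (d≤e : d ℕ.≤ e) where

    -- Rebased at the image of x₀ and pulled back, the coordinates of E become a second system on D
    -- with the same base edge, and uniqueness of multipliers applies.
    iso⇒same : ∀ {α β α′ β′ D E} {x₀ : Fin (N D)} {y₀ : Fin (N E)} → Admissible d e α β → Admissible d e α′ β′ →
               Coordinates d e α β D x₀ → Coordinates d e α′ β′ E y₀ → Iso D E → α ≡ α′ × β ≡ β′
    iso⇒same {x₀ = x₀} A A′ C C′ φ = multipliers-unique C
      (pull-back φ refl (Rebase.rebase d≤e C′ (proj₁ φ ⟨$⟩ʳ x₀)))
      (Admissible.α< A) (Admissible.β< A) (Admissible.α< A′) (Admissible.β< A′)

    iso-reciprocal⇒ : ∀ {α β D E} {x₀ : Fin (N D)} {y₀ : Fin (N E)} →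
                      Coordinates d e α β E y₀ → (φ : Iso D (reciprocal E)) → Coordinates e d β α D x₀
    iso-reciprocal⇒ {x₀ = x₀} C φ = pull-back φ refl (swap-coordinates (Rebase.rebase d≤e C (proj₁ φ ⟨$⟩ʳ x₀)))

    Good : Dessin → Set
    Good D = Regular D × UnderlyingK D (p ℕ.^ d) (p ℕ.^ e)

    admissible : ∀ {D x₀} (K : Classified d e D x₀) → Admissible d e (Classified.α K) (Classified.β K)
    admissible K = record { α< = α< ; β< = β< ; α≡0 = α≡0 ; β≡0 = β≡0 ; α-kills = α-kills ; β-kills = β-kills }
      where
      open Classified K
      open Coordinates coordinates

    -- Every class has a representative with pᵉ black vertices of valency pᵈ, the other colouring
    -- being reached through the reciprocal. It remains to index pairs of multipliers so that each
    -- class occurs once, which `distinct′` secures against reciprocal coincidences.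
    count : ∀ k (α β : Fin k → ℕ) (A : ∀ i → Admissible d e (α i) (β i)) →
            (∀ i j → α i ≡ α j → β i ≡ β j → i ≡ j) →
            (∀ i j → Iso (modelOf (A i)) (reciprocal (modelOf (A j))) → i ≡ j) →
            (∀ D x₀ α β → Admissible d e α β → Coordinates d e α β D x₀ → ∃ λ i → SamePair D (modelOf (A i))) →
            ClassCount Dessin Good SamePair k
    count k α β A distinct distinct′ cover = (λ i → modelOf (A i)) ,
      (λ i → let x₀ , C = modelOf-coordinates (A i) in regular d≤e C , inj₂ (complete-bipartite C)) ,
      separate , represent
      where
      separate : ∀ i j → SamePair (modelOf (A i)) (modelOf (A j)) → i ≡ j
      separate i j (inj₁ φ) = let α≡ , β≡ = iso⇒same (A i) (A j) (proj₂ (modelOf-coordinates (A i))) (proj₂ (modelOf-coordinates (A j))) φ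
                              in distinct i j α≡ β≡
      separate i j (inj₂ φ) = distinct′ i j φ
      represent′ : ∀ D → Regular D → IsCompleteBipartite D (p ℕ.^ e) (p ℕ.^ d) → ∃ λ i → SamePair D (modelOf (A i))
      represent′ D R K = from (classified {d} {e} D R K x₀)
        where
        x₀ = proj₁ (proj₂ (proj₂ (proj₂ (proj₂ (proj₂ K)))) (fin e 0ℤ) (fin d 0ℤ))
        from : Classified d e D x₀ → ∃ λ i → SamePair D (modelOf (A i))
        from C = cover D x₀ (Classified.α C) (Classified.β C) (admissible C) (Classified.coordinates C)
      represent : ∀ D → Good D → ∃ λ i → SamePair D (modelOf (A i))
      represent D (R , inj₂ K) = represent′ D R K
      represent D (R , inj₁ K) = let i , s = represent′ (reciprocal D) (swap-regular D R) (swap-bipartite D K) in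
        i , same-pair-reciprocal D (modelOf (A i)) s

    iso-model : ∀ {α β α′ β′ D x₀} (A : Admissible d e α′ β′) → α ≡ α′ → β ≡ β′ → Coordinates d e α β D x₀ → Iso D (modelOf A)
    iso-model A refl refl C = iso C (proj₂ (modelOf-coordinates A))

  multiple≡0 : ∀ k s → + (p ℕ.^ k ℕ.* s) ≡ 0ℤ [ P ^ k ]
  multiple≡0 k s = ⇒0[] (+ s) (trans (ℤ.pos-* (p ℕ.^ k) s) (cong (_* + s) (pos-^ k)))

  p*≡0 : ∀ s → + (p ℕ.* s) ≡ 0ℤ [ P ]
  p*≡0 s = ⇒0[] (+ s) (ℤ.pos-* p s)

  kills : ∀ {d e} α → d ℕ.≤ e → + α * P ^ e ≡ 0ℤ [ P ^ d ]
  kills {d} {e} α d≤e = ^-weaken d≤e (⇒0[] (+ α) (ℤ.*-comm (+ α) (P ^ e)))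

  quotient : ∀ k {l x} → + x ≡ 0ℤ [ P ^ k ] → x ℕ.< p ℕ.^ k ℕ.* l → ∃ λ (s : Fin l) → x ≡ p ℕ.^ k ℕ.* toℕ s
  quotient k {l} {x} x≡0 x< = from (0[]⇒∣ ([p^]⇒ k x≡0))
    where
    from : p ℕ.^ k ∣ x → ∃ λ (s : Fin l) → x ≡ p ℕ.^ k ℕ.* toℕ s
    from (divides s refl) = Fin.fromℕ< s< , trans (ℕ.*-comm s (p ℕ.^ k)) (cong (p ℕ.^ k ℕ.*_) (sym (Fin.toℕ-fromℕ< s<)))
      where
      s< : s ℕ.< l
      s< = ℕ.*-cancelˡ-< (p ℕ.^ k) s l (subst (ℕ._< p ℕ.^ k ℕ.* l) (ℕ.*-comm s (p ℕ.^ k)) x<)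

  quotient-p : ∀ {l x} → + x ≡ 0ℤ [ P ] → x ℕ.< p ℕ.* l → ∃ λ (s : Fin l) → x ≡ p ℕ.* toℕ s
  quotient-p {l} {x} x≡0 x< = let s , eq = quotient 1 {l} (modP x≡0) (subst (λ q → x ℕ.< q ℕ.* l) (sym (ℕ.*-identityʳ p)) x<) in
    s , trans eq (cong (ℕ._* toℕ s) (ℕ.*-identityʳ p))

  cyclic-case : ∀ e → ClassCount Dessin (Good {0} {e} ℕ.z≤n) SamePair 1
  cyclic-case e = count ℕ.z≤n 1 (λ _ → 0) (λ _ → 0) (λ _ → A) (λ { Fin.zero Fin.zero _ _ → refl }) (λ { Fin.zero Fin.zero _ → refl })
    λ D x₀ α β A′ C → Fin.zero , inj₁ (iso-model ℕ.z≤n A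
      -- For d = 0 the condition α pᵈ ≡ 0 modulo pᵉ itself says that α vanishes.
      (residue-unique e (Admissible.α< A′) (0<p^ e) (subst (λ t → t ≡ 0ℤ [ P ^ e ]) (ℤ.*-identityʳ (+ α)) (Admissible.α-kills A′)))
      (ℕ.n<1⇒n≡0 (Admissible.β< A′)) C)
    where
    A : Admissible 0 e 0 0
    A = record { α< = 0<p^ e ; β< = ℕ.s≤s ℕ.z≤n ; α≡0 = ≡-refl ; β≡0 = ≡-refl ; α-kills = ≡⇒≡[] refl ; β-kills = ≡⇒≡[] refl }

  module Unequal (d r : ℕ) where
    private
      e = suc r ℕ.+ suc d

    d≤e : suc d ℕ.≤ e
    d≤e = ℕ.m≤n+m (suc d) (suc r)

    private
      d<e : suc d ℕ.< e
      d<e = ℕ.s≤s (ℕ.m≤n+m (suc d) r)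

      pᵉ : p ℕ.^ suc r ℕ.* p ℕ.^ suc d ≡ p ℕ.^ e
      pᵉ = sym (ℕ.^-distribˡ-+-* p (suc r) (suc d))

      Pᵉ : P ^ e ≡ P ^ suc r * P ^ suc d
      Pᵉ = ℤ.^-distribˡ-+-* P (suc r) (suc d)

      -- With black valency p^(suc d), the condition `α-kills` says that p^(suc r) divides α, which
      -- leaves p^(suc d) residues modulo pᵉ. For β divisibility by p is the only restriction and
      -- leaves p^d residues.
      α β : Fin (p ℕ.^ suc d) × Fin (p ℕ.^ d) → ℕ
      α (s , t) = p ℕ.^ suc r ℕ.* toℕ s
      β (s , t) = p ℕ.* toℕ t

      A : ∀ q → Admissible (suc d) e (α q) (β q)
      A (s , t) = record
        { α<      = subst (α (s , t) ℕ.<_) pᵉ (ℕ.*-monoʳ-< (p ℕ.^ suc r) ⦃ ℕ.m^n≢0 p (suc r) ⦄ (Fin.toℕ<n s))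
        ; β<      = ℕ.*-monoʳ-< p (Fin.toℕ<n t)
        ; α≡0     = modP⁻ r (multiple≡0 (suc r) (toℕ s))
        ; β≡0     = p*≡0 (toℕ t)
        ; α-kills = subst (λ m → + α (s , t) * P ^ suc d ≡ 0ℤ [ m ]) (sym Pᵉ)
                      (⇒0[] (+ toℕ s) (trans (cong (_* P ^ suc d) (trans (ℤ.pos-* (p ℕ.^ suc r) (toℕ s)) (cong (_* + toℕ s) (pos-^ (suc r)))))
                        (lem (P ^ suc r) (+ toℕ s) (P ^ suc d))))
        ; β-kills = kills (β (s , t)) d≤e
        }
        where
        lem : ∀ m s n → m * s * n ≡ m * n * s
        lem = solve-∀

      α-quotient : ∀ x → + x * P ^ suc d ≡ 0ℤ [ P ^ e ] → + x ≡ 0ℤ [ P ^ suc r ]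
      α-quotient x eq = from (0[]⇒ eq)
        where
        from : (∃ λ q → + x * P ^ suc d ≡ P ^ e * q) → + x ≡ 0ℤ [ P ^ suc r ]
        from (q , e≡) = ⇒0[] q (ℤ.*-cancelˡ-≡ (P ^ suc d) (+ x) (P ^ suc r * q) ⦃ P^-nonZero (suc d) ⦄
          (trans (ℤ.*-comm (P ^ suc d) (+ x)) (trans e≡ (trans (cong (_* q) Pᵉ) (lem (P ^ suc r) (P ^ suc d) q)))))
          where
          lem : ∀ m n q → m * n * q ≡ n * (m * q)
          lem = solve-∀

      distinct : ∀ q q′ → α q ≡ α q′ → β q ≡ β q′ → q ≡ q′
      distinct (s , t) (s′ , t′) α≡ β≡ = cong₂ _,_
        (Fin.toℕ-injective (ℕ.*-cancelˡ-≡ (toℕ s) (toℕ s′) (p ℕ.^ suc r) ⦃ ℕ.m^n≢0 p (suc r) ⦄ α≡))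
        (Fin.toℕ-injective (ℕ.*-cancelˡ-≡ (toℕ t) (toℕ t′) p β≡))

      -- Valencies decide: by an isomorphism with a reciprocal, a could return only after multiples
      -- of pᵉ, yet it returns after p^(suc d) steps.
      distinct′ : ∀ q q′ → Iso (modelOf (A q)) (reciprocal (modelOf (A q′))) → q ≡ q′
      distinct′ q q′ φ = contradiction
        (p^∣⇒≤ e (0<p^ (suc d)) (CoordinateProperties.a-fixed⇒ C′ (p ℕ.^ suc d) x₀ (CoordinateProperties.a-fixed⇐ C (p ℕ.^ suc d) x₀ (p^≡0 (suc d)))))
        (ℕ.<⇒≱ (ℕ.^-monoʳ-< p p>1 d<e))
        where
        p>1 : 1 ℕ.< p
        p>1 = ℕ.nonTrivial⇒n>1 p ⦃ Data.Nat.Primality.prime⇒nonTrivial p-prime ⦄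
        x₀ = proj₁ (modelOf-coordinates (A q))
        C = proj₂ (modelOf-coordinates (A q))
        C′ : Coordinates e (suc d) (β q′) (α q′) (modelOf (A q)) x₀
        C′ = iso-reciprocal⇒ d≤e (proj₂ (modelOf-coordinates (A q′))) φ

      pairs : Fin (p ℕ.^ suc d ℕ.* p ℕ.^ d) → Fin (p ℕ.^ suc d) × Fin (p ℕ.^ d)
      pairs = remQuot {p ℕ.^ suc d} (p ℕ.^ d)

      pairs-injective : ∀ i j → pairs i ≡ pairs j → i ≡ j
      pairs-injective i j eq = trans (sym (Fin.combine-remQuot {p ℕ.^ suc d} (p ℕ.^ d) i))
        (trans (cong (λ (s , t) → combine s t) eq) (Fin.combine-remQuot {p ℕ.^ suc d} (p ℕ.^ d) j))

      cover : ∀ D x₀ α′ β′ → Admissible (suc d) e α′ β′ → Coordinates (suc d) e α′ β′ D x₀ → ∃ λ i → SamePair D (modelOf (A (pairs i)))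
      cover D x₀ α′ β′ A′ C = from (quotient (suc r) (α-quotient α′ α-kills) (subst (α′ ℕ.<_) (sym pᵉ) α<)) (quotient-p β≡0 β<)
        where
        open Admissible A′
        from : (∃ λ (s : Fin (p ℕ.^ suc d)) → α′ ≡ p ℕ.^ suc r ℕ.* toℕ s) → (∃ λ (t : Fin (p ℕ.^ d)) → β′ ≡ p ℕ.* toℕ t) →
               ∃ λ i → SamePair D (modelOf (A (pairs i)))
        from (s , α≡) (t , β≡) = combine s t , inj₁ (iso-model d≤e (A (pairs (combine s t)))
          (trans α≡ (cong α (sym (Fin.remQuot-combine s t)))) (trans β≡ (cong β (sym (Fin.remQuot-combine s t)))) C)

    unequal-case : ClassCount Dessin (Good {suc d} {e} d≤e) SamePair (p ℕ.^ suc d ℕ.* p ℕ.^ d)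
    unequal-case = count d≤e (p ℕ.^ suc d ℕ.* p ℕ.^ d) (λ i → α (pairs i)) (λ i → β (pairs i)) (λ i → A (pairs i))
      (λ i j α≡ β≡ → pairs-injective i j (distinct (pairs i) (pairs j) α≡ β≡))
      (λ i j φ → pairs-injective i j (distinct′ (pairs i) (pairs j) φ))
      cover

  triangular : ℕ → ℕ
  triangular zero    = 0
  triangular (suc q) = suc q ℕ.+ triangular q

  2*triangular : ∀ q → 2 ℕ.* triangular q ≡ q ℕ.* (1 ℕ.+ q)
  2*triangular zero    = refl
  2*triangular (suc q) = trans (ℕ.*-distribˡ-+ 2 (suc q) (triangular q)) (trans (cong (2 ℕ.* suc q ℕ.+_) (2*triangular q)) (lem q))
    where
    lem : ∀ q → 2 ℕ.* (1 ℕ.+ q) ℕ.+ q ℕ.* (1 ℕ.+ q) ≡ (1 ℕ.+ q) ℕ.* (1 ℕ.+ (1 ℕ.+ q))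
    lem = ℕSolver.solve-∀

  mutual
    -- Encodes multisets of two numbers below q by their sorted forms s ≤ t, in blocks by the larger
    -- number; for d = e these multisets are the reciprocal pairs.
    ordered-pair : ∀ q → Fin (triangular q) → ℕ × ℕ
    ordered-pair (suc q) i = ordered-pair′ q (splitAt (suc q) i)

    ordered-pair′ : ∀ q → Fin (suc q) ⊎ Fin (triangular q) → ℕ × ℕ
    ordered-pair′ q (inj₁ s) = toℕ s , q
    ordered-pair′ q (inj₂ j) = ordered-pair q j

  mutual
    ordered-pair-≤ : ∀ q i → proj₁ (ordered-pair q i) ℕ.≤ proj₂ (ordered-pair q i) × proj₂ (ordered-pair q i) ℕ.< q
    ordered-pair-≤ (suc q) i = ordered-pair-≤′ q (splitAt (suc q) i)

    ordered-pair-≤′ : ∀ q x → proj₁ (ordered-pair′ q x) ℕ.≤ proj₂ (ordered-pair′ q x) × proj₂ (ordered-pair′ q x) ℕ.< suc q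
    ordered-pair-≤′ q (inj₁ s) = ℕ.s≤s⁻¹ (Fin.toℕ<n s) , ℕ.≤-refl
    ordered-pair-≤′ q (inj₂ j) = let s≤t , t<q = ordered-pair-≤ q j in s≤t , ℕ.m<n⇒m<1+n t<q

  mutual
    ordered-pair-injective : ∀ q i j → ordered-pair q i ≡ ordered-pair q j → i ≡ j
    ordered-pair-injective (suc q) i j eq = trans (sym (Fin.join-splitAt (suc q) (triangular q) i))
      (trans (cong (join (suc q) (triangular q)) (ordered-pair-injective′ q (splitAt (suc q) i) (splitAt (suc q) j) eq))
        (Fin.join-splitAt (suc q) (triangular q) j))

    ordered-pair-injective′ : ∀ q x y → ordered-pair′ q x ≡ ordered-pair′ q y → x ≡ y
    ordered-pair-injective′ q (inj₁ s) (inj₁ t) eq = cong inj₁ (Fin.toℕ-injective (cong proj₁ eq))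
    ordered-pair-injective′ q (inj₁ s) (inj₂ j) eq = contradiction (cong proj₂ (sym eq)) (ℕ.<⇒≢ (proj₂ (ordered-pair-≤ q j)))
    ordered-pair-injective′ q (inj₂ i) (inj₁ t) eq = contradiction (cong proj₂ eq) (ℕ.<⇒≢ (proj₂ (ordered-pair-≤ q i)))
    ordered-pair-injective′ q (inj₂ i) (inj₂ j) eq = cong inj₂ (ordered-pair-injective q i j eq)

  ordered-pair-surjective : ∀ q s t → s ℕ.≤ t → t ℕ.< q → ∃ λ i → ordered-pair q i ≡ (s , t)
  ordered-pair-surjective (suc q) s t s≤t t<q = from (ℕ.m≤n⇒m<n∨m≡n (ℕ.s≤s⁻¹ t<q))
    where
    at : ∀ x → ordered-pair (suc q) (join (suc q) (triangular q) x) ≡ ordered-pair′ q x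
    at x = cong (ordered-pair′ q) (Fin.splitAt-join (suc q) (triangular q) x)
    from : t ℕ.< q ⊎ t ≡ q → ∃ λ i → ordered-pair (suc q) i ≡ (s , t)
    from (inj₁ t<q)  = let i , eq = ordered-pair-surjective q s t s≤t t<q in
      join (suc q) (triangular q) (inj₂ i) , trans (at (inj₂ i)) eq
    from (inj₂ refl) = join (suc q) (triangular q) (inj₁ (Fin.fromℕ< (ℕ.s≤s s≤t))) ,
      trans (at (inj₁ (Fin.fromℕ< (ℕ.s≤s s≤t)))) (cong (_, t) (Fin.toℕ-fromℕ< (ℕ.s≤s s≤t)))

  module Equal (d : ℕ) where
    private
      e = suc d
      q = p ℕ.^ d

      α β : ℕ × ℕ → ℕ
      α (s , t) = p ℕ.* s
      β (s , t) = p ℕ.* t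

      A : ∀ s t → s ℕ.< q → t ℕ.< q → Admissible e e (p ℕ.* s) (p ℕ.* t)
      A s t s<q t<q = record
        { α<      = ℕ.*-monoʳ-< p s<q
        ; β<      = ℕ.*-monoʳ-< p t<q
        ; α≡0     = p*≡0 s
        ; β≡0     = p*≡0 t
        ; α-kills = kills {e} {e} (p ℕ.* s) ℕ.≤-refl
        ; β-kills = kills {e} {e} (p ℕ.* t) ℕ.≤-refl
        }

      pair : Fin (triangular q) → ℕ × ℕ
      pair = ordered-pair q

      Aᵢ : ∀ i → Admissible e e (α (pair i)) (β (pair i))
      Aᵢ i = let s≤t , t<q = ordered-pair-≤ q i in A (proj₁ (pair i)) (proj₂ (pair i)) (ℕ.≤-<-trans s≤t t<q) t<q

      cancel-p : ∀ {s t} → p ℕ.* s ≡ p ℕ.* t → s ≡ t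
      cancel-p {s} {t} = ℕ.*-cancelˡ-≡ s t p

      distinct : ∀ i j → α (pair i) ≡ α (pair j) → β (pair i) ≡ β (pair j) → i ≡ j
      distinct i j α≡ β≡ = ordered-pair-injective q i j (cong₂ _,_ (cancel-p α≡) (cancel-p β≡))

      -- Reciprocity exchanges the two multipliers, and a sorted pair whose exchange is again sorted
      -- has equal entries.
      distinct′ : ∀ i j → Iso (modelOf (Aᵢ i)) (reciprocal (modelOf (Aᵢ j))) → i ≡ j
      distinct′ i j φ = from (multipliers-unique C C′ (α< (Aᵢ i)) (β< (Aᵢ i)) (β< (Aᵢ j)) (α< (Aᵢ j)))
        where
        open Admissible
        x₀ = proj₁ (modelOf-coordinates (Aᵢ i))
        C = proj₂ (modelOf-coordinates (Aᵢ i))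
        C′ : Coordinates e e (β (pair j)) (α (pair j)) (modelOf (Aᵢ i)) x₀
        C′ = iso-reciprocal⇒ ℕ.≤-refl (proj₂ (modelOf-coordinates (Aᵢ j))) φ
        from : α (pair i) ≡ β (pair j) × β (pair i) ≡ α (pair j) → i ≡ j
        from (α≡ , β≡) = ordered-pair-injective q i j (cong₂ _,_ s≡s′ (trans t≡s′ (trans (sym s≡s′) s≡t′)))
          where
          s≡t′ : proj₁ (pair i) ≡ proj₂ (pair j)
          s≡t′ = cancel-p α≡
          t≡s′ : proj₂ (pair i) ≡ proj₁ (pair j)
          t≡s′ = cancel-p β≡
          s≡s′ : proj₁ (pair i) ≡ proj₁ (pair j)
          s≡s′ = ℕ.≤-antisym (ℕ.≤-trans (proj₁ (ordered-pair-≤ q i)) (ℕ.≤-reflexive t≡s′))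
            (ℕ.≤-trans (proj₁ (ordered-pair-≤ q j)) (ℕ.≤-reflexive (sym s≡t′)))

      cover-≤ : ∀ D x₀ s t → s ℕ.≤ t → t ℕ.< q → Coordinates e e (p ℕ.* s) (p ℕ.* t) D x₀ → ∃ λ i → Iso D (modelOf (Aᵢ i))
      cover-≤ D x₀ s t s≤t t<q C = let i , eq = ordered-pair-surjective q s t s≤t t<q in
        i , iso-model ℕ.≤-refl (Aᵢ i) (cong α (sym eq)) (cong β (sym eq)) C

      cover : ∀ D x₀ α′ β′ → Admissible e e α′ β′ → Coordinates e e α′ β′ D x₀ → ∃ λ i → SamePair D (modelOf (Aᵢ i))
      cover D x₀ α′ β′ A′ C = from (quotient-p α≡0 α<) (quotient-p β≡0 β<)
        where
        open Admissible A′
        from : (∃ λ (s : Fin q) → α′ ≡ p ℕ.* toℕ s) → (∃ λ (t : Fin q) → β′ ≡ p ℕ.* toℕ t) → ∃ λ i → SamePair D (modelOf (Aᵢ i))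
        from (s , α≡) (t , β≡) = by-cases (ℕ.≤-total (toℕ s) (toℕ t))
          where
          C′ : Coordinates e e (p ℕ.* toℕ s) (p ℕ.* toℕ t) D x₀
          C′ = subst₂ (λ α β → Coordinates e e α β D x₀) α≡ β≡ C
          by-cases : toℕ s ℕ.≤ toℕ t ⊎ toℕ t ℕ.≤ toℕ s → ∃ λ i → SamePair D (modelOf (Aᵢ i))
          by-cases (inj₁ s≤t) = let i , φ = cover-≤ D x₀ (toℕ s) (toℕ t) s≤t (Fin.toℕ<n t) C′ in i , inj₁ φ
          by-cases (inj₂ t≤s) = let i , φ = cover-≤ (reciprocal D) x₀ (toℕ t) (toℕ s) t≤s (Fin.toℕ<n s) (swap-coordinates C′) in
            i , inj₂ (swap-isoˡ D (modelOf (Aᵢ i)) φ)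

    equal-case : ClassCount Dessin (Good {e} {e} ℕ.≤-refl) SamePair (triangular q)
    equal-case = count ℕ.≤-refl (triangular q) (λ i → α (pair i)) (λ i → β (pair i)) Aᵢ distinct distinct′ cover

  type-and-genus : ∀ {d e} → d ℕ.≤ e → (D : Dessin) → Regular D → IsCompleteBipartite D (p ℕ.^ e) (p ℕ.^ d) →
    HasType D (p ℕ.^ d) (p ℕ.^ e) (p ℕ.^ e) × ∃ λ g → Genus D g × 2 ℕ.* g ≡ (p ℕ.^ d ℕ.∸ 1) ℕ.* (p ℕ.^ e ℕ.∸ 2)
  type-and-genus {d} {e} d≤e D R K = from (classified {d} {e} D R K x₀)
    where
    x₀ = proj₁ (proj₂ (proj₂ (proj₂ (proj₂ (proj₂ K)))) (fin e 0ℤ) (fin d 0ℤ))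
    from : Classified d e D x₀ →
      HasType D (p ℕ.^ d) (p ℕ.^ e) (p ℕ.^ e) × ∃ λ g → Genus D g × 2 ℕ.* g ≡ (p ℕ.^ d ℕ.∸ 1) ℕ.* (p ℕ.^ e ℕ.∸ 2)
    from C = has-type d≤e (Classified.coordinates C) , genus d≤e (Classified.coordinates C)

open import Defs
open import Data.Nat using (ℕ; suc; _+_; _*_; _∸_; _^_; _<_; _≤_; _%_; _/_; s≤s)
open import Relation.Binary.PropositionalEquality using (_≡_; refl; sym; trans; cong; cong₂; subst)

-- The enumeration in the three cases, with type and genus

odd⇒1+2* : ∀ p → p % 2 ≡ 1 → p ≡ 1 + 2 * (p / 2)
odd⇒1+2* p eq = trans (m≡m%n+[m/n]*n p 2) (cong₂ _+_ eq (ℕ.*-comm (p / 2) 2))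

power-split : ∀ p d → p ^ suc d * p ^ d ≡ p ^ (2 * suc d ∸ 1)
power-split p d = trans (sym (ℕ.^-distribˡ-+-* p (suc d) d)) (cong (p ^_) (sym exponent))
  where
  exponent : d + (suc d + 0) ≡ suc d + d
  exponent = trans (cong (d +_) (ℕ.+-identityʳ (suc d))) (ℕ.+-comm d (suc d))

theorem1p1 : (p d e : ℕ) → Prime p → p % 2 ≡ 1 → d ≤ e →
    ((d ≡ 0 →
        ClassCount Dessin (λ D → Regular D × UnderlyingK D (p ^ d) (p ^ e)) SamePair 1)
    × (0 < d → d ≡ e → ∃ λ ν →
        ClassCount Dessin (λ D → Regular D × UnderlyingK D (p ^ d) (p ^ e)) SamePair ν
        × 2 * ν ≡ p ^ (e ∸ 1) * (1 + p ^ (e ∸ 1)))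
    × (0 < d → d < e →
        ClassCount Dessin (λ D → Regular D × UnderlyingK D (p ^ d) (p ^ e)) SamePair
          (p ^ (2 * d ∸ 1))))
    × ((D : Dessin) → Regular D → IsCompleteBipartite D (p ^ e) (p ^ d) →
        HasType D (p ^ d) (p ^ e) (p ^ e)
        × ∃ λ g → Genus D g × 2 * g ≡ (p ^ d ∸ 1) * (p ^ e ∸ 2))
theorem1p1 p d e p-prime p%2 d≤e = (zero-case , equal , unequal d e) , type-and-genus d≤e
  where
  open Counting p (p / 2) (odd⇒1+2* p p%2) p-prime

  Count : ℕ → ℕ → ℕ → Set
  Count d e = ClassCount Dessin (λ D → Regular D × UnderlyingK D (p ^ d) (p ^ e)) SamePair

  zero-case : d ≡ 0 → Count d e 1
  zero-case refl = cyclic-case e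

  equal : 0 < d → d ≡ e → ∃ λ ν → Count d e ν × 2 * ν ≡ p ^ (e ∸ 1) * (1 + p ^ (e ∸ 1))
  equal (s≤s {n = d′} _) refl = triangular (p ^ d′) , Equal.equal-case d′ , 2*triangular (p ^ d′)

  unequal : ∀ d e → 0 < d → d < e → Count d e (p ^ (2 * d ∸ 1))
  unequal (suc d) e _ d<e = subst (λ e → Count (suc d) e (p ^ (2 * suc d ∸ 1))) e≡
    (subst (Count (suc d) (suc r + suc d)) (power-split p d) (Unequal.unequal-case d r))
    where
    -- One less than the positive gap between the exponents, so that e = suc r + suc d.
    r = e ∸ suc (suc d)
    e≡ : suc r + suc d ≡ e
    e≡ = trans (sym (ℕ.+-suc r (suc d))) (ℕ.m∸n+n≡m d<e)
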